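{- Let $q$ be a prime power, $F=\mathbb{F}_q$, and $n\ge 3$. Let $\mathcal{C}\subset\mathcal{Q}_n$ be a set of quadratic forms with $\operatorname{wt}(\mathcal{C})\ge 3$. Then $|\mathcal{C}|<q^{(n-1)(n-2)/2}$.
   Context: $\mathcal{Q}_n$ is the $F$-vector space of homogeneous polynomials of degree $2$ in $x_1,\ldots,x_n$ with coefficients in $F$ (quadratic forms), and $\mathcal{L}_n$ the space of homogeneous polynomials of degree $1$ (linear forms). The weight $\operatorname{wt}(Q)$ of a non-zero $Q\in\mathcal{Q}_n$ is the smallest $k$ such that $Q=\ell_1\ell_1'+\cdots+\ell_k\ell_k'$ with $\ell_i,\ell_i'\in\mathcal{L}_n$. For a set $\mathcal{C}\subset\mathcal{Q}_n$, $\operatorname{wt}(\mathcal{C})=\min\{\operatorname{wt}(Q-Q'): Q,Q'\in\mathcal{C},\ Q\ne Q'\}$. -}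

module Defs where

open import Level using (Level; _⊔_)
open import Algebra.Bundles using (CommutativeRing)
open import Data.Nat using (ℕ; _<_; _^_)
open import Data.Nat.Primality using (Prime)
open import Data.Fin as Fin using (Fin)
open import Data.Vec using (Vec; []; _∷_)
open import Data.List using (List)
open import Data.List.Membership.Propositional using (_∈_)
open import Data.List.Relation.Unary.AllPairs using (AllPairs)
open import Data.Product using (_×_; _,_; ∃; Σ)
open import Relation.Nullary using (¬_; yes; no)
open import Relation.Binary.PropositionalEquality as ≡ using (_≡_)
open import Function.Bundles using (Inverse)

IsPrimePower : ℕ → Set
IsPrimePower q = Σ ℕ λ p → Σ ℕ λ k → Prime p × (1 Data.Nat.≤ k) × (q ≡ p ^ k)

module _ {c ℓ : Level} (R : CommutativeRing c ℓ) where
  open CommutativeRing R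

  IsField : Set (c ⊔ ℓ)
  IsField = (¬ (1# ≈ 0#)) × (∀ x → ¬ (x ≈ 0#) → ∃ λ y → x * y ≈ 1#)

  HasCardinality : ℕ → Set (c ⊔ ℓ)
  HasCardinality q = Inverse setoid (≡.setoid (Fin q))

  LinForm : ℕ → Set c
  LinForm n = Fin n → Carrier

  -- Quadratic forms in n variables: Q = Σ_{i ≤ j} Q i j · x_i x_j;
  -- only the entries with i ≤ j are meaningful.
  QForm : ℕ → Set c
  QForm n = Fin n → Fin n → Carrier

  _≈Q_ : ∀ {n} → QForm n → QForm n → Set ℓ
  Q ≈Q Q' = ∀ i j → i Fin.≤ j → Q i j ≈ Q' i j

  0Q : ∀ {n} → QForm n
  0Q i j = 0#

  _+Q_ : ∀ {n} → QForm n → QForm n → QForm n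
  (Q +Q Q') i j = Q i j + Q' i j

  _-Q_ : ∀ {n} → QForm n → QForm n → QForm n
  (Q -Q Q') i j = Q i j - Q' i j

  -- the product of two linear forms, as a quadratic form:
  -- coefficient of x_i^2 is a_i b_i, of x_i x_j (i < j) is a_i b_j + a_j b_i
  mulL : ∀ {n} → LinForm n → LinForm n → QForm n
  mulL a b i j with i Fin.≟ j
  ... | yes _ = a i * b i
  ... | no _  = a i * b j + a j * b i

  sumProds : ∀ {n k} → Vec (LinForm n × LinForm n) k → QForm n
  sumProds [] = 0Q
  sumProds ((a , b) ∷ ps) = mulL a b +Q sumProds ps

  SumOfProducts : ∀ {n} → ℕ → QForm n → Set (c ⊔ ℓ)
  SumOfProducts {n} k Q = ∃ λ (ps : Vec (LinForm n × LinForm n) k) → Q ≈Q sumProds ps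

  -- wt(Q) ≥ m  (wt(Q) = least k with Q a sum of k products)
  WtAtLeast : ∀ {n} → ℕ → QForm n → Set (c ⊔ ℓ)
  WtAtLeast m Q = ∀ k → k < m → ¬ SumOfProducts k Q

  -- a finite set of quadratic forms, given as a duplicate-free list
  DistinctForms : ∀ {n} → List (QForm n) → Set (c ⊔ ℓ)
  DistinctForms = AllPairs (λ Q Q' → ¬ (Q ≈Q Q'))

  CodeWtAtLeast : ∀ {n} → ℕ → List (QForm n) → Set (c ⊔ ℓ)
  CodeWtAtLeast m C = ∀ Q Q' → Q ∈ C → Q' ∈ C → ¬ (Q ≈Q Q') → WtAtLeast m (Q -Q Q')

{-# OPTIONS --safe #-}

-- Consider two convolution operators on integer-valued functions f of a quadratic form P in n variables:
--   Tf(P) = Σ f(P + ab) over pairs of linear forms a, b, and Θf(P) = Σ f(P + N(κ)) over linear forms κ = a + ωb over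
-- the quadratic extension F(ω), whose norm N(κ) = a² + ab - db² is again a sum of two products.
-- Since N ⊕ (-N) is hyperbolic and -1 is a norm, Θ² = T². Every nonzero norm is attained q + 1 times, so Θ ≡ 1 mod q + 1;
-- hence on functions with T = q^k the eigenvalue ±q^k of Θ must be (-q)^k.
-- If |C| ≥ q^((n-1)(n-2)/2), counting shows that C meets each coset of aL + bL (a, b independent linear forms) exactly
-- once. This gives (T - q^n)(T - q^(n+1)) χ = constant for the indicator χ of C, so that up to constants χ is a
-- combination of a T-eigenfunction for q^n and one for q^(n+1), and Θχ is determined by χ and Tχ. But no two
-- elements of C differ by a nonzero form of weight ≤ 2, so at a point of C Θχ = 1 and Tχ = 2q^n - 1, and these values
-- are incompatible when n ≥ 3.

module Submission where

-- Behind the two operators stands Fourier analysis. Convolutions on the space of quadratic forms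
-- are diagonalised together by its additive characters, which correspond to symmetric bilinear
-- forms B on the linear forms. If B has rank r, the eigenvalue of T is q^(2n-r) and that of Θ is
-- (-q)^(2n-r). The equation for χ says that its transform lives on the ranks 0, n-1 and n; the sign
-- (-1)^r, invisible to T, is the extra information that Θ supplies. Characters need roots of unity,
-- so they are avoided: polynomials in T applied to χ replace the projections, and the sign is read
-- off modulo q + 1, where -q is 1. This keeps every function integer-valued. The norm form x² + xy
-- - dy² is used instead of x² - dy² because it also gives a separable extension in characteristic
-- 2, so that no case distinction on the characteristic is needed. With x = q^n, the last step ends
-- in (x - 1)(x - q²) = 0 or (x - q)² = 0 according to the parity of n. These equations do hold for
-- n = 2 and n = 1.

open import Defs
open import Level using (Level; _⊔_)
open import Algebra.Bundles using (CommutativeRing; RawRing)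
open import Data.Empty using (⊥)
open import Data.Fin as Fin using (Fin)
import Data.Fin.Properties as Finₚ
open import Data.List using (List; []; _∷_; _++_; map; length; cartesianProductWith; allFin; tabulate)
import Data.List.Properties as Listₚ
open import Data.List.Membership.Propositional using (_∈_; find; lose)
import Data.List.Relation.Unary.All as All
open import Data.List.Relation.Unary.AllPairs using ([]; _∷_)
open import Data.List.Relation.Unary.Any as Any using (Any; any?; here; there)
open import Data.Maybe using (Maybe; just; nothing)
open import Data.Nat as ℕ using (ℕ; zero; suc)
open import Data.Nat.DivMod using (m*n/n≡m)
import Data.Nat.Properties as ℕₚ
import Data.Nat.Tactic.RingSolver as ℕ-solver
open import Data.Product using (_×_; _,_; proj₁; proj₂; ∃)
open import Data.Product.Relation.Binary.Pointwise.NonDependent using (×-setoid)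
open import Data.Sum using (_⊎_; inj₁; inj₂)
open import Data.Vec using ([]; _∷_)
open import Data.Vec.Functional as Vector using ()
import Data.Vec.Functional.Relation.Binary.Equality.Setoid as VecEq
open import Function using (_∘_)
open import Function.Bundles using (Inverse)
open import Relation.Binary.Bundles using (Setoid)
open import Relation.Binary.Definitions using (Decidable)
open import Relation.Binary.PropositionalEquality as ≡ using (_≡_)
import Relation.Binary.Reasoning.Setoid as SetoidReasoning
open import Relation.Nullary using (Dec; yes; no; ¬_; contradiction)

-- A ring solver with integer coefficients, represented as differences of natural numbers

module DifferenceSolver {c ℓ : Level} (R : CommutativeRing c ℓ) where
  open CommutativeRing R
  open import Algebra.Properties.Semiring.Mult semiring using (×-homo-+; ×1-homo-*) renaming (_×_ to _×ₙ_)
  open import Algebra.Properties.Ring ring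
  open import Algebra.Properties.AbelianGroup +-abelianGroup using (⁻¹-∙-comm)
  open import Algebra.Properties.CommutativeSemigroup +-commutativeSemigroup using (interchange)
  open import Algebra.Solver.Ring.AlmostCommutativeRing
  open import Relation.Binary.Reasoning.Setoid setoid

  reduce : ℕ × ℕ → ℕ × ℕ
  reduce (a , b) = a ℕ.∸ b , b ℕ.∸ a

  -- The solver compares normal forms definitionally, so coefficients are kept
  -- reduced, with one of the two components equal to 0.
  Difference : RawRing _ _
  Difference = record
    { Carrier = ℕ × ℕ
    ; _≈_ = _≡_
    ; _+_ = λ { (a , b) (a′ , b′) → reduce (a ℕ.+ a′ , b ℕ.+ b′) }
    ; _*_ = λ { (a , b) (a′ , b′) → reduce (a ℕ.* a′ ℕ.+ b ℕ.* b′ , a ℕ.* b′ ℕ.+ b ℕ.* a′) }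
    ; -_ = λ { (a , b) → b , a }
    ; 0# = 0 , 0
    ; 1# = 1 , 0
    }

  ⟦_⟧ᵈ : ℕ × ℕ → Carrier
  ⟦ a , b ⟧ᵈ = a ×ₙ 1# - b ×ₙ 1#

  -‿interchange : ∀ x y z w → (x + y) - (z + w) ≈ (x - z) + (y - w)
  -‿interchange x y z w = begin
    (x + y) - (z + w)       ≈⟨ +-congˡ (⁻¹-∙-comm z w) ⟨
    (x + y) + (- z + - w)   ≈⟨ interchange x y (- z) (- w) ⟩
    (x - z) + (y - w)       ∎

  *-difference : ∀ x y z w → (x - y) * (z - w) ≈ (x * z + y * w) - (x * w + y * z)
  *-difference x y z w = begin
    (x - y) * (z - w)                          ≈⟨ distribʳ (z - w) x (- y) ⟩
    x * (z - w) + - y * (z - w)                ≈⟨ +-cong (distribˡ x z (- w)) (distribˡ (- y) z (- w)) ⟩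
    (x * z + x * - w) + (- y * z + - y * - w)  ≈⟨ +-cong (+-congˡ (sym (-‿distribʳ-* x w))) (+-cong (sym (-‿distribˡ-* y z)) minus-minus) ⟩
    (x * z - x * w) + (- (y * z) + y * w)      ≈⟨ +-congˡ (+-comm _ _) ⟩
    (x * z - x * w) + (y * w - y * z)          ≈⟨ -‿interchange (x * z) (y * w) (x * w) (y * z) ⟨
    (x * z + y * w) - (x * w + y * z)          ∎
    where
    minus-minus : - y * - w ≈ y * w
    minus-minus = begin
      - y * - w      ≈⟨ -‿distribˡ-* y (- w) ⟨
      - (y * - w)    ≈⟨ -‿cong (-‿distribʳ-* y w) ⟨
      - (- (y * w))  ≈⟨ -‿involutive (y * w) ⟩
      y * w          ∎

  -- Adding `b′` to both components on the left and `b` to both components on the right changes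
  -- neither value and makes the two differences agree.
  ⟦⟧ᵈ-cong : ∀ a b a′ b′ → a ℕ.+ b′ ≡ a′ ℕ.+ b → ⟦ a , b ⟧ᵈ ≈ ⟦ a′ , b′ ⟧ᵈ
  ⟦⟧ᵈ-cong a b a′ b′ eq = begin
    ⟦ a , b ⟧ᵈ                                   ≈⟨ cancel a b b′ ⟨
    (a ×ₙ 1# + b′ ×ₙ 1#) - (b ×ₙ 1# + b′ ×ₙ 1#)
      ≈⟨ +-cong (trans (sym (×-homo-+ 1# a b′)) (trans (reflexive (≡.cong (_×ₙ 1#) eq)) (×-homo-+ 1# a′ b)))
                (-‿cong (+-comm _ _)) ⟩
    (a′ ×ₙ 1# + b ×ₙ 1#) - (b′ ×ₙ 1# + b ×ₙ 1#)  ≈⟨ cancel a′ b′ b ⟩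
    ⟦ a′ , b′ ⟧ᵈ                                 ∎
    where
    cancel : ∀ a b m → (a ×ₙ 1# + m ×ₙ 1#) - (b ×ₙ 1# + m ×ₙ 1#) ≈ ⟦ a , b ⟧ᵈ
    cancel a b m = trans (-‿interchange _ _ _ _) (trans (+-congˡ (-‿inverseʳ (m ×ₙ 1#))) (+-identityʳ _))

  reduce-homo : ∀ x → ⟦ reduce x ⟧ᵈ ≈ ⟦ x ⟧ᵈ
  reduce-homo (a , b) = ⟦⟧ᵈ-cong (a ℕ.∸ b) (b ℕ.∸ a) a b (a∸b+b≡a+b∸a a b)
    where
    a∸b+b≡a+b∸a : ∀ a b → a ℕ.∸ b ℕ.+ b ≡ a ℕ.+ (b ℕ.∸ a)
    a∸b+b≡a+b∸a zero zero = ≡.refl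
    a∸b+b≡a+b∸a zero (suc b) = ≡.refl
    a∸b+b≡a+b∸a (suc a) zero = ≡.refl
    a∸b+b≡a+b∸a (suc a) (suc b) = ≡.trans (ℕₚ.+-suc (a ℕ.∸ b) b) (≡.cong suc (a∸b+b≡a+b∸a a b))

  morphism : Difference -Raw-AlmostCommutative⟶ fromCommutativeRing R
  morphism = record
    { ⟦_⟧ = ⟦_⟧ᵈ
    ; +-homo = λ { (a , b) (a′ , b′) → trans (reduce-homo (a ℕ.+ a′ , b ℕ.+ b′)) (trans
        (+-cong (×-homo-+ 1# a a′) (-‿cong (×-homo-+ 1# b b′))) (-‿interchange _ _ _ _)) }
    ; *-homo = λ { (a , b) (a′ , b′) → begin
        ⟦ reduce (a ℕ.* a′ ℕ.+ b ℕ.* b′ , a ℕ.* b′ ℕ.+ b ℕ.* a′) ⟧ᵈ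
          ≈⟨ reduce-homo (a ℕ.* a′ ℕ.+ b ℕ.* b′ , a ℕ.* b′ ℕ.+ b ℕ.* a′) ⟩
        ⟦ a ℕ.* a′ ℕ.+ b ℕ.* b′ , a ℕ.* b′ ℕ.+ b ℕ.* a′ ⟧ᵈ
          ≈⟨ +-cong (×1-+* a a′ b b′) (-‿cong (×1-+* a b′ b a′)) ⟩
        _ ≈⟨ *-difference _ _ _ _ ⟨
        ⟦ a , b ⟧ᵈ * ⟦ a′ , b′ ⟧ᵈ ∎ }
    ; -‿homo = λ { (a , b) → begin
        b ×ₙ 1# - a ×ₙ 1#         ≈⟨ +-comm _ _ ⟩
        - (a ×ₙ 1#) + b ×ₙ 1#     ≈⟨ +-congˡ (-‿involutive _) ⟨
        - (a ×ₙ 1#) - - (b ×ₙ 1#) ≈⟨ ⁻¹-∙-comm _ _ ⟩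
        - ⟦ a , b ⟧ᵈ              ∎ }
    ; 0-homo = -‿inverseʳ 0#
    ; 1-homo = trans (+-cong (+-identityʳ 1#) -0#≈0#) (+-identityʳ 1#)
    }
    where
    ×1-+* : ∀ a b c d → (a ℕ.* b ℕ.+ c ℕ.* d) ×ₙ 1# ≈ (a ×ₙ 1#) * (b ×ₙ 1#) + (c ×ₙ 1#) * (d ×ₙ 1#)
    ×1-+* a b c d = trans (×-homo-+ 1# (a ℕ.* b) (c ℕ.* d)) (+-cong (×1-homo-* a b) (×1-homo-* c d))

  _≟ᵈ_ : ∀ x y → Maybe (⟦ x ⟧ᵈ ≈ ⟦ y ⟧ᵈ)
  (a , b) ≟ᵈ (a′ , b′) with a ℕ.+ b′ ℕ.≟ a′ ℕ.+ b
  ... | yes eq = just (⟦⟧ᵈ-cong a b a′ b′ eq)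
  ... | no _ = nothing

  open import Algebra.Solver.Ring Difference (fromCommutativeRing R) morphism _≟ᵈ_ public
    using (solve; _:=_; _:+_; _:*_; _:-_; :-_)

open import Data.Integer using (ℤ; -[1+_]; ∣_∣; _^_; _+_; _*_; _-_; -_; _≤_; +≤+; 0ℤ; 1ℤ) renaming (+_ to pos)
import Data.Integer.Properties as ℤₚ
open import Data.Integer.Tactic.RingSolver using (solve-∀)
open ≡ using (refl; sym; trans; cong; cong₂)

-- Sums over enumerated finite setoids

private variable
  a b ℓ₁ ℓ₂ : Level
  A : Set a
  B : Set b

[_] : {P : Set a} → Dec P → ℤ
[ yes _ ] = 1ℤ
[ no _ ] = 0ℤ

[]-yes : {P : Set a} (P? : Dec P) → P → [ P? ] ≡ 1ℤ
[]-yes (yes _) _ = refl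
[]-yes (no ¬p) p = contradiction p ¬p

[]-no : {P : Set a} (P? : Dec P) → ¬ P → [ P? ] ≡ 0ℤ
[]-no (yes p) ¬p = contradiction p ¬p
[]-no (no _) _ = refl

[]-cong : {P : Set a} {Q : Set b} (P? : Dec P) (Q? : Dec Q) → (P → Q) → (Q → P) → [ P? ] ≡ [ Q? ]
[]-cong (yes p) Q? to from = sym ([]-yes Q? (to p))
[]-cong (no ¬p) Q? to from = sym ([]-no Q? (¬p ∘ from))

[]-nonneg : {P : Set a} (P? : Dec P) → 0ℤ ≤ [ P? ]
[]-nonneg (yes _) = +≤+ ℕ.z≤n
[]-nonneg (no _) = ℤₚ.≤-refl

infixr 5 ∑
∑ : List A → (A → ℤ) → ℤ
∑ [] f = 0ℤ
∑ (x ∷ xs) f = f x + ∑ xs f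

syntax ∑ xs (λ x → e) = ∑[ x ∈ xs ] e

module _ {A : Set a} where

  ∑-cong : ∀ (xs : List A) {f g} → (∀ x → f x ≡ g x) → ∑ xs f ≡ ∑ xs g
  ∑-cong [] eq = refl
  ∑-cong (x ∷ xs) eq = cong₂ _+_ (eq x) (∑-cong xs eq)

  ∑-mono : ∀ (xs : List A) {f g} → (∀ x → f x ≤ g x) → ∑ xs f ≤ ∑ xs g
  ∑-mono [] le = ℤₚ.≤-refl
  ∑-mono (x ∷ xs) le = ℤₚ.+-mono-≤ (le x) (∑-mono xs le)

  ∑-const : ∀ (xs : List A) k → (∑[ x ∈ xs ] k) ≡ pos (length xs) * k
  ∑-const [] k = sym (ℤₚ.*-zeroˡ k)
  ∑-const (x ∷ xs) k = trans (cong (k +_) (∑-const xs k)) (sym (ℤₚ.suc-* (pos (length xs)) k))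

  ∑-+ : ∀ (xs : List A) f g → (∑[ x ∈ xs ] (f x + g x)) ≡ ∑ xs f + ∑ xs g
  ∑-+ [] f g = refl
  ∑-+ (x ∷ xs) f g = trans (cong ((f x + g x) +_) (∑-+ xs f g)) (interchange (f x) (g x) (∑ xs f) (∑ xs g))
    where
    interchange : ∀ u v s t → (u + v) + (s + t) ≡ (u + s) + (v + t)
    interchange = solve-∀

  ∑-*ˡ : ∀ (xs : List A) k f → (∑[ x ∈ xs ] k * f x) ≡ k * ∑ xs f
  ∑-*ˡ [] k f = sym (ℤₚ.*-zeroʳ k)
  ∑-*ˡ (x ∷ xs) k f = trans (cong (k * f x +_) (∑-*ˡ xs k f)) (sym (ℤₚ.*-distribˡ-+ k (f x) (∑ xs f)))

  ∑-*ʳ : ∀ (xs : List A) k f → (∑[ x ∈ xs ] f x * k) ≡ ∑ xs f * k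
  ∑-*ʳ xs k f = trans (∑-cong xs λ x → ℤₚ.*-comm (f x) k) (trans (∑-*ˡ xs k f) (ℤₚ.*-comm k _))

  ∑-- : ∀ (xs : List A) f g → (∑[ x ∈ xs ] (f x - g x)) ≡ ∑ xs f - ∑ xs g
  ∑-- [] f g = refl
  ∑-- (x ∷ xs) f g = trans (cong ((f x - g x) +_) (∑-- xs f g)) (interchange (f x) (g x) (∑ xs f) (∑ xs g))
    where
    interchange : ∀ u v s t → (u - v) + (s - t) ≡ (u + s) - (v + t)
    interchange = solve-∀

  ∑-++ : ∀ (xs ys : List A) f → ∑ (xs ++ ys) f ≡ ∑ xs f + ∑ ys f
  ∑-++ [] ys f = sym (ℤₚ.+-identityˡ _)
  ∑-++ (x ∷ xs) ys f = trans (cong (f x +_) (∑-++ xs ys f)) (sym (ℤₚ.+-assoc (f x) _ _))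

∑-zero : ∀ (xs : List A) → (∑[ x ∈ xs ] 0ℤ) ≡ 0ℤ
∑-zero xs = trans (∑-const xs 0ℤ) (ℤₚ.*-zeroʳ (pos (length xs)))

∑-map : ∀ (h : A → B) xs f → ∑ (map h xs) f ≡ ∑ xs (f ∘ h)
∑-map h [] f = refl
∑-map h (x ∷ xs) f = cong (f (h x) +_) (∑-map h xs f)

∑-swap : ∀ (xs : List A) (ys : List B) (f : A → B → ℤ) →
  (∑[ x ∈ xs ] ∑[ y ∈ ys ] f x y) ≡ (∑[ y ∈ ys ] ∑[ x ∈ xs ] f x y)
∑-swap [] ys f = sym (∑-zero ys)
∑-swap (x ∷ xs) ys f = trans (cong (∑ ys (f x) +_) (∑-swap xs ys f)) (sym (∑-+ ys (f x) (λ y → ∑[ x ∈ xs ] f x y)))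

∑-cartesian : ∀ {C : Set ℓ₁} (h : A → B → C) xs ys f →
  ∑ (cartesianProductWith h xs ys) f ≡ (∑[ x ∈ xs ] ∑[ y ∈ ys ] f (h x y))
∑-cartesian h [] ys f = refl
∑-cartesian h (x ∷ xs) ys f = trans (∑-++ (map (h x) ys) (cartesianProductWith h xs ys) f)
  (cong₂ _+_ (∑-map (h x) ys f) (∑-cartesian h xs ys f))

-- `once` expresses completeness and absence of repetition, both up to `_≈_`, in one equation. As a
-- sum it can serve directly as a delta function when sums are interchanged.
record Enumeration (S : Setoid a ℓ₁) : Set (a ⊔ ℓ₁) where
  open Setoid S
  field
    elements : List Carrier
    _≟_      : Decidable _≈_
    once     : ∀ x → (∑[ y ∈ elements ] [ y ≟ x ]) ≡ 1ℤ

  size : ℕ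
  size = length elements

Respects : (S : Setoid a ℓ₁) → (Setoid.Carrier S → ℤ) → Set (a ⊔ ℓ₁)
Respects S f = ∀ {x y} → Setoid._≈_ S x y → f x ≡ f y

module Sift {S : Setoid a ℓ₁} (E : Enumeration S) where
  open Setoid S using (Carrier; _≈_)
  open Enumeration E

  sift : ∀ {f} → Respects S f → ∀ x → (∑[ y ∈ elements ] [ y ≟ x ] * f y) ≡ f x
  sift {f} resp x = trans (∑-cong elements pointwise)
    (trans (∑-*ʳ elements (f x) (λ y → [ y ≟ x ])) (trans (cong (_* f x) (once x)) (ℤₚ.*-identityˡ (f x))))
    where
    pointwise : ∀ y → [ y ≟ x ] * f y ≡ [ y ≟ x ] * f x
    pointwise y with y ≟ x
    ... | yes y≈x = cong (1ℤ *_) (resp y≈x)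
    ... | no _ = refl

  term≤∑ : ∀ {f} → Respects S f → (∀ x → 0ℤ ≤ f x) → ∀ x → f x ≤ ∑ elements f
  term≤∑ {f} resp f≥0 x = ℤₚ.≤-trans (ℤₚ.≤-reflexive (sym (sift resp x))) (∑-mono elements pointwise)
    where
    pointwise : ∀ y → [ y ≟ x ] * f y ≤ f y
    pointwise y with y ≟ x
    ... | yes _ = ℤₚ.≤-reflexive (ℤₚ.*-identityˡ (f y))
    ... | no _ = f≥0 y

  ∑-single : ∀ {f} → Respects S f → ∀ x → (∀ y → ¬ (y ≈ x) → f y ≡ 0ℤ) → ∑ elements f ≡ f x
  ∑-single {f} resp x zero-elsewhere = trans (∑-cong elements pointwise) (sift resp x)
    where
    pointwise : ∀ y → f y ≡ [ y ≟ x ] * f y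
    pointwise y with y ≟ x
    ... | yes _ = sym (ℤₚ.*-identityˡ (f y))
    ... | no y≉x = zero-elsewhere y y≉x

  -- All terms of `g - f` are nonnegative and their sum is not positive, so each of them vanishes.
  ∑-tight : ∀ {f g} → Respects S f → Respects S g → (∀ x → f x ≤ g x) → ∑ elements g ≤ ∑ elements f →
    ∀ x → f x ≡ g x
  ∑-tight {f} {g} f-resp g-resp f≤g ∑g≤∑f x = ℤₚ.≤-antisym (f≤g x) (ℤₚ.i-j≤0⇒i≤j
    (ℤₚ.≤-trans (term≤∑ (λ x≈y → cong₂ _-_ (g-resp x≈y) (f-resp x≈y)) (λ y → ℤₚ.i≤j⇒0≤j-i (f≤g y)) x)
      (ℤₚ.≤-trans (ℤₚ.≤-reflexive (∑-- elements g f)) (ℤₚ.i≤j⇒i-j≤0 ∑g≤∑f))))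

module _ {S : Setoid a ℓ₁} {T : Setoid b ℓ₂} (E : Enumeration S) (F : Enumeration T) where
  private
    module S = Setoid S
    module T = Setoid T
    module E = Enumeration E
    module F = Enumeration F

  -- The two hypotheses make `φ` and `ψ` mutually inverse and compatible with the equalities. In
  -- this form they turn the delta function of `φ x` at `y` into that of `ψ y` at `x`, so that
  -- interchanging the double sum suffices.
  ∑-reindex : (φ : S.Carrier → T.Carrier) (ψ : T.Carrier → S.Carrier) →
    (∀ x y → y T.≈ φ x → x S.≈ ψ y) → (∀ x y → x S.≈ ψ y → y T.≈ φ x) →
    ∀ {f} → Respects T f → ∑ E.elements (f ∘ φ) ≡ ∑ F.elements f
  ∑-reindex φ ψ to from {f} resp = begin
    (∑[ x ∈ E.elements ] f (φ x))
      ≡⟨ ∑-cong E.elements (λ x → sym (Sift.sift F resp (φ x))) ⟩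
    (∑[ x ∈ E.elements ] ∑[ y ∈ F.elements ] [ y F.≟ φ x ] * f y)
      ≡⟨ ∑-swap E.elements F.elements _ ⟩
    (∑[ y ∈ F.elements ] ∑[ x ∈ E.elements ] [ y F.≟ φ x ] * f y)
      ≡⟨ ∑-cong F.elements inner ⟩
    ∑ F.elements f ∎
    where
    open ≡.≡-Reasoning
    inner : ∀ y → (∑[ x ∈ E.elements ] [ y F.≟ φ x ] * f y) ≡ f y
    inner y = trans (∑-*ʳ E.elements (f y) (λ x → [ y F.≟ φ x ]))
      (trans (cong (_* f y) (trans (∑-cong E.elements λ x → []-cong (y F.≟ φ x) (x E.≟ ψ y) (to x y) (from x y)) (E.once (ψ y))))
        (ℤₚ.*-identityˡ (f y)))

  ×-enumeration : Enumeration (×-setoid S T)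
  ×-enumeration = record
    { elements = cartesianProductWith _,_ E.elements F.elements
    ; _≟_ = _≟_
    ; once = λ { (x , y) → begin
        ∑ (cartesianProductWith _,_ E.elements F.elements) (λ z → [ z ≟ (x , y) ])
          ≡⟨ ∑-cartesian _,_ E.elements F.elements _ ⟩
        (∑[ x′ ∈ E.elements ] ∑[ y′ ∈ F.elements ] [ (x′ , y′) ≟ (x , y) ])
          ≡⟨ ∑-cong E.elements (λ x′ → ∑-cong F.elements λ y′ → []-× (x′ E.≟ x) (y′ F.≟ y)) ⟩
        (∑[ x′ ∈ E.elements ] ∑[ y′ ∈ F.elements ] [ x′ E.≟ x ] * [ y′ F.≟ y ])
          ≡⟨ ∑-cong E.elements (λ x′ → trans (∑-*ˡ F.elements [ x′ E.≟ x ] (λ y′ → [ y′ F.≟ y ]))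
               (trans (cong ([ x′ E.≟ x ] *_) (F.once y)) (ℤₚ.*-identityʳ _))) ⟩
        (∑[ x′ ∈ E.elements ] [ x′ E.≟ x ])
          ≡⟨ E.once x ⟩
        1ℤ ∎ }
    }
    where
    open ≡.≡-Reasoning
    _≟_ : Decidable (Setoid._≈_ (×-setoid S T))
    (x , y) ≟ (x′ , y′) with x E.≟ x′ | y F.≟ y′
    ... | yes p | yes q = yes (p , q)
    ... | yes _ | no ¬q = no (¬q ∘ proj₂)
    ... | no ¬p | _     = no (¬p ∘ proj₁)
    []-× : ∀ {x x′ y y′} (P? : Dec (x S.≈ x′)) (Q? : Dec (y T.≈ y′)) → [ (x , y) ≟ (x′ , y′) ] ≡ [ P? ] * [ Q? ]
    []-× {x} {x′} {y} {y′} (yes p) (yes q) = []-yes ((x , y) ≟ (x′ , y′)) (p , q)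
    []-× {x} {x′} {y} {y′} (yes p) (no ¬q) = []-no ((x , y) ≟ (x′ , y′)) (¬q ∘ proj₂)
    []-× {x} {x′} {y} {y′} (no ¬p) Q? = []-no ((x , y) ≟ (x′ , y′)) (¬p ∘ proj₁)

  size-× : Enumeration.size ×-enumeration ≡ E.size ℕ.* F.size
  size-× = lengths E.elements
    where
    lengths : ∀ xs → length (cartesianProductWith _,_ xs F.elements) ≡ length xs ℕ.* F.size
    lengths [] = refl
    lengths (x ∷ xs) = trans (Listₚ.length-++ (map (x ,_) F.elements))
      (cong₂ ℕ._+_ (Listₚ.length-map (x ,_) F.elements) (lengths xs))

  ∑-× : ∀ f → ∑ (Enumeration.elements ×-enumeration) f ≡ (∑[ x ∈ E.elements ] ∑[ y ∈ F.elements ] f (x , y))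
  ∑-× = ∑-cartesian _,_ E.elements F.elements

module _ {S : Setoid a ℓ₁} (T : Setoid b ℓ₂) (E : Enumeration S) where
  private
    module S = Setoid S
    module T = Setoid T
    module E = Enumeration E

  transport-enumeration : (φ : S.Carrier → T.Carrier) (ψ : T.Carrier → S.Carrier) →
    (∀ x y → φ x T.≈ y → x S.≈ ψ y) → (∀ x y → x S.≈ ψ y → φ x T.≈ y) → Enumeration T
  transport-enumeration φ ψ to from = record
    { elements = map φ E.elements
    ; _≟_ = _≟_
    ; once = λ y → trans (∑-map φ E.elements (λ z → [ z ≟ y ]))
        (trans (∑-cong E.elements λ x → []-cong (φ x ≟ y) (x E.≟ ψ y) (to x y) (from x y)) (E.once (ψ y)))
    }
    where
    φψ : ∀ y → φ (ψ y) T.≈ y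
    φψ y = from (ψ y) y S.refl
    _≟_ : Decidable T._≈_
    y ≟ y′ with ψ y E.≟ ψ y′
    ... | yes p = yes (T.trans (T.sym (φψ y)) (from (ψ y) y′ p))
    ... | no ¬p = no λ y≈y′ → ¬p (to (ψ y) y′ (T.trans (φψ y) y≈y′))

  size-transport : ∀ φ ψ to from → Enumeration.size (transport-enumeration φ ψ to from) ≡ E.size
  size-transport φ ψ to from = Listₚ.length-map φ E.elements

Fin-enumeration : ∀ n → Enumeration (≡.setoid (Fin n))
Fin-enumeration n = record { elements = allFin n ; _≟_ = Fin._≟_ ; once = once }
  where
  once : ∀ {n} (i : Fin n) → (∑[ j ∈ allFin n ] [ j Fin.≟ i ]) ≡ 1ℤ
  suc-once : ∀ {n} (i : Fin (suc n)) → (∑[ j ∈ tabulate Fin.suc ] [ j Fin.≟ i ]) ≡ (∑[ j ∈ allFin n ] [ Fin.suc j Fin.≟ i ])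
  suc-once {n} i = trans (cong (λ js → ∑[ j ∈ js ] [ j Fin.≟ i ]) (sym (Listₚ.map-tabulate (λ j → j) Fin.suc)))
    (∑-map Fin.suc (allFin n) _)
  once {suc n} Fin.zero = cong (1ℤ +_) (trans (suc-once {n} Fin.zero) (∑-zero (allFin n)))
  once {suc n} (Fin.suc i) = trans (ℤₚ.+-identityˡ _) (trans (suc-once (Fin.suc i))
    (trans (∑-cong (allFin n) λ j → []-cong (Fin.suc j Fin.≟ Fin.suc i) (j Fin.≟ i) Finₚ.suc-injective (cong Fin.suc)) (once i)))

module _ {S : Setoid a ℓ₁} (E : Enumeration S) where
  private
    module S = Setoid S
    open VecEq S using (≋-setoid)

    cons : ∀ {n} → S.Carrier × (Fin n → S.Carrier) → Fin (suc n) → S.Carrier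
    cons (x , v) = x Vector.∷ v

    uncons : ∀ {n} → (Fin (suc n) → S.Carrier) → S.Carrier × (Fin n → S.Carrier)
    uncons v = v Fin.zero , v ∘ Fin.suc

    cons-to : ∀ {n} (xv : S.Carrier × (Fin n → S.Carrier)) w → (∀ i → cons xv i S.≈ w i) →
      Setoid._≈_ (×-setoid S (≋-setoid n)) xv (uncons w)
    cons-to xv w eq = eq Fin.zero , λ i → eq (Fin.suc i)

    cons-from : ∀ {n} (xv : S.Carrier × (Fin n → S.Carrier)) w →
      Setoid._≈_ (×-setoid S (≋-setoid n)) xv (uncons w) → ∀ i → cons xv i S.≈ w i
    cons-from xv w (eq , eqs) Fin.zero = eq
    cons-from xv w (eq , eqs) (Fin.suc i) = eqs i

  vector-enumeration : ∀ n → Enumeration (≋-setoid n)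
  vector-enumeration zero = record
    { elements = Vector.[] ∷ []
    ; _≟_ = λ _ _ → yes λ ()
    ; once = λ _ → refl
    }
  vector-enumeration (suc n) = transport-enumeration (≋-setoid (suc n)) (×-enumeration E (vector-enumeration n))
    cons uncons cons-to cons-from

  size-vector : ∀ n → Enumeration.size (vector-enumeration n) ≡ Enumeration.size E ℕ.^ n
  size-vector zero = refl
  size-vector (suc n) = trans (size-transport (≋-setoid (suc n)) (×-enumeration E (vector-enumeration n)) cons uncons cons-to cons-from)
    (trans (size-× E (vector-enumeration n)) (cong (Enumeration.size E ℕ.*_) (size-vector n)))

  ∑-vector-suc : ∀ n f → ∑ (Enumeration.elements (vector-enumeration (suc n))) f ≡
    (∑[ x ∈ Enumeration.elements E ] ∑[ v ∈ Enumeration.elements (vector-enumeration n) ] f (x Vector.∷ v))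
  ∑-vector-suc n f = trans (∑-map cons (Enumeration.elements (×-enumeration E (vector-enumeration n))) f)
    (∑-× E (vector-enumeration n) (f ∘ cons))

-- Functions with values 0 and 1: exhaustive search and counting by injections

Binary : ℤ → Set
Binary k = k ≡ 0ℤ ⊎ k ≡ 1ℤ

[]-binary : {P : Set a} (P? : Dec P) → Binary [ P? ]
[]-binary (yes _) = inj₂ refl
[]-binary (no _) = inj₁ refl

[]≡1⇒ : {P : Set a} (P? : Dec P) → [ P? ] ≡ 1ℤ → P
[]≡1⇒ (yes p) _ = p

module _ {S : Setoid a ℓ₁} (E : Enumeration S) where
  open Setoid S using (Carrier; _≈_)
  open Enumeration E
  open Sift E

  ∑-binary : ∀ {p} (xs : List Carrier) → (∀ x → Binary (p x)) → ∑ xs p ≡ 0ℤ ⊎ ∃ λ x → p x ≡ 1ℤ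
  ∑-binary [] bin = inj₁ refl
  ∑-binary (x ∷ xs) bin with bin x
  ... | inj₂ px≡1 = inj₂ (x , px≡1)
  ... | inj₁ px≡0 with ∑-binary xs bin
  ...   | inj₁ eq = inj₁ (cong₂ _+_ px≡0 eq)
  ...   | inj₂ found = inj₂ found

  -- Only the listed representatives are inspected. If the indicators sum to 0, nonnegativity of the
  -- terms excludes every element, listed or not.
  search : ∀ {p} {P : Carrier → Set p} (P? : ∀ x → Dec (P x)) → (∀ {x y} → x ≈ y → P x → P y) →
    (∃ P) ⊎ (∀ x → ¬ P x)
  search {P = P} P? resp with ∑-binary elements (λ x → []-binary (P? x))
  ... | inj₂ (x , eq) = inj₁ (x , []≡1⇒ (P? x) eq)
  ... | inj₁ ∑≡0 = inj₂ λ x Px → contradiction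
          (ℤₚ.≤-trans (ℤₚ.≤-reflexive (sym ([]-yes (P? x) Px)))
            (ℤₚ.≤-trans (term≤∑ respects (λ y → []-nonneg (P? y)) x) (ℤₚ.≤-reflexive ∑≡0)))
          λ { (+≤+ ()) }
    where
    respects : Respects S (λ x → [ P? x ])
    respects x≈y = []-cong (P? _) (P? _) (resp x≈y) (resp (Setoid.sym S x≈y))

  ∑-atMostOne : ∀ {p} → Respects S p → (∀ x → Binary (p x)) → (∀ x y → p x ≡ 1ℤ → p y ≡ 1ℤ → x ≈ y) →
    ∑ elements p ≤ 1ℤ
  ∑-atMostOne {p} resp bin unique with ∑-binary elements bin
  ... | inj₁ eq = ℤₚ.≤-trans (ℤₚ.≤-reflexive eq) (+≤+ ℕ.z≤n)
  ... | inj₂ (x , px≡1) = ℤₚ.≤-reflexive (trans (∑-single resp x elsewhere) px≡1)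
    where
    elsewhere : ∀ y → ¬ (y ≈ x) → p y ≡ 0ℤ
    elsewhere y y≉x with bin y
    ... | inj₁ py≡0 = py≡0
    ... | inj₂ py≡1 = contradiction (unique y x py≡1 px≡1) y≉x

module _ {S : Setoid a ℓ₁} {T : Setoid b ℓ₂} (E : Enumeration S) (F : Enumeration T) where
  private
    module S = Setoid S
    module T = Setoid T
    module E = Enumeration E
    module F = Enumeration F

  -- The sum is split according to the value of `h`; each fibre contains at most one point where `p`
  -- is 1.
  ∑-injective : ∀ {p} (h : S.Carrier → T.Carrier) → (∀ {x y} → x S.≈ y → h x T.≈ h y) →
    Respects S p → (∀ x → Binary (p x)) → (∀ x y → p x ≡ 1ℤ → p y ≡ 1ℤ → h x T.≈ h y → x S.≈ y) →
    ∑ E.elements p ≤ pos F.size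
  ∑-injective {p} h h-cong resp bin inj = begin
    ∑ E.elements p
      ≡⟨ ∑-cong E.elements (λ x → trans (sym (ℤₚ.*-identityʳ (p x)))
           (trans (cong (p x *_) (sym (F.once (h x)))) (sym (∑-*ˡ F.elements (p x) _)))) ⟩
    (∑[ x ∈ E.elements ] ∑[ y ∈ F.elements ] p x * [ y F.≟ h x ])
      ≡⟨ ∑-swap E.elements F.elements _ ⟩
    (∑[ y ∈ F.elements ] ∑[ x ∈ E.elements ] p x * [ y F.≟ h x ])
      ≤⟨ ∑-mono F.elements (λ y → ∑-atMostOne E (resp′ y) (bin′ y) (unique y)) ⟩
    (∑[ y ∈ F.elements ] 1ℤ)
      ≡⟨ trans (∑-const F.elements 1ℤ) (ℤₚ.*-identityʳ _) ⟩
    pos F.size ∎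
    where
    open ℤₚ.≤-Reasoning
    resp′ : ∀ y → Respects S (λ x → p x * [ y F.≟ h x ])
    resp′ y x≈x′ = cong₂ _*_ (resp x≈x′) ([]-cong (y F.≟ h _) (y F.≟ h _)
      (λ eq → T.trans eq (h-cong x≈x′)) (λ eq → T.trans eq (T.sym (h-cong x≈x′))))
    bin′ : ∀ y x → Binary (p x * [ y F.≟ h x ])
    bin′ y x with bin x | []-binary (y F.≟ h x)
    ... | inj₁ eq | _ = inj₁ (trans (cong (_* [ y F.≟ h x ]) eq) (ℤₚ.*-zeroˡ [ y F.≟ h x ]))
    ... | inj₂ _ | inj₁ eq = inj₁ (trans (cong (p x *_) eq) (ℤₚ.*-zeroʳ (p x)))
    ... | inj₂ eq | inj₂ eq′ = inj₂ (cong₂ _*_ eq eq′)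
    factors : ∀ y x → p x * [ y F.≟ h x ] ≡ 1ℤ → p x ≡ 1ℤ × y T.≈ h x
    factors y x eq with bin x | y F.≟ h x
    ... | inj₂ px≡1 | yes y≈hx = px≡1 , y≈hx
    ... | inj₂ px≡1 | no _ = contradiction (trans (sym eq) (ℤₚ.*-zeroʳ (p x))) λ ()
    ... | inj₁ px≡0 | d = contradiction (trans (sym eq) (trans (cong (_* [ d ]) px≡0) (ℤₚ.*-zeroˡ [ d ]))) λ ()
    unique : ∀ y x x′ → p x * [ y F.≟ h x ] ≡ 1ℤ → p x′ * [ y F.≟ h x′ ] ≡ 1ℤ → x S.≈ x′
    unique y x x′ eq eq′ with factors y x eq | factors y x′ eq′
    ... | px , y≈ | px′ , y≈′ = inj x x′ px px′ (T.trans (T.sym y≈) y≈′)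

-- The finite field and the norm form x² + xy - dy²

module FiniteField {c ℓ : Level} (R : CommutativeRing c ℓ) (q : ℕ) (isField : IsField R) (card : HasCardinality R q) where

  open CommutativeRing R public
    renaming ( Carrier to F; _+_ to _+ᶠ_; _*_ to _·_; _-_ to _-ᶠ_; -_ to -ᶠ_
             ; refl to ≈-refl; sym to ≈-sym; trans to ≈-trans; setoid to F-setoid
             ; +-cong to +ᶠ-cong; +-congˡ to +ᶠ-congˡ; +-congʳ to +ᶠ-congʳ; *-cong to ·-cong; *-congˡ to ·-congˡ; *-congʳ to ·-congʳ )
    using (_≈_; 0#; 1#; +-group; -‿cong; zeroˡ; zeroʳ; *-identityˡ; *-identityʳ; +-identityˡ; +-identityʳ; -‿inverseʳ; +-comm)
  open DifferenceSolver R public using (solve; _:=_; _:+_; _:*_; _:-_; :-_)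
  open import Algebra.Properties.Group +-group public using () renaming (x∙y⁻¹≈ε⇒x≈y to x-y≈0⇒x≈y)
  module ≈-Reasoning = SetoidReasoning F-setoid

  1≉0 : ¬ (1# ≈ 0#)
  1≉0 = proj₁ isField

  inverse : ∀ {x} → ¬ (x ≈ 0#) → ∃ λ y → x · y ≈ 1#
  inverse = proj₂ isField _

  F-enumeration : Enumeration F-setoid
  F-enumeration = transport-enumeration F-setoid (Fin-enumeration q) from to
    (λ i x eq → ≡.sym (inverseˡ (≈-sym eq))) (λ i x eq → inverseʳ eq)
    where open Inverse card

  open Enumeration F-enumeration public using (_≟_; once) renaming (elements to 𝔽)
  open Sift F-enumeration

  size-F : Enumeration.size F-enumeration ≡ q
  size-F = trans (Listₚ.length-map (Inverse.from card) (allFin q)) (Listₚ.length-tabulate (λ i → i))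

  ∑-const-F : ∀ k → (∑[ x ∈ 𝔽 ] k) ≡ pos q * k
  ∑-const-F k = trans (∑-const 𝔽 k) (cong (λ m → pos m * k) size-F)

  cancel-nonzero : ∀ {x y} → ¬ (x ≈ 0#) → x · y ≈ 0# → y ≈ 0#
  cancel-nonzero {x} {y} x≉0 xy≈0 with inverse x≉0
  ... | i , xi≈1 = begin
    y            ≈⟨ *-identityˡ y ⟨
    1# · y       ≈⟨ ·-congʳ xi≈1 ⟨
    (x · i) · y  ≈⟨ solve 3 (λ x i y → (x :* i) :* y := i :* (x :* y)) ≈-refl x i y ⟩
    i · (x · y)  ≈⟨ ·-congˡ xy≈0 ⟩
    i · 0#       ≈⟨ zeroʳ i ⟩
    0# ∎
    where open ≈-Reasoning

  -- x² + x takes the value 0 at both 0 and -1, so it is not injective on the finite field, hence not surjective.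
  nonsplit : ∃ λ d → ∀ x → ¬ (x · x +ᶠ x ≈ d)
  nonsplit with search F-enumeration unattained? unattained-resp
    where
    attained : ∀ d → (∃ λ x → d ≈ x · x +ᶠ x) ⊎ (∀ x → ¬ (d ≈ x · x +ᶠ x))
    attained d = search F-enumeration (λ x → d ≟ (x · x +ᶠ x))
      λ x≈y eq → ≈-trans eq (+ᶠ-cong (·-cong x≈y x≈y) x≈y)
    unattained? : ∀ d → Dec (∀ x → ¬ (x · x +ᶠ x ≈ d))
    unattained? d with attained d
    ... | inj₁ (x , eq) = no λ none → none x (≈-sym eq)
    ... | inj₂ none = yes λ x eq → none x (≈-sym eq)
    unattained-resp : ∀ {d e} → d ≈ e → (∀ x → ¬ (x · x +ᶠ x ≈ d)) → ∀ x → ¬ (x · x +ᶠ x ≈ e)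
    unattained-resp d≈e none x eq = none x (≈-trans eq (≈-sym d≈e))
  ... | inj₁ found = found
  ... | inj₂ surjective = contradiction (ℤₚ.≤-trans fibre-0≥2 (ℤₚ.≤-reflexive (sym (fibre≡1 0#)))) λ { (+≤+ (ℕ.s≤s ())) }
    where
    fibre : F → ℤ
    fibre d = ∑[ x ∈ 𝔽 ] [ d ≟ (x · x +ᶠ x) ]
    fibre-resp : Respects F-setoid fibre
    fibre-resp d≈e = ∑-cong 𝔽 λ x → []-cong (_ ≟ _) (_ ≟ _) (≈-trans (≈-sym d≈e)) (≈-trans d≈e)
    term-resp : ∀ d → Respects F-setoid (λ x → [ d ≟ (x · x +ᶠ x) ])
    term-resp d x≈y = []-cong (_ ≟ _) (_ ≟ _)
      (λ eq → ≈-trans eq (+ᶠ-cong (·-cong x≈y x≈y) x≈y))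
      (λ eq → ≈-trans eq (≈-sym (+ᶠ-cong (·-cong x≈y x≈y) x≈y)))
    fibre≥1 : ∀ d → 1ℤ ≤ fibre d
    fibre≥1 d with search F-enumeration (λ x → d ≟ (x · x +ᶠ x)) (λ x≈y eq → ≈-trans eq (+ᶠ-cong (·-cong x≈y x≈y) x≈y))
    ... | inj₁ (x , eq) = ℤₚ.≤-trans (ℤₚ.≤-reflexive (sym ([]-yes (d ≟ (x · x +ᶠ x)) eq)))
            (term≤∑ (term-resp d) (λ y → []-nonneg (d ≟ (y · y +ᶠ y))) x)
    ... | inj₂ none = contradiction (λ x eq → none x (≈-sym eq)) (surjective d)
    -- If x² + x were surjective, every fibre would have at least one element, while the q fibres
    -- have q elements in all. Hence every fibre would be a singleton, contrary to the two roots of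
    -- x² + x.
    fibre≡1 : ∀ d → 1ℤ ≡ fibre d
    fibre≡1 = ∑-tight (λ _ → refl) fibre-resp fibre≥1 (ℤₚ.≤-reflexive
      (trans (∑-swap 𝔽 𝔽 (λ d x → [ d ≟ (x · x +ᶠ x) ])) (∑-cong 𝔽 λ x → once (x · x +ᶠ x))))
    0≉-1 : ¬ (0# ≈ -ᶠ 1#)
    0≉-1 eq = 1≉0 (begin
      1#           ≈⟨ +-identityʳ 1# ⟨
      1# +ᶠ 0#     ≈⟨ +ᶠ-congˡ eq ⟩
      1# -ᶠ 1#     ≈⟨ -‿inverseʳ 1# ⟩
      0# ∎)
      where open ≈-Reasoning
    roots≤ : ∀ x → [ x ≟ 0# ] + [ x ≟ (-ᶠ 1#) ] ≤ [ 0# ≟ (x · x +ᶠ x) ]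
    roots≤ x with x ≟ 0# | x ≟ (-ᶠ 1#)
    ... | yes x≈0 | yes x≈-1 = contradiction (≈-trans (≈-sym x≈0) x≈-1) 0≉-1
    ... | yes x≈0 | no _ = ℤₚ.≤-reflexive (sym ([]-yes (0# ≟ (x · x +ᶠ x)) (≈-sym (begin
      x · x +ᶠ x    ≈⟨ +ᶠ-cong (·-congˡ x≈0) x≈0 ⟩
      x · 0# +ᶠ 0#  ≈⟨ +-identityʳ _ ⟩
      x · 0#        ≈⟨ zeroʳ x ⟩
      0# ∎))))
      where open ≈-Reasoning
    ... | no _ | yes x≈-1 = ℤₚ.≤-reflexive (sym ([]-yes (0# ≟ (x · x +ᶠ x)) (≈-sym (begin
      x · x +ᶠ x                ≈⟨ +ᶠ-congˡ (*-identityʳ x) ⟨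
      x · x +ᶠ x · 1#           ≈⟨ +ᶠ-congʳ (·-congˡ x≈-1) ⟩
      x · (-ᶠ 1#) +ᶠ x · 1#     ≈⟨ solve 2 (λ x u → x :* (:- u) :+ x :* u := x :* (u :- u)) ≈-refl x 1# ⟩
      x · (1# -ᶠ 1#)            ≈⟨ ·-congˡ (-‿inverseʳ 1#) ⟩
      x · 0#                    ≈⟨ zeroʳ x ⟩
      0# ∎))))
      where open ≈-Reasoning
    ... | no _ | no _ = []-nonneg (0# ≟ (x · x +ᶠ x))
    fibre-0≥2 : pos 2 ≤ fibre 0#
    fibre-0≥2 = begin
      pos 2                                        ≡⟨ cong₂ _+_ (once 0#) (once (-ᶠ 1#)) ⟨
      (∑[ x ∈ 𝔽 ] [ x ≟ 0# ]) + (∑[ x ∈ 𝔽 ] [ x ≟ (-ᶠ 1#) ])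
        ≡⟨ ∑-+ 𝔽 (λ x → [ x ≟ 0# ]) (λ x → [ x ≟ (-ᶠ 1#) ]) ⟨
      (∑[ x ∈ 𝔽 ] ([ x ≟ 0# ] + [ x ≟ (-ᶠ 1#) ]))    ≤⟨ ∑-mono 𝔽 roots≤ ⟩
      fibre 0# ∎
      where open ℤₚ.≤-Reasoning

  d : F
  d = proj₁ nonsplit

  norm : F → F → F
  norm x y = (x · x +ᶠ x · y) -ᶠ d · (y · y)

  -- If y is not 0, dividing by y² makes x/y a root of t² + t - d, which the choice of `d` excludes.
  -- If y is 0, what remains is x² = 0.
  norm-anisotropic : ∀ x y → norm x y ≈ 0# → x ≈ 0# × y ≈ 0#
  norm-anisotropic x y eq with y ≟ 0#
  ... | yes y≈0 = x≈0 , y≈0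
    where
    open ≈-Reasoning
    xx≈0 : x · x ≈ 0#
    xx≈0 = begin
      x · x                                 ≈⟨ solve 3 (λ x y d → x :* x := ((x :* x :+ x :* y) :- d :* (y :* y)) :+ (d :* y :- x) :* y) ≈-refl x y d ⟩
      norm x y +ᶠ (d · y -ᶠ x) · y          ≈⟨ +ᶠ-cong eq (·-congˡ y≈0) ⟩
      0# +ᶠ (d · y -ᶠ x) · 0#               ≈⟨ +ᶠ-congˡ (zeroʳ _) ⟩
      0# +ᶠ 0#                              ≈⟨ +-identityʳ 0# ⟩
      0# ∎
    x≈0 : x ≈ 0#
    x≈0 with x ≟ 0#
    ... | yes p = p
    ... | no x≉0 = cancel-nonzero x≉0 xx≈0
  ... | no y≉0 with inverse y≉0
  ...   | i , yi≈1 = contradiction (begin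
      (x · i) · (x · i) +ᶠ x · i
        ≈⟨ solve 4 (λ x y i d → (x :* i) :* (x :* i) :+ x :* i :=
             ((((x :* x :+ x :* y) :- d :* (y :* y)) :* (i :* i)) :+ (x :* i :- (x :* i) :* (y :* i))) :+ d :* ((y :* i) :* (y :* i))) ≈-refl x y i d ⟩
      ((norm x y · (i · i)) +ᶠ (x · i -ᶠ (x · i) · (y · i))) +ᶠ d · ((y · i) · (y · i))
        ≈⟨ +ᶠ-cong (+ᶠ-cong (·-congʳ eq) (+ᶠ-congˡ (-‿cong (·-congˡ yi≈1)))) (·-congˡ (·-cong yi≈1 yi≈1)) ⟩
      ((0# · (i · i)) +ᶠ (x · i -ᶠ (x · i) · 1#)) +ᶠ d · (1# · 1#)
        ≈⟨ +ᶠ-cong (+ᶠ-cong (zeroˡ _) (+ᶠ-congˡ (-‿cong (*-identityʳ _)))) (·-congˡ (*-identityʳ _)) ⟩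
      (0# +ᶠ (x · i -ᶠ x · i)) +ᶠ d · 1#
        ≈⟨ +ᶠ-cong (≈-trans (+-identityˡ _) (-‿inverseʳ _)) (*-identityʳ d) ⟩
      0# +ᶠ d
        ≈⟨ +-identityˡ d ⟩
      d ∎) (proj₂ nonsplit (x · i))
    where open ≈-Reasoning

  -- `1# +ᶠ 4d` is the discriminant of t² + t - d. In characteristic 2 it is just 1, so it can be
  -- inverted in every characteristic.
  4d : F
  4d = (d +ᶠ d) +ᶠ (d +ᶠ d)

  -- Otherwise 2d would be a (double) root of x² + x - d.
  discriminant≉0 : ¬ (1# +ᶠ 4d ≈ 0#)
  discriminant≉0 eq = proj₂ nonsplit (d +ᶠ d) (begin
    (d +ᶠ d) · (d +ᶠ d) +ᶠ (d +ᶠ d)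
      ≈⟨ +ᶠ-congˡ (*-identityʳ _) ⟨
    (d +ᶠ d) · (d +ᶠ d) +ᶠ (d +ᶠ d) · 1#
      ≈⟨ solve 2 (λ d u → (d :+ d) :* (d :+ d) :+ (d :+ d) :* u := d :* (u :+ ((d :+ d) :+ (d :+ d))) :+ d :* u) ≈-refl d 1# ⟩
    d · (1# +ᶠ 4d) +ᶠ d · 1#
      ≈⟨ +ᶠ-cong (≈-trans (·-congˡ eq) (zeroʳ d)) (*-identityʳ d) ⟩
    0# +ᶠ d
      ≈⟨ +-identityˡ d ⟩
    d ∎)
    where open ≈-Reasoning

  δ⁻¹ : F
  δ⁻¹ = proj₁ (inverse discriminant≉0)

  discriminant-cancel : ∀ x → (x +ᶠ 4d · x) · δ⁻¹ ≈ x
  discriminant-cancel x = begin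
    (x +ᶠ 4d · x) · δ⁻¹        ≈⟨ ·-congʳ (+ᶠ-congʳ (*-identityˡ x)) ⟨
    (1# · x +ᶠ 4d · x) · δ⁻¹   ≈⟨ solve 4 (λ u e x i → (u :* x :+ e :* x) :* i := x :* ((u :+ e) :* i)) ≈-refl 1# 4d x δ⁻¹ ⟩
    x · ((1# +ᶠ 4d) · δ⁻¹)     ≈⟨ ·-congˡ (proj₂ (inverse discriminant≉0)) ⟩
    x · 1#                     ≈⟨ *-identityʳ x ⟩
    x ∎
    where open ≈-Reasoning

-- The operators T and Θ

module QuadraticForms {c ℓ : Level} (R : CommutativeRing c ℓ) (q : ℕ) (isField : IsField R) (card : HasCardinality R q) where

  open FiniteField R q isField card public

  K : Set c
  K = F × F

  K-setoid : Setoid c ℓ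
  K-setoid = ×-setoid F-setoid F-setoid

  K-enumeration : Enumeration K-setoid
  K-enumeration = ×-enumeration F-enumeration F-enumeration

  L-setoid KV-setoid QForm-setoid : ℕ → Setoid c ℓ
  L-setoid = VecEq.≋-setoid F-setoid
  KV-setoid = VecEq.≋-setoid K-setoid
  QForm-setoid n = record
    { Carrier = QForm R n
    ; _≈_ = _≈Q_ R
    ; isEquivalence = record
      { refl = λ _ _ _ → ≈-refl
      ; sym = λ eq i j le → ≈-sym (eq i j le)
      ; trans = λ eq eq′ i j le → ≈-trans (eq i j le) (eq′ i j le)
      }
    }

  L-enumeration : ∀ n → Enumeration (L-setoid n)
  L-enumeration = vector-enumeration F-enumeration

  KV-enumeration : ∀ n → Enumeration (KV-setoid n)
  KV-enumeration = vector-enumeration K-enumeration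

  𝕂 : List K
  𝕂 = Enumeration.elements K-enumeration

  𝕃 : ∀ n → List (LinForm R n)
  𝕃 n = Enumeration.elements (L-enumeration n)

  𝕂𝕍 : ∀ n → List (Fin n → K)
  𝕂𝕍 n = Enumeration.elements (KV-enumeration n)

  infix 4 _≈q_
  _≈q_ : ∀ {n} → QForm R n → QForm R n → Set ℓ
  _≈q_ = _≈Q_ R

  infixl 6 _⊞_ _⊟_
  infixl 7 _⊙_ _•_
  _⊞_ _⊟_ : ∀ {n} → QForm R n → QForm R n → QForm R n
  _⊞_ = _+Q_ R
  _⊟_ = _-Q_ R

  _⊙_ : ∀ {n} → LinForm R n → LinForm R n → QForm R n
  _⊙_ = mulL R

  _•_ : ∀ {n} → F → QForm R n → QForm R n
  (s • Q) i j = s · Q i j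

  ⊙-cong : ∀ {n} {a a′ b b′ : LinForm R n} → (∀ i → a i ≈ a′ i) → (∀ i → b i ≈ b′ i) →
    ∀ i j → (a ⊙ b) i j ≈ (a′ ⊙ b′) i j
  ⊙-cong a≈ b≈ i j with i Fin.≟ j
  ... | yes _ = ·-cong (a≈ i) (b≈ i)
  ... | no _ = +ᶠ-cong (·-cong (a≈ i) (b≈ j)) (·-cong (a≈ j) (b≈ i))

  re im : ∀ {n} → (Fin n → K) → LinForm R n
  re κ i = proj₁ (κ i)
  im κ i = proj₂ (κ i)

  -- The norm x² + xy - dy² of the linear form x + ωy over the quadratic extension F(ω), ω² = ω + d.
  N : ∀ {n} → (Fin n → K) → QForm R n
  N κ = re κ ⊙ (λ i → re κ i +ᶠ im κ i) ⊞ (λ i → -ᶠ (d · im κ i)) ⊙ im κ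

  N-cong : ∀ {n} {κ λ′ : Fin n → K} → Setoid._≈_ (KV-setoid n) κ λ′ → ∀ i j → N κ i j ≈ N λ′ i j
  N-cong κ≈λ i j = +ᶠ-cong
    (⊙-cong (λ i → proj₁ (κ≈λ i)) (λ i → +ᶠ-cong (proj₁ (κ≈λ i)) (proj₂ (κ≈λ i))) i j)
    (⊙-cong (λ i → -‿cong (·-congˡ (proj₂ (κ≈λ i)))) (λ i → proj₂ (κ≈λ i)) i j)

  module _ {n : ℕ} where

    -- `T²` is the square of `T` with the four sums regrouped: for fixed a and b the inner sums run
    -- over the translate of P by aL + bL, the cosets on which a code is counted.
    T T² Θ : (QForm R n → ℤ) → QForm R n → ℤ
    T f P = ∑[ a ∈ 𝕃 n ] ∑[ b ∈ 𝕃 n ] f (P ⊞ a ⊙ b)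
    T² f P = ∑[ a ∈ 𝕃 n ] ∑[ b ∈ 𝕃 n ] ∑[ u ∈ 𝕃 n ] ∑[ v ∈ 𝕃 n ] f (P ⊞ a ⊙ u ⊞ b ⊙ v)
    Θ f P = ∑[ κ ∈ 𝕂𝕍 n ] f (P ⊞ N κ)

    ∑-re-im : ∀ {g : LinForm R n × LinForm R n → ℤ} → Respects (×-setoid (L-setoid n) (L-setoid n)) g →
      (∑[ κ ∈ 𝕂𝕍 n ] g (re κ , im κ)) ≡ (∑[ a ∈ 𝕃 n ] ∑[ b ∈ 𝕃 n ] g (a , b))
    ∑-re-im {g} resp = trans
      (∑-reindex (KV-enumeration n) (×-enumeration (L-enumeration n) (L-enumeration n))
        (λ κ → re κ , im κ) (λ (a , b) i → a i , b i)
        (λ κ (a , b) (a≈ , b≈) i → ≈-sym (a≈ i) , ≈-sym (b≈ i))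
        (λ κ (a , b) eq → (λ i → ≈-sym (proj₁ (eq i))) , (λ i → ≈-sym (proj₂ (eq i)))) resp)
      (∑-× (L-enumeration n) (L-enumeration n) g)

    module _ (α : Fin n → K) where
      shift : (Fin n → K) → Fin n → K
      shift κ i = re κ i +ᶠ re α i , im κ i +ᶠ im α i

      -- With κ = (l , m) and α = (a , b), N(κ + α) - N(κ) = a(a + 2l + m) + b(a - db + l - 2dm);
      -- these are the two cofactors. The mixed term ab could go to either of them and is put into
      -- the second.
      slopes : (Fin n → K) → LinForm R n × LinForm R n
      slopes κ = (λ i → (re α i +ᶠ (re κ i +ᶠ re κ i)) +ᶠ im κ i)
               , (λ i → (re α i -ᶠ d · im α i) +ᶠ (re κ i -ᶠ d · (im κ i +ᶠ im κ i)))

      N-shift : ∀ P κ i j → (P ⊟ N κ ⊞ N (shift κ)) i j ≈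
        (P ⊞ re α ⊙ proj₁ (slopes κ) ⊞ im α ⊙ proj₂ (slopes κ)) i j
      N-shift P κ i j with i Fin.≟ j
      ... | yes _ = solve 6 (λ p d l m a b →
              (p :- (l :* (l :+ m) :+ (:- (d :* m)) :* m)) :+ ((l :+ a) :* ((l :+ a) :+ (m :+ b)) :+ (:- (d :* (m :+ b))) :* (m :+ b))
              := (p :+ a :* ((a :+ (l :+ l)) :+ m)) :+ b :* ((a :- d :* b) :+ (l :- d :* (m :+ m))))
              ≈-refl (P i j) d (re κ i) (im κ i) (re α i) (im α i)
      ... | no _ = solve 10 (λ p d l m a b l′ m′ a′ b′ →
              (p :- ((l :* (l′ :+ m′) :+ l′ :* (l :+ m)) :+ ((:- (d :* m)) :* m′ :+ (:- (d :* m′)) :* m)))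
                :+ (((l :+ a) :* ((l′ :+ a′) :+ (m′ :+ b′)) :+ (l′ :+ a′) :* ((l :+ a) :+ (m :+ b)))
                   :+ ((:- (d :* (m :+ b))) :* (m′ :+ b′) :+ (:- (d :* (m′ :+ b′))) :* (m :+ b)))
              := (p :+ (a :* ((a′ :+ (l′ :+ l′)) :+ m′) :+ a′ :* ((a :+ (l :+ l)) :+ m)))
                   :+ (b :* ((a′ :- d :* b′) :+ (l′ :- d :* (m′ :+ m′))) :+ b′ :* ((a :- d :* b) :+ (l :- d :* (m :+ m)))))
              ≈-refl (P i j) d (re κ i) (im κ i) (re α i) (im α i) (re κ j) (im κ j) (re α j) (im α j)

      -- Cramer's rule for (l , m) ↦ (2l + m , l - 2dm), whose determinant is -(1 + 4d).
      -- Invertibility is thus exactly the nonvanishing of the discriminant.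
      unslopes : LinForm R n × LinForm R n → Fin n → K
      unslopes (u , v) i = ((d +ᶠ d) · u′ +ᶠ v′) · δ⁻¹ , (u′ -ᶠ (v′ +ᶠ v′)) · δ⁻¹
        where
        u′ = u i -ᶠ re α i
        v′ = v i -ᶠ (re α i -ᶠ d · im α i)

      private
        L² = ×-setoid (L-setoid n) (L-setoid n)
        module L² = Setoid L²
        module KV = Setoid (KV-setoid n)

      slopes-cong : ∀ {κ λ′} → κ KV.≈ λ′ → slopes κ L².≈ slopes λ′
      slopes-cong eq =
          (λ i → let p , r = eq i in +ᶠ-cong (+ᶠ-congˡ (+ᶠ-cong p p)) r)
        , (λ i → let p , r = eq i in +ᶠ-congˡ (+ᶠ-cong p (-‿cong (·-congˡ (+ᶠ-cong r r)))))

      unslopes-cong : ∀ {x y} → x L².≈ y → unslopes x KV.≈ unslopes y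
      unslopes-cong (u≈ , v≈) i =
          ·-congʳ (+ᶠ-cong (·-congˡ (+ᶠ-congʳ (u≈ i))) (+ᶠ-congʳ (v≈ i)))
        , ·-congʳ (+ᶠ-cong (+ᶠ-congʳ (u≈ i)) (-‿cong (+ᶠ-cong (+ᶠ-congʳ (v≈ i)) (+ᶠ-congʳ (v≈ i)))))

      unslopes-slopes : ∀ κ → unslopes (slopes κ) KV.≈ κ
      unslopes-slopes κ i =
          ≈-trans (solve 6 (λ d l m a b e →
            let u = ((a :+ (l :+ l)) :+ m) :- a ; v = ((a :- d :* b) :+ (l :- d :* (m :+ m))) :- (a :- d :* b) in
            ((d :+ d) :* u :+ v) :* e := (l :+ ((d :+ d) :+ (d :+ d)) :* l) :* e) ≈-refl d (re κ i) (im κ i) (re α i) (im α i) δ⁻¹)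
            (discriminant-cancel (re κ i))
        , ≈-trans (solve 6 (λ d l m a b e →
            let u = ((a :+ (l :+ l)) :+ m) :- a ; v = ((a :- d :* b) :+ (l :- d :* (m :+ m))) :- (a :- d :* b) in
            (u :- (v :+ v)) :* e := (m :+ ((d :+ d) :+ (d :+ d)) :* m) :* e) ≈-refl d (re κ i) (im κ i) (re α i) (im α i) δ⁻¹)
            (discriminant-cancel (im κ i))

      slopes-unslopes : ∀ x → slopes (unslopes x) L².≈ x
      slopes-unslopes (u , v) =
          (λ i → begin
            proj₁ (slopes (unslopes (u , v))) i
              ≈⟨ solve 6 (λ d u v a b e →
                   let u′ = u :- a ; v′ = v :- (a :- d :* b) ; l = ((d :+ d) :* u′ :+ v′) :* e ; m = (u′ :- (v′ :+ v′)) :* e in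
                   (a :+ (l :+ l)) :+ m := a :+ (u′ :+ ((d :+ d) :+ (d :+ d)) :* u′) :* e) ≈-refl d (u i) (v i) (re α i) (im α i) δ⁻¹ ⟩
            re α i +ᶠ ((u i -ᶠ re α i) +ᶠ 4d · (u i -ᶠ re α i)) · δ⁻¹
              ≈⟨ +ᶠ-congˡ (discriminant-cancel _) ⟩
            re α i +ᶠ (u i -ᶠ re α i)
              ≈⟨ solve 2 (λ a u → a :+ (u :- a) := u) ≈-refl (re α i) (u i) ⟩
            u i ∎)
        , (λ i → let s = re α i -ᶠ d · im α i in begin
            proj₂ (slopes (unslopes (u , v))) i
              ≈⟨ solve 6 (λ d u v a b e →
                   let u′ = u :- a ; v′ = v :- (a :- d :* b) ; l = ((d :+ d) :* u′ :+ v′) :* e ; m = (u′ :- (v′ :+ v′)) :* e in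
                   (a :- d :* b) :+ (l :- d :* (m :+ m)) := (a :- d :* b) :+ (v′ :+ ((d :+ d) :+ (d :+ d)) :* v′) :* e) ≈-refl d (u i) (v i) (re α i) (im α i) δ⁻¹ ⟩
            s +ᶠ ((v i -ᶠ s) +ᶠ 4d · (v i -ᶠ s)) · δ⁻¹
              ≈⟨ +ᶠ-congˡ (discriminant-cancel _) ⟩
            s +ᶠ (v i -ᶠ s)
              ≈⟨ solve 2 (λ a u → a :+ (u :- a) := u) ≈-refl s (v i) ⟩
            v i ∎)
        where open ≈-Reasoning

      ∑-slopes : ∀ {g} → Respects L² g → (∑[ κ ∈ 𝕂𝕍 n ] g (slopes κ)) ≡ (∑[ u ∈ 𝕃 n ] ∑[ v ∈ 𝕃 n ] g (u , v))
      ∑-slopes {g} resp = trans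
        (∑-reindex (KV-enumeration n) (×-enumeration (L-enumeration n) (L-enumeration n)) slopes unslopes
          (λ κ x eq → KV.sym {unslopes x} {κ} (KV.trans {unslopes x} {unslopes (slopes κ)} {κ} (unslopes-cong {x} {slopes κ} eq) (unslopes-slopes κ)))
          (λ κ x eq → L².sym {slopes κ} {x} (L².trans {slopes κ} {slopes (unslopes x)} {x} (slopes-cong {κ} {unslopes x} eq) (slopes-unslopes x)))
          resp)
        (∑-× (L-enumeration n) (L-enumeration n) g)

      ∑-shift : ∀ {g} → Respects (KV-setoid n) g → (∑[ κ ∈ 𝕂𝕍 n ] g (shift κ)) ≡ ∑ (𝕂𝕍 n) g
      ∑-shift = ∑-reindex (KV-enumeration n) (KV-enumeration n) shift
        (λ κ i → re κ i -ᶠ re α i , im κ i -ᶠ im α i)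
        (λ κ κ′ eq i → let p , r = eq i in ≈-sym (≈-trans (+ᶠ-congʳ p) (cancel (re κ i) (re α i))) , ≈-sym (≈-trans (+ᶠ-congʳ r) (cancel (im κ i) (im α i))))
        (λ κ κ′ eq i → let p , r = eq i in ≈-sym (≈-trans (+ᶠ-congʳ p) (cancel′ (re κ′ i) (re α i))) , ≈-sym (≈-trans (+ᶠ-congʳ r) (cancel′ (im κ′ i) (im α i))))
        where
        cancel : ∀ x y → (x +ᶠ y) -ᶠ y ≈ x
        cancel = solve 2 (λ x y → (x :+ y) :- y := x) ≈-refl
        cancel′ : ∀ x y → (x -ᶠ y) +ᶠ y ≈ x
        cancel′ = solve 2 (λ x y → (x :- y) :+ y := x) ≈-refl

    -- N(κ + α) - N(κ) = re α · u + im α · v with κ ↦ (u , v) bijective for each α.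
    ∑Θ-N : ∀ {f} → Respects (QForm-setoid n) f → ∀ P → (∑[ κ ∈ 𝕂𝕍 n ] Θ f (P ⊟ N κ)) ≡ T² f P
    ∑Θ-N {f} resp P = begin
      (∑[ κ ∈ 𝕂𝕍 n ] ∑[ β ∈ 𝕂𝕍 n ] f (P ⊟ N κ ⊞ N β))
        ≡⟨ ∑-cong (𝕂𝕍 n) (λ κ → sym (∑-shift κ λ β≈ → resp λ i j _ → +ᶠ-congˡ (N-cong β≈ i j))) ⟩
      (∑[ κ ∈ 𝕂𝕍 n ] ∑[ α ∈ 𝕂𝕍 n ] f (P ⊟ N κ ⊞ N (shift κ α)))
        ≡⟨ ∑-swap (𝕂𝕍 n) (𝕂𝕍 n) _ ⟩
      (∑[ α ∈ 𝕂𝕍 n ] ∑[ κ ∈ 𝕂𝕍 n ] f (P ⊟ N κ ⊞ N (shift κ α)))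
        ≡⟨ ∑-cong (𝕂𝕍 n) (λ α → ∑-cong (𝕂𝕍 n) λ κ → resp λ i j _ → ≈-trans
             (+ᶠ-congˡ (N-cong (λ i → +-comm (re α i) (re κ i) , +-comm (im α i) (im κ i)) i j)) (N-shift α P κ i j)) ⟩
      (∑[ α ∈ 𝕂𝕍 n ] ∑[ κ ∈ 𝕂𝕍 n ] f (P ⊞ re α ⊙ proj₁ (slopes α κ) ⊞ im α ⊙ proj₂ (slopes α κ)))
        ≡⟨ ∑-cong (𝕂𝕍 n) (λ α → ∑-slopes α λ {x} {y} (u≈ , v≈) → resp λ i j _ →
             +ᶠ-cong (+ᶠ-congˡ (⊙-cong (λ _ → ≈-refl) u≈ i j)) (⊙-cong (λ _ → ≈-refl) v≈ i j)) ⟩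
      (∑[ α ∈ 𝕂𝕍 n ] ∑[ u ∈ 𝕃 n ] ∑[ v ∈ 𝕃 n ] f (P ⊞ re α ⊙ u ⊞ im α ⊙ v))
        ≡⟨ ∑-re-im (λ (a≈ , b≈) → ∑-cong (𝕃 n) λ u → ∑-cong (𝕃 n) λ v → resp λ i j _ →
             +ᶠ-cong (+ᶠ-congˡ (⊙-cong a≈ (λ _ → ≈-refl) i j)) (⊙-cong b≈ (λ _ → ≈-refl) i j)) ⟩
      T² f P ∎
      where open ≡.≡-Reasoning

-- Fibres of the norm

square-nonneg : ∀ i → 0ℤ ≤ i * i
square-nonneg (pos n) = ℤₚ.≤-trans (+≤+ ℕ.z≤n) (ℤₚ.≤-reflexive (ℤₚ.pos-* n n))
square-nonneg -[1+ n ] = +≤+ ℕ.z≤n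

-- The second moment of ρ has exactly the value for which the variance of ρ + Q e vanishes.
module _ {a ℓ} {S : Setoid a ℓ} (E : Enumeration S) where
  open Enumeration E using (elements)
  open Setoid S using (Carrier)

  fibres-from-moments : (ρ e : Carrier → ℤ) → Respects S ρ → Respects S e →
    (∀ x → e x ≡ 0ℤ ⊎ e x ≡ 1ℤ × ρ x ≡ 1ℤ) → (Q : ℤ) →
    ∑ elements e ≡ 1ℤ → (∀ k → (∑[ x ∈ elements ] k) ≡ Q * k) → ∑ elements ρ ≡ Q * Q →
    (∑[ x ∈ elements ] ρ x * ρ x) ≡ Q * Q * Q + Q * Q - Q →
    ∀ x → ρ x + Q * e x ≡ 1ℤ + Q
  fibres-from-moments ρ e ρ-resp e-resp marked Q ∑e ∑const ∑ρ ∑ρ² x = ℤₚ.i-j≡0⇒i≡j (ρ x + Q * e x) (1ℤ + Q) w≡0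
    where
    open ≡.≡-Reasoning
    w : Carrier → ℤ
    w y = (ρ y + Q * e y) - (1ℤ + Q)
    w-resp : Respects S w
    w-resp y≈z = cong (_- (1ℤ + Q)) (cong₂ _+_ (ρ-resp y≈z) (cong (Q *_) (e-resp y≈z)))
    k₁ k₂ k₃ : ℤ
    k₁ = - (pos 2 * (1ℤ + Q))
    k₂ = - (Q * Q)
    k₃ = (1ℤ + Q) * (1ℤ + Q)
    off : ∀ r x → ((r + x * 0ℤ) - (1ℤ + x)) * ((r + x * 0ℤ) - (1ℤ + x)) ≡
      (r * r + (- (pos 2 * (1ℤ + x))) * r) + (0ℤ * (- (x * x)) + (1ℤ + x) * (1ℤ + x))
    off = solve-∀
    on : ∀ x → ((1ℤ + x * 1ℤ) - (1ℤ + x)) * ((1ℤ + x * 1ℤ) - (1ℤ + x)) ≡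
      (1ℤ * 1ℤ + (- (pos 2 * (1ℤ + x))) * 1ℤ) + (1ℤ * (- (x * x)) + (1ℤ + x) * (1ℤ + x))
    on = solve-∀
    -- Since `e` is 0 or 1 and forces ρ = 1 where it is 1, the products e² and ρe both reduce to e.
    -- Hence w² is a combination of ρ², ρ, e and 1, all of whose sums are known.
    expand : ∀ y → w y * w y ≡ (ρ y * ρ y + k₁ * ρ y) + (e y * k₂ + k₃)
    expand y with e y | ρ y | marked y
    ... | _ | r | inj₁ refl = off r Q
    ... | _ | _ | inj₂ (refl , refl) = on Q
    total : ∀ x → ((x * x * x + x * x - x) + (- (pos 2 * (1ℤ + x))) * (x * x)) + (1ℤ * (- (x * x)) + x * ((1ℤ + x) * (1ℤ + x))) ≡ 0ℤ
    total = solve-∀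
    ∑w²≡0 : (∑[ y ∈ elements ] w y * w y) ≡ 0ℤ
    ∑w²≡0 = begin
      (∑[ y ∈ elements ] w y * w y)
        ≡⟨ ∑-cong elements expand ⟩
      (∑[ y ∈ elements ] ((ρ y * ρ y + k₁ * ρ y) + (e y * k₂ + k₃)))
        ≡⟨ ∑-+ elements (λ y → ρ y * ρ y + k₁ * ρ y) (λ y → e y * k₂ + k₃) ⟩
      (∑[ y ∈ elements ] (ρ y * ρ y + k₁ * ρ y)) + (∑[ y ∈ elements ] (e y * k₂ + k₃))
        ≡⟨ cong₂ _+_ (∑-+ elements (λ y → ρ y * ρ y) (λ y → k₁ * ρ y)) (∑-+ elements (λ y → e y * k₂) (λ _ → k₃)) ⟩
      ((∑[ y ∈ elements ] ρ y * ρ y) + (∑[ y ∈ elements ] k₁ * ρ y)) + ((∑[ y ∈ elements ] e y * k₂) + (∑[ y ∈ elements ] k₃))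
        ≡⟨ cong₂ _+_ (cong₂ _+_ ∑ρ² (trans (∑-*ˡ elements k₁ ρ) (cong (k₁ *_) ∑ρ)))
             (cong₂ _+_ (trans (∑-*ʳ elements k₂ e) (cong (_* k₂) ∑e)) (∑const k₃)) ⟩
      ((Q * Q * Q + Q * Q - Q) + k₁ * (Q * Q)) + (1ℤ * k₂ + Q * k₃)
        ≡⟨ total Q ⟩
      0ℤ ∎
    w²≡0 : w x * w x ≡ 0ℤ
    w²≡0 = ℤₚ.≤-antisym
      (ℤₚ.≤-trans (Sift.term≤∑ E {λ y → w y * w y} (λ y≈z → cong₂ _*_ (w-resp y≈z) (w-resp y≈z)) (λ y → square-nonneg (w y)) x)
        (ℤₚ.≤-reflexive ∑w²≡0))
      (square-nonneg (w x))
    w≡0 : w x ≡ 0ℤ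
    w≡0 with ℤₚ.i*j≡0⇒i≡0∨j≡0 (w x) w²≡0
    ... | inj₁ eq = eq
    ... | inj₂ eq = eq

module NormFibres {c ℓ : Level} (R : CommutativeRing c ℓ) (q : ℕ) (isField : IsField R) (card : HasCardinality R q) where

  open QuadraticForms R q isField card public

  normᴷ : K → F
  normᴷ (x , y) = norm x y

  norm-cong : ∀ {k l} → Setoid._≈_ K-setoid k l → normᴷ k ≈ normᴷ l
  norm-cong (p , r) = +ᶠ-cong (+ᶠ-cong (·-cong p p) (·-cong p r)) (-‿cong (·-congˡ (·-cong r r)))

  ∑-const-𝕂 : ∀ k → (∑[ x ∈ 𝕂 ] k) ≡ pos q * pos q * k
  ∑-const-𝕂 k = trans (∑-× F-enumeration F-enumeration (λ _ → k))
    (trans (∑-cong 𝔽 λ _ → ∑-const-F k) (trans (∑-const-F (pos q * k)) (sym (ℤₚ.*-assoc (pos q) (pos q) k))))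

  norm-00 : norm 0# 0# ≈ 0#
  norm-00 = ≈-trans (solve 2 (λ z d → (z :* z :+ z :* z) :- d :* (z :* z) := z :* (z :+ z :- d :* z)) ≈-refl 0# d) (zeroˡ _)

  private
    ∑-𝕃₁ : ∀ f → ∑ (𝕃 1) f ≡ (∑[ x ∈ 𝔽 ] f (x Vector.∷ Vector.[]))
    ∑-𝕃₁ f = trans (∑-vector-suc F-enumeration 0 f) (∑-cong 𝔽 λ x → ℤₚ.+-identityʳ _)

    ∑-𝕂𝕍₁ : ∀ f → ∑ (𝕂𝕍 1) f ≡ (∑[ k ∈ 𝕂 ] f (k Vector.∷ Vector.[]))
    ∑-𝕂𝕍₁ f = trans (∑-vector-suc K-enumeration 0 f) (∑-cong 𝕂 λ x → ℤₚ.+-identityʳ _)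

    ρ : F → ℤ
    ρ x = ∑[ k ∈ 𝕂 ] [ x ≟ normᴷ k ]

    ρ-resp : Respects F-setoid ρ
    ρ-resp x≈y = ∑-cong 𝕂 λ k → []-cong (_ ≟ _) (_ ≟ _) (≈-trans (≈-sym x≈y)) (≈-trans x≈y)

    ∑-ρ : ∀ {g} → Respects F-setoid g → (∑[ x ∈ 𝔽 ] ρ x * g x) ≡ (∑[ k ∈ 𝕂 ] g (normᴷ k))
    ∑-ρ {g} resp = begin
      (∑[ x ∈ 𝔽 ] ρ x * g x)                          ≡⟨ ∑-cong 𝔽 (λ x → ∑-*ʳ 𝕂 (g x) (λ k → [ x ≟ normᴷ k ])) ⟨
      (∑[ x ∈ 𝔽 ] ∑[ k ∈ 𝕂 ] [ x ≟ normᴷ k ] * g x)   ≡⟨ ∑-swap 𝔽 𝕂 _ ⟩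
      (∑[ k ∈ 𝕂 ] ∑[ x ∈ 𝔽 ] [ x ≟ normᴷ k ] * g x)   ≡⟨ ∑-cong 𝕂 (λ k → Sift.sift F-enumeration resp (normᴷ k)) ⟩
      (∑[ k ∈ 𝕂 ] g (normᴷ k)) ∎
      where open ≡.≡-Reasoning

    ρ-total : ∑ 𝔽 ρ ≡ pos q * pos q
    ρ-total = trans (∑-cong 𝔽 λ x → sym (ℤₚ.*-identityʳ (ρ x)))
      (trans (∑-ρ {λ _ → 1ℤ} λ _ → refl) (trans (∑-const-𝕂 1ℤ) (ℤₚ.*-identityʳ _)))

    ρ-0 : ρ 0# ≡ 1ℤ
    ρ-0 = trans (Sift.∑-single K-enumeration resp (0# , 0#) elsewhere)
      ([]-yes (0# ≟ norm 0# 0#) (≈-sym norm-00))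
      where
      resp : Respects K-setoid (λ k → [ 0# ≟ normᴷ k ])
      resp k≈l = []-cong (_ ≟ _) (_ ≟ _) (λ eq → ≈-trans eq (norm-cong k≈l)) (λ eq → ≈-trans eq (≈-sym (norm-cong k≈l)))
      elsewhere : ∀ k → ¬ (Setoid._≈_ K-setoid k (0# , 0#)) → [ 0# ≟ normᴷ k ] ≡ 0ℤ
      elsewhere (x , y) k≉0 = []-no (0# ≟ norm x y) λ eq → k≉0 (norm-anisotropic x y (≈-sym eq))

    linear-once : ∀ s {b} → ¬ (b ≈ 0#) → (∑[ v ∈ 𝔽 ] [ (s +ᶠ b · v) ≟ 0# ]) ≡ 1ℤ
    linear-once s {b} b≉0 with inverse b≉0
    ... | i , bi≈1 = trans (∑-cong 𝔽 λ v → []-cong (_ ≟ _) (v ≟ (-ᶠ s · i)) (to v) (from v)) (once (-ᶠ s · i))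
      where
      open ≈-Reasoning
      to : ∀ v → s +ᶠ b · v ≈ 0# → v ≈ -ᶠ s · i
      to v eq = begin
        v                                  ≈⟨ *-identityʳ v ⟨
        v · 1#                             ≈⟨ ·-congˡ bi≈1 ⟨
        v · (b · i)                        ≈⟨ solve 4 (λ v b i s → v :* (b :* i) := (s :+ b :* v) :* i :+ (:- s) :* i) ≈-refl v b i s ⟩
        (s +ᶠ b · v) · i +ᶠ -ᶠ s · i       ≈⟨ +ᶠ-congʳ (≈-trans (·-congʳ eq) (zeroˡ i)) ⟩
        0# +ᶠ -ᶠ s · i                     ≈⟨ +-identityˡ _ ⟩
        -ᶠ s · i ∎
      from : ∀ v → v ≈ -ᶠ s · i → s +ᶠ b · v ≈ 0#
      from v eq = begin
        s +ᶠ b · v              ≈⟨ +ᶠ-congˡ (·-congˡ eq) ⟩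
        s +ᶠ b · (-ᶠ s · i)     ≈⟨ solve 3 (λ s b i → s :+ b :* ((:- s) :* i) := s :- s :* (b :* i)) ≈-refl s b i ⟩
        s -ᶠ s · (b · i)        ≈⟨ +ᶠ-congˡ (-‿cong (≈-trans (·-congˡ bi≈1) (*-identityʳ s))) ⟩
        s -ᶠ s                  ≈⟨ -‿inverseʳ s ⟩
        0# ∎

    -- A nontrivial linear equation in two unknowns has q solutions and the trivial one has q²; the
    -- product of brackets switches between the two counts. The leading `0#` is the coefficient of
    -- the zero form at which `T²` is evaluated later.
    bilinear-zeros : ∀ a b → (∑[ u ∈ 𝔽 ] ∑[ v ∈ 𝔽 ] [ ((0# +ᶠ a · u) +ᶠ b · v) ≟ 0# ]) ≡
      pos q + (pos q * pos q - pos q) * ([ a ≟ 0# ] * [ b ≟ 0# ])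
    bilinear-zeros a b with b ≟ 0# | a ≟ 0#
    ... | no b≉0 | a? = trans (∑-cong 𝔽 λ u → linear-once (0# +ᶠ a · u) b≉0)
            (trans (∑-const-F 1ℤ) (aux (pos q) [ a? ]))
      where
      aux : ∀ x y → x * 1ℤ ≡ x + (x * x - x) * (y * 0ℤ)
      aux = solve-∀
    ... | yes b≈0 | no a≉0 = trans (∑-swap 𝔽 𝔽 _)
            (trans (∑-cong 𝔽 λ v → trans
              (∑-cong 𝔽 λ u → []-cong (_ ≟ _) ((b · v +ᶠ a · u) ≟ 0#) (≈-trans (≈-sym (swapped u v))) (≈-trans (swapped u v)))
              (linear-once (b · v) a≉0))
            (trans (∑-const-F 1ℤ) (aux (pos q))))
      where
      aux : ∀ x → x * 1ℤ ≡ x + (x * x - x) * 0ℤ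
      aux = solve-∀
      swapped : ∀ u v → (0# +ᶠ a · u) +ᶠ b · v ≈ b · v +ᶠ a · u
      swapped u v = ≈-trans (+ᶠ-congʳ (+-identityˡ _)) (+-comm _ _)
    ... | yes b≈0 | yes a≈0 = trans
            (∑-cong 𝔽 λ u → trans (∑-cong 𝔽 λ v → []-yes (_ ≟ _) (vanishes u v)) (∑-const-F 1ℤ))
            (trans (∑-const-F (pos q * 1ℤ)) (aux (pos q)))
      where
      open ≈-Reasoning
      aux : ∀ x → x * (x * 1ℤ) ≡ x + (x * x - x) * 1ℤ
      aux = solve-∀
      vanishes : ∀ u v → (0# +ᶠ a · u) +ᶠ b · v ≈ 0#
      vanishes u v = begin
        (0# +ᶠ a · u) +ᶠ b · v  ≈⟨ +ᶠ-cong (+-identityˡ _) (≈-trans (·-congʳ b≈0) (zeroˡ v)) ⟩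
        a · u +ᶠ 0#             ≈⟨ +-identityʳ _ ⟩
        a · u                   ≈⟨ ≈-trans (·-congʳ a≈0) (zeroˡ u) ⟩
        0# ∎

    -- The second moment counts pairs of equal norm. For n = 1 this is the sum in `∑Θ-N` for the
    -- indicator of the zero form, so the hyperbolic substitution already proved turns it into a
    -- count of the zeros of au + bv.
    ρ-square : (∑[ x ∈ 𝔽 ] ρ x * ρ x) ≡ pos q * pos q * pos q + pos q * pos q - pos q
    ρ-square = begin
      (∑[ x ∈ 𝔽 ] ρ x * ρ x)
        ≡⟨ ∑-ρ ρ-resp ⟩
      (∑[ l ∈ 𝕂 ] ∑[ k ∈ 𝕂 ] [ normᴷ l ≟ normᴷ k ])
        ≡⟨ ∑-cong 𝕂 (λ l → ∑-cong 𝕂 λ k → []-cong (_ ≟ _) (_ ≟ 0#) (to l k) (from l k)) ⟩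
      (∑[ l ∈ 𝕂 ] ∑[ k ∈ 𝕂 ] value (0Q R ⊟ N (l Vector.∷ Vector.[]) ⊞ N (k Vector.∷ Vector.[])))
        ≡⟨ trans (∑-𝕂𝕍₁ _) (∑-cong 𝕂 λ l → ∑-𝕂𝕍₁ _) ⟨
      (∑[ κ ∈ 𝕂𝕍 1 ] Θ value (0Q R ⊟ N κ))
        ≡⟨ ∑Θ-N value-resp (0Q R) ⟩
      T² value (0Q R)
        ≡⟨ trans (∑-𝕃₁ _) (∑-cong 𝔽 λ a → trans (∑-𝕃₁ _) (∑-cong 𝔽 λ b → trans (∑-𝕃₁ _) (∑-cong 𝔽 λ u → ∑-𝕃₁ _))) ⟩
      (∑[ a ∈ 𝔽 ] ∑[ b ∈ 𝔽 ] ∑[ u ∈ 𝔽 ] ∑[ v ∈ 𝔽 ] [ ((0# +ᶠ a · u) +ᶠ b · v) ≟ 0# ])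
        ≡⟨ ∑-cong 𝔽 (λ a → trans (∑-cong 𝔽 (bilinear-zeros a)) (row a)) ⟩
      (∑[ a ∈ 𝔽 ] (Q * Q + (Q * Q - Q) * [ a ≟ 0# ]))
        ≡⟨ trans (∑-+ 𝔽 (λ _ → Q * Q) (λ a → (Q * Q - Q) * [ a ≟ 0# ])) (cong₂ _+_ (∑-const-F (Q * Q))
             (trans (∑-*ˡ 𝔽 (Q * Q - Q) (λ a → [ a ≟ 0# ])) (cong ((Q * Q - Q) *_) (once 0#)))) ⟩
      Q * (Q * Q) + (Q * Q - Q) * 1ℤ
        ≡⟨ aux Q ⟩
      Q * Q * Q + Q * Q - Q ∎
      where
      open ≡.≡-Reasoning
      Q = pos q
      aux : ∀ x → x * (x * x) + (x * x - x) * 1ℤ ≡ x * x * x + x * x - x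
      aux = solve-∀
      value : QForm R 1 → ℤ
      value P = [ P Fin.zero Fin.zero ≟ 0# ]
      value-resp : Respects (QForm-setoid 1) value
      value-resp eq = []-cong (_ ≟ 0#) (_ ≟ 0#) (≈-trans (≈-sym (eq Fin.zero Fin.zero ℕ.z≤n))) (≈-trans (eq Fin.zero Fin.zero ℕ.z≤n))
      difference : ∀ l k → (0Q R ⊟ N (l Vector.∷ Vector.[]) ⊞ N (k Vector.∷ Vector.[])) Fin.zero Fin.zero ≈ 0# +ᶠ (normᴷ k -ᶠ normᴷ l)
      difference (x , y) (z , w) = solve 6 (λ o d x y z w →
        (o :- (x :* (x :+ y) :+ (:- (d :* y)) :* y)) :+ (z :* (z :+ w) :+ (:- (d :* w)) :* w) :=
        o :+ (((z :* z :+ z :* w) :- d :* (w :* w)) :- ((x :* x :+ x :* y) :- d :* (y :* y)))) ≈-refl 0# d x y z w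
      to : ∀ l k → normᴷ l ≈ normᴷ k → (0Q R ⊟ N (l Vector.∷ Vector.[]) ⊞ N (k Vector.∷ Vector.[])) Fin.zero Fin.zero ≈ 0#
      to l k eq = ≈-trans (difference l k) (≈-trans (+-identityˡ _) (≈-trans (+ᶠ-congʳ (≈-sym eq)) (-‿inverseʳ _)))
      from : ∀ l k → (0Q R ⊟ N (l Vector.∷ Vector.[]) ⊞ N (k Vector.∷ Vector.[])) Fin.zero Fin.zero ≈ 0# → normᴷ l ≈ normᴷ k
      from l k eq = ≈-sym (x-y≈0⇒x≈y _ _ (≈-trans (≈-sym (≈-trans (difference l k) (+-identityˡ _))) eq))
      row : ∀ a → (∑[ b ∈ 𝔽 ] (Q + (Q * Q - Q) * ([ a ≟ 0# ] * [ b ≟ 0# ]))) ≡ Q * Q + (Q * Q - Q) * [ a ≟ 0# ]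
      row a = trans (∑-+ 𝔽 (λ _ → Q) _) (cong₂ _+_ (∑-const-F Q)
        (trans (∑-*ˡ 𝔽 (Q * Q - Q) _) (cong ((Q * Q - Q) *_)
          (trans (∑-*ˡ 𝔽 [ a ≟ 0# ] _) (trans (cong ([ a ≟ 0# ] *_) (once 0#)) (ℤₚ.*-identityʳ _))))))

    -- The norm takes the value 0 once and every other value q + 1 times.
    ρ-value : ∀ x → ρ x + pos q * [ x ≟ 0# ] ≡ 1ℤ + pos q
    ρ-value = fibres-from-moments F-enumeration ρ (λ x → [ x ≟ 0# ]) ρ-resp
      (λ x≈y → []-cong (_ ≟ 0#) (_ ≟ 0#) (≈-trans (≈-sym x≈y)) (≈-trans x≈y))
      (λ x → marked (x ≟ 0#) λ x≈0 → trans (ρ-resp x≈0) ρ-0)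
      (pos q) (once 0#) ∑-const-F ρ-total ρ-square
      where
      marked : ∀ {p r} {P : Set p} (P? : Dec P) → (P → r ≡ 1ℤ) → [ P? ] ≡ 0ℤ ⊎ [ P? ] ≡ 1ℤ × r ≡ 1ℤ
      marked (no _) _ = inj₁ refl
      marked (yes p) r≡1 = inj₂ (refl , r≡1 p)

  -- The value 0 is attained q times too rarely for a uniform multiplicity q + 1, and the second
  -- summand makes up for this.
  ∑-norm : ∀ {g} → Respects F-setoid g → (∑[ k ∈ 𝕂 ] g (normᴷ k)) + pos q * g 0# ≡ (1ℤ + pos q) * ∑ 𝔽 g
  ∑-norm {g} resp = begin
    (∑[ k ∈ 𝕂 ] g (normᴷ k)) + Q * g 0#
      ≡⟨ cong₂ _+_ (∑-ρ resp) (trans (∑-*ˡ 𝔽 Q _) (cong (Q *_) (Sift.sift F-enumeration resp 0#))) ⟨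
    (∑[ x ∈ 𝔽 ] ρ x * g x) + (∑[ x ∈ 𝔽 ] Q * ([ x ≟ 0# ] * g x))
      ≡⟨ ∑-+ 𝔽 _ _ ⟨
    (∑[ x ∈ 𝔽 ] (ρ x * g x + Q * ([ x ≟ 0# ] * g x)))
      ≡⟨ ∑-cong 𝔽 (λ x → trans (factor (ρ x) (g x) Q [ x ≟ 0# ]) (cong (_* g x) (ρ-value x))) ⟩
    (∑[ x ∈ 𝔽 ] (1ℤ + Q) * g x)
      ≡⟨ ∑-*ˡ 𝔽 (1ℤ + Q) g ⟩
    (1ℤ + Q) * ∑ 𝔽 g ∎
    where
    open ≡.≡-Reasoning
    Q = pos q
    factor : ∀ r y x e → r * y + x * (e * y) ≡ (r + x * e) * y
    factor = solve-∀

  norm-surjective : ∀ {x} → ¬ (x ≈ 0#) → ∃ λ k → normᴷ k ≈ x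
  norm-surjective {x} x≉0 with ∑-binary K-enumeration 𝕂 (λ k → []-binary (x ≟ normᴷ k))
  ... | inj₂ (k , eq) = k , ≈-sym ([]≡1⇒ (x ≟ normᴷ k) eq)
  ... | inj₁ ρx≡0 = contradiction (trans (sym (cong₂ _+_ ρx≡0
          (trans (cong (pos q *_) ([]-no (x ≟ 0#) x≉0)) (ℤₚ.*-zeroʳ (pos q))))) (ρ-value x)) λ ()

-- The sign of the eigenvalues of Θ

module NormSums {c ℓ : Level} (R : CommutativeRing c ℓ) (q : ℕ) (isField : IsField R) (card : HasCardinality R q) where

  open NormFibres R q isField card public

  infixl 7 _∗_ _∗ᵛ_
  -- Multiplication in F(ω), where ω² = ω + d, with (x , y) standing for x + ωy.
  _∗_ : K → K → K
  (x , y) ∗ (a , b) = x · a +ᶠ d · (y · b) , (x · b +ᶠ y · a) +ᶠ y · b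

  _∗ᵛ_ : ∀ {n} → K → (Fin n → K) → Fin n → K
  (k ∗ᵛ κ) i = k ∗ κ i

  N-∗ : ∀ {n} k (κ : Fin n → K) i j → N (k ∗ᵛ κ) i j ≈ normᴷ k · N κ i j
  N-∗ (x , y) κ i j with i Fin.≟ j
  ... | yes _ = solve 5 (λ d x y a b →
      let a₁ = x :* a :+ d :* (y :* b) ; b₁ = (x :* b :+ y :* a) :+ y :* b in
      a₁ :* (a₁ :+ b₁) :+ (:- (d :* b₁)) :* b₁ :=
      ((x :* x :+ x :* y) :- d :* (y :* y)) :* (a :* (a :+ b) :+ (:- (d :* b)) :* b))
      ≈-refl d x y (re κ i) (im κ i)
  ... | no _ = solve 7 (λ d x y a b a′ b′ →
      let a₁ = x :* a :+ d :* (y :* b) ; b₁ = (x :* b :+ y :* a) :+ y :* b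
          a₂ = x :* a′ :+ d :* (y :* b′) ; b₂ = (x :* b′ :+ y :* a′) :+ y :* b′ in
      (a₁ :* (a₂ :+ b₂) :+ a₂ :* (a₁ :+ b₁)) :+ ((:- (d :* b₁)) :* b₂ :+ (:- (d :* b₂)) :* b₁) :=
      ((x :* x :+ x :* y) :- d :* (y :* y)) :*
        ((a :* (a′ :+ b′) :+ a′ :* (a :+ b)) :+ ((:- (d :* b)) :* b′ :+ (:- (d :* b′)) :* b)))
      ≈-refl d x y (re κ i) (im κ i) (re κ j) (im κ j)

  module _ {n : ℕ} where
    private module KV = Setoid (KV-setoid n)

    ∗ᵛ-cong : ∀ k {κ λ′} → κ KV.≈ λ′ → k ∗ᵛ κ KV.≈ k ∗ᵛ λ′
    ∗ᵛ-cong k eq i = let p , r = eq i in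
      +ᶠ-cong (·-congˡ p) (·-congˡ (·-congˡ r)) , +ᶠ-cong (+ᶠ-cong (·-congˡ r) (·-congˡ p)) (·-congˡ r)

    ∑-∗ᵛ : ∀ k → ¬ (normᴷ k ≈ 0#) → ∀ {g} → Respects (KV-setoid n) g → (∑[ κ ∈ 𝕂𝕍 n ] g (k ∗ᵛ κ)) ≡ ∑ (𝕂𝕍 n) g
    ∑-∗ᵛ k@(x , y) nk≉0 = ∑-reindex (KV-enumeration n) (KV-enumeration n) (k ∗ᵛ_) (k⁻¹ ∗ᵛ_)
      (λ κ λ′ eq → KV.sym {k⁻¹ ∗ᵛ λ′} {κ} (KV.trans {k⁻¹ ∗ᵛ λ′} {k⁻¹ ∗ᵛ (k ∗ᵛ κ)} {κ} (∗ᵛ-cong k⁻¹ {λ′} {k ∗ᵛ κ} eq) (left-inverse κ)))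
      (λ κ λ′ eq → KV.sym {k ∗ᵛ κ} {λ′} (KV.trans {k ∗ᵛ κ} {k ∗ᵛ (k⁻¹ ∗ᵛ λ′)} {λ′} (∗ᵛ-cong k {κ} {k⁻¹ ∗ᵛ λ′} eq) (right-inverse λ′)))
      where
      t = proj₁ (inverse nk≉0)
      -- The conjugate of x + ωy is (x + y) - ωy; dividing it by the norm gives the inverse.
      k⁻¹ : K
      k⁻¹ = (x +ᶠ y) · t , -ᶠ (y · t)
      unit : ∀ a → a · (norm x y · t) ≈ a
      unit a = ≈-trans (·-congˡ (proj₂ (inverse nk≉0))) (*-identityʳ a)
      left-inverse : ∀ κ → k⁻¹ ∗ᵛ (k ∗ᵛ κ) KV.≈ κ
      left-inverse κ i =
          ≈-trans (solve 6 (λ d x y t a b →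
            let a₁ = x :* a :+ d :* (y :* b) ; b₁ = (x :* b :+ y :* a) :+ y :* b ; x₁ = (x :+ y) :* t ; y₁ = :- (y :* t) in
            x₁ :* a₁ :+ d :* (y₁ :* b₁) := a :* (((x :* x :+ x :* y) :- d :* (y :* y)) :* t)) ≈-refl d x y t (re κ i) (im κ i)) (unit (re κ i))
        , ≈-trans (solve 6 (λ d x y t a b →
            let a₁ = x :* a :+ d :* (y :* b) ; b₁ = (x :* b :+ y :* a) :+ y :* b ; x₁ = (x :+ y) :* t ; y₁ = :- (y :* t) in
            (x₁ :* b₁ :+ y₁ :* a₁) :+ y₁ :* b₁ := b :* (((x :* x :+ x :* y) :- d :* (y :* y)) :* t)) ≈-refl d x y t (re κ i) (im κ i)) (unit (im κ i))
      right-inverse : ∀ κ → k ∗ᵛ (k⁻¹ ∗ᵛ κ) KV.≈ κ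
      right-inverse κ i =
          ≈-trans (solve 6 (λ d x y t a b →
            let x₁ = (x :+ y) :* t ; y₁ = :- (y :* t) ; a₁ = x₁ :* a :+ d :* (y₁ :* b) ; b₁ = (x₁ :* b :+ y₁ :* a) :+ y₁ :* b in
            x :* a₁ :+ d :* (y :* b₁) := a :* (((x :* x :+ x :* y) :- d :* (y :* y)) :* t)) ≈-refl d x y t (re κ i) (im κ i)) (unit (re κ i))
        , ≈-trans (solve 6 (λ d x y t a b →
            let x₁ = (x :+ y) :* t ; y₁ = :- (y :* t) ; a₁ = x₁ :* a :+ d :* (y₁ :* b) ; b₁ = (x₁ :* b :+ y₁ :* a) :+ y₁ :* b in
            (x :* b₁ :+ y :* a₁) :+ y :* b₁ := b :* (((x :* x :+ x :* y) :- d :* (y :* y)) :* t)) ≈-refl d x y t (re κ i) (im κ i)) (unit (im κ i))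

    -- Substitute kκ for κ, where k has norm -1.
    Θ-negated : ∀ {f} → Respects (QForm-setoid n) f → ∀ P → (∑[ κ ∈ 𝕂𝕍 n ] f (P ⊟ N κ)) ≡ Θ f P
    Θ-negated {f} resp P with norm-surjective {x = -ᶠ 1#} -1≉0
      where
      -1≉0 : ¬ (-ᶠ 1# ≈ 0#)
      -1≉0 eq = 1≉0 (begin
        1#           ≈⟨ +-identityʳ 1# ⟨
        1# +ᶠ 0#     ≈⟨ +ᶠ-congˡ eq ⟨
        1# -ᶠ 1#     ≈⟨ -‿inverseʳ 1# ⟩
        0# ∎)
        where open ≈-Reasoning
    ... | k , nk≈-1 = trans
      (∑-cong (𝕂𝕍 n) λ κ → resp λ i j _ → +ᶠ-congˡ (begin
        -ᶠ N κ i j             ≈⟨ -‿cong (*-identityˡ _) ⟨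
        -ᶠ (1# · N κ i j)      ≈⟨ solve 2 (λ u x → :- (u :* x) := (:- u) :* x) ≈-refl 1# (N κ i j) ⟩
        -ᶠ 1# · N κ i j        ≈⟨ ·-congʳ nk≈-1 ⟨
        normᴷ k · N κ i j      ≈⟨ N-∗ k κ i j ⟨
        N (k ∗ᵛ κ) i j ∎))
      (∑-∗ᵛ k nk≉0 λ κ≈λ → resp λ i j _ → +ᶠ-congˡ (N-cong κ≈λ i j))
      where
      open ≈-Reasoning
      nk≉0 : ¬ (normᴷ k ≈ 0#)
      nk≉0 eq = 1≉0 (begin
        1#            ≈⟨ solve 1 (λ u → u := :- (:- u)) ≈-refl 1# ⟩
        -ᶠ (-ᶠ 1#)    ≈⟨ -‿cong nk≈-1 ⟨
        -ᶠ normᴷ k    ≈⟨ -‿cong eq ⟩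
        -ᶠ 0#         ≈⟨ +-identityˡ _ ⟨
        0# -ᶠ 0#      ≈⟨ -‿inverseʳ 0# ⟩
        0# ∎)

    Θ² : ∀ {f} → Respects (QForm-setoid n) f → ∀ P → Θ (Θ f) P ≡ T² f P
    Θ² {f} resp P = trans (sym (Θ-negated (λ P≈Q → ∑-cong (𝕂𝕍 n) λ κ → resp λ i j le → +ᶠ-congʳ (P≈Q i j le)) P)) (∑Θ-N resp P)

  0ᴷ 1ᴷ : K
  0ᴷ = 0# , 0#
  1ᴷ = 1# , 0#

  ∗-zeroʳ : ∀ k → Setoid._≈_ K-setoid 0ᴷ (k ∗ 0ᴷ)
  ∗-zeroʳ (x , y) =
      ≈-sym (≈-trans (solve 4 (λ d x y z → x :* z :+ d :* (y :* z) := z :* (x :+ d :* y)) ≈-refl d x y 0#) (zeroˡ _))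
    , ≈-sym (≈-trans (solve 3 (λ x y z → (x :* z :+ y :* z) :+ y :* z := z :* (x :+ y :+ y)) ≈-refl x y 0#) (zeroˡ _))

  ∗-identityʳ : ∀ k → Setoid._≈_ K-setoid k (k ∗ 1ᴷ)
  ∗-identityʳ (x , y) =
      ≈-sym (≈-trans (+ᶠ-cong (*-identityʳ x) (≈-trans (·-congˡ (zeroʳ y)) (zeroʳ d))) (+-identityʳ x))
    , ≈-sym (≈-trans (+ᶠ-cong (≈-trans (+ᶠ-cong (zeroʳ x) (*-identityʳ y)) (+-identityˡ y)) (zeroʳ y)) (+-identityʳ y))

  K-cons-cong : ∀ {m} {k l} {κ λ′ : Fin m → K} → Setoid._≈_ K-setoid k l → Setoid._≈_ (KV-setoid m) κ λ′ →
    Setoid._≈_ (KV-setoid (suc m)) (k Vector.∷ κ) (l Vector.∷ λ′)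
  K-cons-cong k≈l κ≈λ Fin.zero = k≈l
  K-cons-cong k≈l κ≈λ (Fin.suc i) = κ≈λ i

  ∗ᵛ-cons : ∀ {m} {k l l′} {κ : Fin m → K} → Setoid._≈_ K-setoid l (k ∗ l′) →
    Setoid._≈_ (KV-setoid (suc m)) (l Vector.∷ (k ∗ᵛ κ)) (k ∗ᵛ (l′ Vector.∷ κ))
  ∗ᵛ-cons eq Fin.zero = eq
  ∗ᵛ-cons eq (Fin.suc i) = Setoid.refl K-setoid

  module _ {n : ℕ} {f : QForm R n → ℤ} (f-resp : Respects (QForm-setoid n) f) where

    -- Write a nonzero vector as k (0, …, 0, 1, …) with k its first nonzero coordinate: as k varies,
    -- its norm takes every value in F \ {0} exactly q + 1 times.
    ∑-hermitian-mod : ∀ m (M : (Fin m → K) → QForm R n) →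
      (∀ {κ λ′} → Setoid._≈_ (KV-setoid m) κ λ′ → M κ ≈q M λ′) → (∀ k κ → M (k ∗ᵛ κ) ≈q normᴷ k • M κ) →
      ∀ P → ∃ λ w → (∑[ κ ∈ 𝕂𝕍 m ] f (P ⊞ M κ)) ≡ f P + (1ℤ + pos q) * w
    -- Homogeneity with the scalar 0 forces `M` to vanish at the empty vector.
    ∑-hermitian-mod zero M M-cong M-∗ P = 0ℤ , trans (ℤₚ.+-identityʳ _) (trans (f-resp λ i j le → begin
        P i j +ᶠ M Vector.[] i j                       ≈⟨ +ᶠ-congˡ (M-cong (λ ()) i j le) ⟩
        P i j +ᶠ M (0ᴷ ∗ᵛ Vector.[]) i j               ≈⟨ +ᶠ-congˡ (M-∗ 0ᴷ Vector.[] i j le) ⟩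
        P i j +ᶠ norm 0# 0# · M Vector.[] i j          ≈⟨ +ᶠ-congˡ (≈-trans (·-congʳ norm-00) (zeroˡ _)) ⟩
        P i j +ᶠ 0#                                    ≈⟨ +-identityʳ _ ⟩
        P i j ∎) (sym (trans (cong (f P +_) (ℤₚ.*-zeroʳ (1ℤ + pos q))) (ℤₚ.+-identityʳ _))))
      where open ≈-Reasoning
    ∑-hermitian-mod (suc m) M M-cong M-∗ P =
      w₀ + (∑[ κ ∈ 𝕂𝕍 m ] W κ) , (begin
        (∑[ κ ∈ 𝕂𝕍 (suc m) ] f (P ⊞ M κ))
          ≡⟨ ∑-vector-suc K-enumeration m (λ κ → f (P ⊞ M κ)) ⟩
        (∑[ k ∈ 𝕂 ] h k)
          ≡⟨ ∑-cong 𝕂 h-split ⟩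
        (∑[ k ∈ 𝕂 ] (h′ k + [ k ≟ᴷ 0ᴷ ] * (h 0ᴷ - h′ 0ᴷ)))
          ≡⟨ ∑-+ 𝕂 h′ (λ k → [ k ≟ᴷ 0ᴷ ] * (h 0ᴷ - h′ 0ᴷ)) ⟩
        ∑ 𝕂 h′ + (∑[ k ∈ 𝕂 ] [ k ≟ᴷ 0ᴷ ] * (h 0ᴷ - h′ 0ᴷ))
          ≡⟨ cong (∑ 𝕂 h′ +_) (trans (∑-*ʳ 𝕂 (h 0ᴷ - h′ 0ᴷ) (λ k → [ k ≟ᴷ 0ᴷ ]))
               (trans (cong (_* (h 0ᴷ - h′ 0ᴷ)) (Enumeration.once K-enumeration 0ᴷ)) (ℤₚ.*-identityˡ (h 0ᴷ - h′ 0ᴷ)))) ⟩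
        ∑ 𝕂 h′ + (h 0ᴷ - h′ 0ᴷ)
          ≡⟨ rearrange (∑ 𝕂 h′) (h 0ᴷ) (h′ 0ᴷ) ⟩
        h 0ᴷ + (∑ 𝕂 h′ - h′ 0ᴷ)
          ≡⟨ cong₂ _+_ (proj₂ ih) excess ⟩
        (f P + (1ℤ + pos q) * w₀) + (1ℤ + pos q) * (∑[ κ ∈ 𝕂𝕍 m ] W κ)
          ≡⟨ collect (f P) (1ℤ + pos q) w₀ (∑[ κ ∈ 𝕂𝕍 m ] W κ) ⟩
        f P + (1ℤ + pos q) * (w₀ + (∑[ κ ∈ 𝕂𝕍 m ] W κ)) ∎)
      where
      open ≡.≡-Reasoning
      _≟ᴷ_ = Enumeration._≟_ K-enumeration
      -- On vectors with first coordinate 0, `M` is again homogeneous under the norm. The induction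
      -- needs such restrictions, hence a general `M` in place of `N`.
      ih : ∃ λ w → (∑[ κ ∈ 𝕂𝕍 m ] f (P ⊞ M (0ᴷ Vector.∷ κ))) ≡ f P + (1ℤ + pos q) * w
      ih = ∑-hermitian-mod m (λ κ → M (0ᴷ Vector.∷ κ))
        (λ κ≈λ → M-cong (K-cons-cong (Setoid.refl K-setoid) κ≈λ))
        (λ k κ → Setoid.trans (QForm-setoid n) (M-cong (∗ᵛ-cons (∗-zeroʳ k))) (M-∗ k (0ᴷ Vector.∷ κ))) P
      w₀ : ℤ
      w₀ = proj₁ ih
      -- `h k` collects the vectors with first coordinate k. For k ≠ 0 the substitution of kκ for
      -- the tail κ turns it into `h′ k`, where k enters only through its norm; k = 0 is treated as
      -- a correction.
      h h′ : K → ℤ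
      h k = ∑[ κ ∈ 𝕂𝕍 m ] f (P ⊞ M (k Vector.∷ κ))
      h′ k = ∑[ κ ∈ 𝕂𝕍 m ] f (P ⊞ normᴷ k • M (1ᴷ Vector.∷ κ))
      h-resp : Respects K-setoid h
      h-resp k≈l = ∑-cong (𝕂𝕍 m) λ κ → f-resp λ i j le → +ᶠ-congˡ (M-cong (K-cons-cong k≈l (λ _ → Setoid.refl K-setoid)) i j le)
      h′-resp : Respects K-setoid h′
      h′-resp k≈l = ∑-cong (𝕂𝕍 m) λ κ → f-resp λ i j le → +ᶠ-congˡ (·-congʳ (norm-cong k≈l))
      h≡h′ : ∀ k → ¬ (Setoid._≈_ K-setoid k 0ᴷ) → h k ≡ h′ k
      h≡h′ k k≉0 = trans
        (sym (∑-∗ᵛ k (λ nk≈0 → k≉0 (norm-anisotropic (proj₁ k) (proj₂ k) nk≈0))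
          λ κ≈λ → f-resp λ i j le → +ᶠ-congˡ (M-cong (K-cons-cong (Setoid.refl K-setoid) κ≈λ) i j le)))
        (∑-cong (𝕂𝕍 m) λ κ → f-resp λ i j le → +ᶠ-congˡ
          (≈-trans (M-cong (∗ᵛ-cons (∗-identityʳ k)) i j le) (M-∗ k (1ᴷ Vector.∷ κ) i j le)))
      h-split : ∀ k → h k ≡ h′ k + [ k ≟ᴷ 0ᴷ ] * (h 0ᴷ - h′ 0ᴷ)
      h-split k = split (k ≟ᴷ 0ᴷ) (λ k≈0 → h-resp k≈0) (λ k≈0 → h′-resp k≈0) (h≡h′ k)
        where
        split : ∀ {p x y x₀ y₀} {P : Set p} (P? : Dec P) → (P → x ≡ x₀) → (P → y ≡ y₀) → (¬ P → x ≡ y) →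
          x ≡ y + [ P? ] * (x₀ - y₀)
        split {x = x} {y} (yes p) x≡x₀ y≡y₀ _ with refl ← x≡x₀ p | refl ← y≡y₀ p = aux x y
          where
          aux : ∀ x y → x ≡ y + 1ℤ * (x - y)
          aux = solve-∀
        split {y = y} {x₀} {y₀} (no ¬p) _ _ x≡y = trans (x≡y ¬p) (aux y (x₀ - y₀))
          where
          aux : ∀ y z → y ≡ y + 0ℤ * z
          aux = solve-∀
      g : (Fin m → K) → F → ℤ
      g κ x = f (P ⊞ x • M (1ᴷ Vector.∷ κ))
      g-resp : ∀ κ → Respects F-setoid (g κ)
      g-resp κ x≈y = f-resp λ i j le → +ᶠ-congˡ (·-congʳ x≈y)
      g-0 : ∀ κ {x} → x ≈ 0# → g κ x ≡ f P
      g-0 κ x≈0 = f-resp λ i j le → ≈-trans (+ᶠ-congˡ (≈-trans (·-congʳ x≈0) (zeroˡ _))) (+-identityʳ _)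
      W : (Fin m → K) → ℤ
      W κ = ∑ 𝔽 (g κ) - f P
      -- For fixed κ, the nonzero k run q + 1 times through the nonzero multiples of M(1, κ), so
      -- removing k = 0 leaves a multiple of q + 1.
      excess : ∑ 𝕂 h′ - h′ 0ᴷ ≡ (1ℤ + pos q) * (∑[ κ ∈ 𝕂𝕍 m ] W κ)
      excess = begin
        ∑ 𝕂 h′ - h′ 0ᴷ
          ≡⟨ cong (_- h′ 0ᴷ) (∑-swap 𝕂 (𝕂𝕍 m) (λ k κ → g κ (normᴷ k))) ⟩
        (∑[ κ ∈ 𝕂𝕍 m ] ∑[ k ∈ 𝕂 ] g κ (normᴷ k)) - h′ 0ᴷ
          ≡⟨ ∑-- (𝕂𝕍 m) (λ κ → ∑[ k ∈ 𝕂 ] g κ (normᴷ k)) (λ κ → g κ (normᴷ 0ᴷ)) ⟨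
        (∑[ κ ∈ 𝕂𝕍 m ] ((∑[ k ∈ 𝕂 ] g κ (normᴷ k)) - g κ (normᴷ 0ᴷ)))
          ≡⟨ ∑-cong (𝕂𝕍 m) (λ κ → pointwise (∑[ k ∈ 𝕂 ] g κ (normᴷ k)) (g κ (normᴷ 0ᴷ)) (f P) (pos q) (∑ 𝔽 (g κ)) (g-0 κ norm-00)
               (trans (cong (λ z → (∑[ k ∈ 𝕂 ] g κ (normᴷ k)) + pos q * z) (sym (g-0 κ ≈-refl))) (∑-norm (g-resp κ)))) ⟩
        (∑[ κ ∈ 𝕂𝕍 m ] (1ℤ + pos q) * W κ)
          ≡⟨ ∑-*ˡ (𝕂𝕍 m) (1ℤ + pos q) W ⟩
        (1ℤ + pos q) * (∑[ κ ∈ 𝕂𝕍 m ] W κ) ∎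
        where
        pointwise : ∀ s t x z c → t ≡ x → s + z * x ≡ (1ℤ + z) * c → s - t ≡ (1ℤ + z) * (c - x)
        pointwise s .x x z c refl eq = trans (aux₁ s x z) (trans (cong (_- (1ℤ + z) * x) eq) (aux₂ z c x))
          where
          aux₁ : ∀ s x z → s - x ≡ (s + z * x) - (1ℤ + z) * x
          aux₁ = solve-∀
          aux₂ : ∀ z c x → (1ℤ + z) * c - (1ℤ + z) * x ≡ (1ℤ + z) * (c - x)
          aux₂ = solve-∀
      rearrange : ∀ a b c → a + (b - c) ≡ b + (a - c)
      rearrange = solve-∀
      collect : ∀ a b c e → (a + b * c) + b * e ≡ a + b * (c + e)
      collect = solve-∀

  module _ {n : ℕ} where

    Θ-resp : ∀ {f} → Respects (QForm-setoid n) f → Respects (QForm-setoid n) (Θ f)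
    Θ-resp f-resp P≈P′ = ∑-cong (𝕂𝕍 n) λ κ → f-resp λ i j le → +ᶠ-congʳ (P≈P′ i j le)

    Θ-mod : ∀ {f} → Respects (QForm-setoid n) f → ∀ P → ∃ λ w → Θ f P ≡ f P + (1ℤ + pos q) * w
    Θ-mod f-resp = ∑-hermitian-mod f-resp n N (λ κ≈λ i j _ → N-cong κ≈λ i j) (λ k κ i j _ → N-∗ k κ i j)

  q≥2 : 2 ℕ.≤ q
  q≥2 = ℤₚ.drop‿+≤+ (begin
    pos 2                                            ≡⟨ cong₂ _+_ (once 0#) (once 1#) ⟨
    (∑[ x ∈ 𝔽 ] [ x ≟ 0# ]) + (∑[ x ∈ 𝔽 ] [ x ≟ 1# ])  ≡⟨ ∑-+ 𝔽 (λ x → [ x ≟ 0# ]) (λ x → [ x ≟ 1# ]) ⟨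
    (∑[ x ∈ 𝔽 ] ([ x ≟ 0# ] + [ x ≟ 1# ]))             ≤⟨ ∑-mono 𝔽 disjoint ⟩
    (∑[ x ∈ 𝔽 ] 1ℤ)                                   ≡⟨ trans (∑-const-F 1ℤ) (ℤₚ.*-identityʳ (pos q)) ⟩
    pos q ∎)
    where
    open ℤₚ.≤-Reasoning
    disjoint : ∀ x → [ x ≟ 0# ] + [ x ≟ 1# ] ≤ 1ℤ
    disjoint x with x ≟ 0# | x ≟ 1#
    ... | yes x≈0 | yes x≈1 = contradiction (≈-trans (≈-sym x≈1) x≈0) 1≉0
    ... | yes _ | no _ = ℤₚ.≤-refl
    ... | no _ | yes _ = ℤₚ.≤-refl
    ... | no _ | no _ = +≤+ ℕ.z≤n

  -- Induction from -q = 1 - (1 + q).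
  -q^≡1-mod : ∀ k → ∃ λ z → (- pos q) ^ k ≡ 1ℤ + (1ℤ + pos q) * z
  -q^≡1-mod zero = 0ℤ , sym (trans (cong (1ℤ +_) (ℤₚ.*-zeroʳ (1ℤ + pos q))) (ℤₚ.+-identityʳ 1ℤ))
  -q^≡1-mod (suc k) with -q^≡1-mod k
  ... | z , eq = - 1ℤ - pos q * z , trans (cong (- pos q *_) eq) (aux (pos q) z)
    where
    aux : ∀ x z → - x * (1ℤ + (1ℤ + x) * z) ≡ 1ℤ + (1ℤ + x) * (- 1ℤ - x * z)
    aux = solve-∀

  module _ {n : ℕ} (y z : ℤ) (y≡1 : y ≡ 1ℤ + (1ℤ + pos q) * z) where

    -- Infinite descent: 2ν is divisible by q + 1 > 2, and the quotient is again an eigenfunction.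
    eigenvalue-sign : ∀ b ν → Respects (QForm-setoid n) ν → (∀ P → Θ ν P ≡ - y * ν P) →
      ∀ P → ∣ ν P ∣ ℕ.≤ b → ν P ≡ 0ℤ
    eigenvalue-sign zero ν ν-resp eigen P ∣νP∣≤0 = ℤₚ.∣i∣≡0⇒i≡0 (ℕₚ.n≤0⇒n≡0 ∣νP∣≤0)
    eigenvalue-sign (suc b) ν ν-resp eigen P ∣νP∣≤1+b = ℤₚ.*-cancelˡ-≡ (pos 2) (ν P) 0ℤ (begin
      pos 2 * ν P                ≡⟨ double P ⟩
      (1ℤ + pos q) * ν′ P        ≡⟨ cong ((1ℤ + pos q) *_) (eigenvalue-sign b ν′ ν′-resp ν′-eigen P ∣ν′P∣≤b) ⟩
      (1ℤ + pos q) * 0ℤ          ≡⟨ ℤₚ.*-zeroʳ (1ℤ + pos q) ⟩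
      pos 2 * 0ℤ ∎)
      where
      open ≡.≡-Reasoning
      -- Comparing Θν = -yν with Θν = ν + (q + 1)w, where y = 1 + (q + 1)z, gives 2ν = (q + 1)(-zν -
      -- w).
      ν′ : QForm R n → ℤ
      ν′ P = - (z * ν P) - proj₁ (Θ-mod ν-resp P)
      double : ∀ P → pos 2 * ν P ≡ (1ℤ + pos q) * ν′ P
      double P = begin
        pos 2 * ν P
          ≡⟨ aux₁ y (ν P) ⟩
        ν P + - (- y * ν P) + (1ℤ - y) * ν P
          ≡⟨ cong₂ (λ s t → ν P + - s + (1ℤ - t) * ν P) (trans (sym (eigen P)) (proj₂ (Θ-mod ν-resp P))) y≡1 ⟩
        ν P + - (ν P + (1ℤ + pos q) * proj₁ (Θ-mod ν-resp P)) + (1ℤ - (1ℤ + (1ℤ + pos q) * z)) * ν P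
          ≡⟨ aux₂ (ν P) (1ℤ + pos q) (proj₁ (Θ-mod ν-resp P)) z ⟩
        (1ℤ + pos q) * ν′ P ∎
        where
        aux₁ : ∀ y v → pos 2 * v ≡ v + - (- y * v) + (1ℤ - y) * v
        aux₁ = solve-∀
        aux₂ : ∀ v x w z → v + - (v + x * w) + (1ℤ - (1ℤ + x * z)) * v ≡ x * (- (z * v) - w)
        aux₂ = solve-∀
      ν′-resp : Respects (QForm-setoid n) ν′
      ν′-resp {P} {P′} P≈P′ = ℤₚ.*-cancelˡ-≡ (1ℤ + pos q) (ν′ P) (ν′ P′)
        (trans (sym (double P)) (trans (cong (pos 2 *_) (ν-resp P≈P′)) (double P′)))
      ν′-eigen : ∀ P → Θ ν′ P ≡ - y * ν′ P
      ν′-eigen P = ℤₚ.*-cancelˡ-≡ (1ℤ + pos q) (Θ ν′ P) (- y * ν′ P) (begin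
        (1ℤ + pos q) * Θ ν′ P                        ≡⟨ ∑-*ˡ (𝕂𝕍 n) (1ℤ + pos q) (λ κ → ν′ (P ⊞ N κ)) ⟨
        (∑[ κ ∈ 𝕂𝕍 n ] (1ℤ + pos q) * ν′ (P ⊞ N κ))   ≡⟨ ∑-cong (𝕂𝕍 n) (λ κ → double (P ⊞ N κ)) ⟨
        (∑[ κ ∈ 𝕂𝕍 n ] pos 2 * ν (P ⊞ N κ))           ≡⟨ ∑-*ˡ (𝕂𝕍 n) (pos 2) (λ κ → ν (P ⊞ N κ)) ⟩
        pos 2 * Θ ν P                                ≡⟨ cong (pos 2 *_) (eigen P) ⟩
        pos 2 * (- y * ν P)                          ≡⟨ swap (pos 2) (- y) (ν P) ⟩
        - y * (pos 2 * ν P)                          ≡⟨ cong (- y *_) (double P) ⟩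
        - y * ((1ℤ + pos q) * ν′ P)                  ≡⟨ swap (- y) (1ℤ + pos q) (ν′ P) ⟩
        (1ℤ + pos q) * (- y * ν′ P) ∎)
        where
        swap : ∀ a b c → a * (b * c) ≡ b * (a * c)
        swap = solve-∀
      -- A larger value would give (q + 1)(b + 1) ≤ (q + 1)∣ν′ P∣ = 2∣ν P∣ ≤ 2(b + 1), although q +
      -- 1 > 2.
      ∣ν′P∣≤b : ∣ ν′ P ∣ ℕ.≤ b
      ∣ν′P∣≤b = ℕₚ.≮⇒≥ λ b<∣ν′P∣ → ℕₚ.<-irrefl refl (ℕₚ.<-≤-trans
        (ℕₚ.*-monoˡ-< (suc b) (ℕ.s≤s q≥2))
        (ℕₚ.≤-trans (ℕₚ.*-monoʳ-≤ (suc q) b<∣ν′P∣) (ℕₚ.≤-trans (ℕₚ.≤-reflexive abs-double) (ℕₚ.*-monoʳ-≤ 2 ∣νP∣≤1+b))))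
        where
        abs-double : suc q ℕ.* ∣ ν′ P ∣ ≡ 2 ℕ.* ∣ ν P ∣
        abs-double = trans (sym (ℤₚ.abs-* (1ℤ + pos q) (ν′ P))) (trans (cong ∣_∣ (sym (double P))) (ℤₚ.abs-* (pos 2) (ν P)))

  -- The sign of the eigenvalue is dictated by Θ ≡ 1 ≡ (-q)^k mod q + 1.
  Θ-eigenvalue : ∀ {n} k f → Respects (QForm-setoid n) f →
    (∀ P → T² f P ≡ (- pos q) ^ k * ((- pos q) ^ k * f P)) → ∀ P → Θ f P ≡ (- pos q) ^ k * f P
  Θ-eigenvalue {n} k f f-resp T²f P = ℤₚ.i-j≡0⇒i≡j (Θ f P) (y * f P)
    (eigenvalue-sign y (proj₁ (-q^≡1-mod k)) (proj₂ (-q^≡1-mod k)) ∣ ν P ∣ ν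
      (λ P≈P′ → cong₂ _-_ (Θ-resp f-resp P≈P′) (cong (y *_) (f-resp P≈P′))) eigen P ℕₚ.≤-refl)
    where
    open ≡.≡-Reasoning
    y = (- pos q) ^ k
    -- Up to a factor this is the component of `f` with the wrong sign: Θ²f = y²f gives Θν = -yν,
    -- and such a ν must vanish.
    ν : QForm R n → ℤ
    ν P = Θ f P - y * f P
    eigen : ∀ P → Θ ν P ≡ - y * ν P
    eigen P = begin
      (∑[ κ ∈ 𝕂𝕍 n ] (Θ f (P ⊞ N κ) - y * f (P ⊞ N κ)))
        ≡⟨ ∑-- (𝕂𝕍 n) (λ κ → Θ f (P ⊞ N κ)) (λ κ → y * f (P ⊞ N κ)) ⟩
      Θ (Θ f) P - (∑[ κ ∈ 𝕂𝕍 n ] y * f (P ⊞ N κ))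
        ≡⟨ cong₂ _-_ (trans (Θ² f-resp P) (T²f P)) (∑-*ˡ (𝕂𝕍 n) y (λ κ → f (P ⊞ N κ))) ⟩
      y * (y * f P) - y * Θ f P
        ≡⟨ aux y (f P) (Θ f P) ⟩
      - y * ν P ∎
      where
      aux : ∀ y a b → y * (y * a) - y * b ≡ - y * (b - y * a)
      aux = solve-∀

-- Products of linear forms

module Products {c ℓ : Level} (R : CommutativeRing c ℓ) (q : ℕ) (isField : IsField R) (card : HasCardinality R q) where

  open NormSums R q isField card public

  triangle : ℕ → ℕ
  triangle zero = 0
  triangle (suc n) = suc n ℕ.+ triangle n

  private
    bordered : ∀ {n} → LinForm R (suc n) × QForm R n → QForm R (suc n)
    bordered (r , Q) Fin.zero j = r j
    -- An arbitrary filler: entries below the diagonal are ignored by `_≈Q_`.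
    bordered (r , Q) (Fin.suc i) Fin.zero = 0#
    bordered (r , Q) (Fin.suc i) (Fin.suc j) = Q i j

    unbordered : ∀ {n} → QForm R (suc n) → LinForm R (suc n) × QForm R n
    unbordered P = P Fin.zero , λ i j → P (Fin.suc i) (Fin.suc j)

    bordered-to : ∀ {n} x (P : QForm R (suc n)) → bordered x ≈q P →
      Setoid._≈_ (×-setoid (L-setoid (suc n)) (QForm-setoid n)) x (unbordered P)
    bordered-to x P eq = (λ j → eq Fin.zero j ℕ.z≤n) , λ i j le → eq (Fin.suc i) (Fin.suc j) (ℕ.s≤s le)

    bordered-from : ∀ {n} x (P : QForm R (suc n)) →
      Setoid._≈_ (×-setoid (L-setoid (suc n)) (QForm-setoid n)) x (unbordered P) → bordered x ≈q P
    bordered-from x P (r≈ , Q≈) Fin.zero j le = r≈ j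
    bordered-from x P (r≈ , Q≈) (Fin.suc i) (Fin.suc j) (ℕ.s≤s le) = Q≈ i j le

  QForm-enumeration : ∀ n → Enumeration (QForm-setoid n)
  QForm-enumeration zero = record { elements = (λ ()) ∷ [] ; _≟_ = λ _ _ → yes λ () ; once = λ _ → refl }
  QForm-enumeration (suc n) = transport-enumeration (QForm-setoid (suc n))
    (×-enumeration (L-enumeration (suc n)) (QForm-enumeration n)) bordered unbordered bordered-to bordered-from

  size-L : ∀ n → length (𝕃 n) ≡ q ℕ.^ n
  size-L n = trans (size-vector F-enumeration n) (cong (ℕ._^ n) size-F)

  size-KV : ∀ n → length (𝕂𝕍 n) ≡ (q ℕ.* q) ℕ.^ n
  size-KV n = trans (size-vector K-enumeration n)
    (cong (ℕ._^ n) (trans (size-× F-enumeration F-enumeration) (cong₂ ℕ._*_ size-F size-F)))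

  size-QForm : ∀ n → Enumeration.size (QForm-enumeration n) ≡ q ℕ.^ triangle n
  size-QForm zero = refl
  size-QForm (suc n) = trans (Listₚ.length-map bordered (Enumeration.elements (×-enumeration (L-enumeration (suc n)) (QForm-enumeration n))))
    (trans (size-× (L-enumeration (suc n)) (QForm-enumeration n))
      (trans (cong₂ ℕ._*_ (size-L (suc n)) (size-QForm n)) (sym (ℕₚ.^-distribˡ-+-* q (suc n) (triangle n)))))

  module _ {n : ℕ} where

    ⊙-comm : ∀ (a b : LinForm R n) i j → (a ⊙ b) i j ≈ (a ⊙ b) j i
    ⊙-comm a b i j with i Fin.≟ j | j Fin.≟ i
    ... | yes refl | yes _ = ≈-refl
    ... | yes i≡j | no j≢i = contradiction (sym i≡j) j≢i
    ... | no i≢j | yes j≡i = contradiction (sym j≡i) i≢j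
    ... | no _ | no _ = +-comm _ _

    ⊙-diagonal : ∀ (a b : LinForm R n) i → (a ⊙ b) i i ≈ a i · b i
    ⊙-diagonal a b i with i Fin.≟ i
    ... | yes _ = ≈-refl
    ... | no i≢i = contradiction refl i≢i

    ⊙-off-diagonal : ∀ (a b : LinForm R n) {i j} → ¬ (i ≡ j) → (a ⊙ b) i j ≈ a i · b j +ᶠ a j · b i
    ⊙-off-diagonal a b {i} {j} i≢j with i Fin.≟ j
    ... | yes i≡j = contradiction i≡j i≢j
    ... | no _ = ≈-refl

    -- Equality of forms sees only the entries with i ≤ j. Products of linear forms have symmetric
    -- tables, so coefficients can then be compared without regard to the order of the indices.
    symmetric-≈0 : ∀ {Z : QForm R n} → (∀ i j → Z i j ≈ Z j i) → Z ≈q 0Q R → ∀ i j → Z i j ≈ 0#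
    symmetric-≈0 Z-sym Z≈0 i j with Finₚ.≤-total i j
    ... | inj₁ i≤j = Z≈0 i j i≤j
    ... | inj₂ j≤i = ≈-trans (Z-sym i j) (Z≈0 j i j≤i)

    0ᴸ : LinForm R n
    0ᴸ _ = 0#

    ⊙-zeroʳ : ∀ (a : LinForm R n) i j → (a ⊙ 0ᴸ) i j ≈ 0#
    ⊙-zeroʳ a i j with i Fin.≟ j
    ... | yes _ = zeroʳ _
    ... | no _ = ≈-trans (+ᶠ-cong (zeroʳ _) (zeroʳ _)) (+-identityʳ 0#)

    ⊙-zeroˡ : ∀ (a : LinForm R n) i j → (0ᴸ ⊙ a) i j ≈ 0#
    ⊙-zeroˡ a i j with i Fin.≟ j
    ... | yes _ = zeroˡ _
    ... | no _ = ≈-trans (+ᶠ-cong (zeroˡ _) (zeroˡ _)) (+-identityʳ 0#)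

    _≋_ : LinForm R n → LinForm R n → Set ℓ
    a ≋ b = ∀ i → a i ≈ b i

    nonzero-coordinate : ∀ {a b : LinForm R n} → ¬ (a ≋ b) → ∃ λ i → ¬ (a i ≈ b i)
    nonzero-coordinate {a} {b} = Finₚ.¬∀⟶∃¬ n (λ i → a i ≈ b i) (λ i → a i ≟ b i)

    -- If a_i ≠ 0, the coefficient of x_i² gives b_i = 0, after which that of x_i x_j is a_i b_j.
    ⊙-integral : ∀ {a b : LinForm R n} → a ⊙ b ≈q 0Q R → ¬ (a ≋ 0ᴸ) → b ≋ 0ᴸ
    ⊙-integral {a} {b} ab≈0 a≉0 with nonzero-coordinate a≉0
    ... | i , ai≉0 = b≈0
      where
      all≈0 : ∀ i j → (a ⊙ b) i j ≈ 0#
      all≈0 = symmetric-≈0 (⊙-comm a b) ab≈0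
      bi≈0 : b i ≈ 0#
      bi≈0 = cancel-nonzero ai≉0 (≈-trans (≈-sym (⊙-diagonal a b i)) (all≈0 i i))
      b≈0 : b ≋ 0ᴸ
      b≈0 j with i Fin.≟ j
      ... | yes refl = bi≈0
      ... | no i≢j = cancel-nonzero ai≉0 (begin
        a i · b j                   ≈⟨ +-identityʳ _ ⟨
        a i · b j +ᶠ 0#             ≈⟨ +ᶠ-congˡ (≈-trans (·-congˡ bi≈0) (zeroʳ (a j))) ⟨
        a i · b j +ᶠ a j · b i      ≈⟨ ⊙-off-diagonal a b i≢j ⟨
        (a ⊙ b) i j                 ≈⟨ all≈0 i j ⟩
        0# ∎)
        where open ≈-Reasoning

    -- For independent a and b, the syzygies a u + b v = 0 are (u , v) = t (b , -a), and are determined by one coordinate of v.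
    syzygy : ∀ {a b u v : LinForm R n} {i s} → ¬ (a i ≈ 0#) → s · a i ≈ b i → ¬ (b ≋ (λ j → s · a j)) →
      a ⊙ u ⊞ b ⊙ v ≈q 0Q R → v i ≈ 0# → u ≋ 0ᴸ × v ≋ 0ᴸ
    syzygy {a} {b} {u} {v} {i} {s} ai≉0 sai≈bi b≉sa eq vi≈0 = u≈0 , v≈0
      where
      open ≈-Reasoning
      all≈0 : ∀ i j → (a ⊙ u ⊞ b ⊙ v) i j ≈ 0#
      all≈0 = symmetric-≈0 (λ i j → +ᶠ-cong (⊙-comm a u i j) (⊙-comm b v i j)) eq
      ui≈0 : u i ≈ 0#
      ui≈0 = cancel-nonzero ai≉0 (begin
        a i · u i                       ≈⟨ +-identityʳ _ ⟨
        a i · u i +ᶠ 0#                 ≈⟨ +ᶠ-congˡ (≈-trans (·-congˡ vi≈0) (zeroʳ (b i))) ⟨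
        a i · u i +ᶠ b i · v i          ≈⟨ +ᶠ-cong (⊙-diagonal a u i) (⊙-diagonal b v i) ⟨
        (a ⊙ u ⊞ b ⊙ v) i i             ≈⟨ all≈0 i i ⟩
        0# ∎)
      -- With u_i = v_i = 0 and b_i = s a_i, the coefficient of x_i x_j in au + bv is a_i(u_j + s
      -- v_j).
      u+sv≈0 : ∀ j → u j +ᶠ s · v j ≈ 0#
      u+sv≈0 j with i Fin.≟ j
      ... | yes refl = ≈-trans (+ᶠ-cong ui≈0 (≈-trans (·-congˡ vi≈0) (zeroʳ s))) (+-identityʳ 0#)
      ... | no i≢j = cancel-nonzero ai≉0 (begin
        a i · (u j +ᶠ s · v j)
          ≈⟨ solve 4 (λ a u s v → a :* (u :+ s :* v) := a :* u :+ (s :* a) :* v) ≈-refl (a i) (u j) s (v j) ⟩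
        a i · u j +ᶠ (s · a i) · v j
          ≈⟨ +ᶠ-congˡ (·-congʳ sai≈bi) ⟩
        a i · u j +ᶠ b i · v j
          ≈⟨ +ᶠ-cong (+-identityʳ _) (+-identityʳ _) ⟨
        (a i · u j +ᶠ 0#) +ᶠ (b i · v j +ᶠ 0#)
          ≈⟨ +ᶠ-cong (+ᶠ-congˡ (≈-trans (·-congˡ ui≈0) (zeroʳ (a j)))) (+ᶠ-congˡ (≈-trans (·-congˡ vi≈0) (zeroʳ (b j)))) ⟨
        (a i · u j +ᶠ a j · u i) +ᶠ (b i · v j +ᶠ b j · v i)
          ≈⟨ +ᶠ-cong (⊙-off-diagonal a u i≢j) (⊙-off-diagonal b v i≢j) ⟨
        (a ⊙ u ⊞ b ⊙ v) i j
          ≈⟨ all≈0 i j ⟩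
        0# ∎)
      -- au + bv = a(u + sv) + (b - sa)v. The first product is already zero and b - sa is not, so v
      -- = 0.
      e : LinForm R n
      e j = b j -ᶠ s · a j
      e≉0 : ¬ (e ≋ 0ᴸ)
      e≉0 e≈0 = b≉sa λ j → x-y≈0⇒x≈y (b j) (s · a j) (e≈0 j)
      split : ∀ i j → (e ⊙ v) i j ≈ (a ⊙ u ⊞ b ⊙ v) i j -ᶠ (a ⊙ (λ k → u k +ᶠ s · v k)) i j
      split i j with i Fin.≟ j
      ... | yes _ = solve 5 (λ a b u v s → (b :- s :* a) :* v := (a :* u :+ b :* v) :- a :* (u :+ s :* v)) ≈-refl (a i) (b i) (u i) (v i) s
      ... | no _ = solve 9 (λ s a b u v a′ b′ u′ v′ →
            (b :- s :* a) :* v′ :+ (b′ :- s :* a′) :* v :=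
            ((a :* u′ :+ a′ :* u) :+ (b :* v′ :+ b′ :* v)) :- (a :* (u′ :+ s :* v′) :+ a′ :* (u :+ s :* v)))
            ≈-refl s (a i) (b i) (u i) (v i) (a j) (b j) (u j) (v j)
      v≈0 : v ≋ 0ᴸ
      v≈0 = ⊙-integral (λ i j _ → begin
        (e ⊙ v) i j            ≈⟨ split i j ⟩
        (a ⊙ u ⊞ b ⊙ v) i j -ᶠ (a ⊙ (λ k → u k +ᶠ s · v k)) i j
          ≈⟨ +ᶠ-cong (all≈0 i j) (-‿cong (≈-trans (⊙-cong (λ _ → ≈-refl) u+sv≈0 i j) (⊙-zeroʳ a i j))) ⟩
        0# -ᶠ 0#               ≈⟨ -‿inverseʳ 0# ⟩
        0# ∎) e≉0
      u≈0 : u ≋ 0ᴸ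
      u≈0 j = begin
        u j                ≈⟨ +-identityʳ _ ⟨
        u j +ᶠ 0#          ≈⟨ +ᶠ-congˡ (≈-trans (·-congˡ (v≈0 j)) (zeroʳ s)) ⟨
        u j +ᶠ s · v j     ≈⟨ u+sv≈0 j ⟩
        0# ∎

    -- The coefficient of x_i² in `N κ` is the norm of the i-th coordinate of κ.
    N-anisotropic : ∀ {κ : Fin n → K} → N κ ≈q 0Q R → ∀ i → re κ i ≈ 0# × im κ i ≈ 0#
    N-anisotropic {κ} Nκ≈0 i = norm-anisotropic (re κ i) (im κ i) (begin
      norm (re κ i) (im κ i)
        ≈⟨ solve 3 (λ d a b → (a :* a :+ a :* b) :- d :* (b :* b) := a :* (a :+ b) :+ (:- (d :* b)) :* b) ≈-refl d (re κ i) (im κ i) ⟩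
      re κ i · (re κ i +ᶠ im κ i) +ᶠ -ᶠ (d · im κ i) · im κ i
        ≈⟨ +ᶠ-cong (⊙-diagonal (re κ) (λ j → re κ j +ᶠ im κ j) i) (⊙-diagonal (λ j → -ᶠ (d · im κ j)) (im κ) i) ⟨
      N κ i i
        ≈⟨ Nκ≈0 i i ℕₚ.≤-refl ⟩
      0# ∎)
      where open ≈-Reasoning

-- Indicator of a code of weight at least 3

module Codes {c ℓ : Level} (R : CommutativeRing c ℓ) (q : ℕ) (isField : IsField R) (card : HasCardinality R q)
  (n : ℕ) (C : List (QForm R n)) (distinct : DistinctForms R C) (separated : CodeWtAtLeast R 3 C) where

  open Products R q isField card public
  private module QS = Setoid (QForm-setoid n)

  𝕏 Q : ℤ
  𝕏 = pos (q ℕ.^ n)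
  Q = pos q

  _≟ᴸ_ = Enumeration._≟_ (L-enumeration n)
  _≟Q_ = Enumeration._≟_ (QForm-enumeration n)

  ∑-const-L : ∀ k → (∑[ a ∈ 𝕃 n ] k) ≡ 𝕏 * k
  ∑-const-L k = trans (∑-const (𝕃 n) k) (cong (λ m → pos m * k) (size-L n))

  matches? : (D : List (QForm R n)) (P : QForm R n) → Dec (Any (_≈q P) D)
  matches? D P = any? (_≟Q P) D

  χ : QForm R n → ℤ
  χ P = [ matches? C P ]

  Any-resp : ∀ {D : List (QForm R n)} {P P′} → P ≈q P′ → Any (_≈q P) D → Any (_≈q P′) D
  Any-resp {P = P} {P′} P≈P′ = Any.map λ {X} X≈P → QS.trans {X} {P} {P′} X≈P P≈P′

  χ-resp : Respects (QForm-setoid n) χ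
  χ-resp {P} {P′} P≈P′ = []-cong (matches? C P) (matches? C P′) (Any-resp {P = P} {P′} P≈P′) (Any-resp {P = P′} {P} (QS.sym {P} {P′} P≈P′))

  χ-binary : ∀ P → Binary (χ P)
  χ-binary P = []-binary (matches? C P)

  χ-member : ∀ {P} → P ∈ C → χ P ≡ 1ℤ
  χ-member {P} P∈C = []-yes (matches? C P) (lose P∈C (QS.refl {P}))

  ∑-χ : (∑[ P ∈ Enumeration.elements (QForm-enumeration n) ] χ P) ≡ pos (length C)
  ∑-χ = count C distinct
    where
    count : ∀ D → DistinctForms R D → (∑[ P ∈ Enumeration.elements (QForm-enumeration n) ] [ matches? D P ]) ≡ pos (length D)
    count [] _ = ∑-zero (Enumeration.elements (QForm-enumeration n))
    count (X ∷ D) (X∉D ∷ D-distinct) = begin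
      (∑[ P ∈ Ps ] [ matches? (X ∷ D) P ])          ≡⟨ ∑-cong Ps split ⟩
      (∑[ P ∈ Ps ] ([ P ≟Q X ] + [ matches? D P ]))  ≡⟨ ∑-+ Ps (λ P → [ P ≟Q X ]) (λ P → [ matches? D P ]) ⟩
      (∑[ P ∈ Ps ] [ P ≟Q X ]) + (∑[ P ∈ Ps ] [ matches? D P ])
                                                    ≡⟨ cong₂ _+_ (Enumeration.once (QForm-enumeration n) X) (count D D-distinct) ⟩
      pos (suc (length D)) ∎
      where
      open ≡.≡-Reasoning
      Ps = Enumeration.elements (QForm-enumeration n)
      split : ∀ P → [ matches? (X ∷ D) P ] ≡ [ P ≟Q X ] + [ matches? D P ]
      split P = cases (P ≟Q X) (matches? D P)
        where
        cases : (P≟X : Dec (P ≈q X)) (P∈D : Dec (Any (_≈q P) D)) → [ matches? (X ∷ D) P ] ≡ [ P≟X ] + [ P∈D ]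
        cases (yes P≈X) (yes P∈D) = contradiction P∈D λ P∈D → let Y , Y∈D , Y≈P = find P∈D in
          All.lookup X∉D Y∈D (QS.sym {Y} {X} (QS.trans {Y} {P} {X} Y≈P P≈X))
        cases (yes P≈X) (no _) = []-yes (matches? (X ∷ D) P) (here (QS.sym {P} {X} P≈X))
        cases (no _) (yes P∈D) = []-yes (matches? (X ∷ D) P) (there P∈D)
        cases (no P≉X) (no P∉D) = []-no (matches? (X ∷ D) P)
          λ { (here X≈P) → P≉X (QS.sym {X} {P} X≈P) ; (there P∈D) → P∉D P∈D }

  ∑-χ-translate : ∀ U → (∑[ P ∈ Enumeration.elements (QForm-enumeration n) ] χ (P ⊞ U)) ≡ pos (length C)
  ∑-χ-translate U = trans (∑-reindex (QForm-enumeration n) (QForm-enumeration n) (_⊞ U) (_⊟ U)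
      (λ P P′ eq i j le → ≈-sym (≈-trans (+ᶠ-congʳ (eq i j le)) (solve 2 (λ x y → (x :+ y) :- y := x) ≈-refl (P i j) (U i j))))
      (λ P P′ eq i j le → ≈-sym (≈-trans (+ᶠ-congʳ (eq i j le)) (solve 2 (λ x y → (x :- y) :+ y := x) ≈-refl (P′ i j) (U i j))))
      (λ {P} {P′} → χ-resp {P} {P′})) ∑-χ

  -- Carries the weight condition from the listed forms to all forms equal to one of them, and
  -- states it positively: two hits of `χ` whose difference has weight below 3 coincide.
  χ-separated : ∀ {X Y} → χ X ≡ 1ℤ → χ Y ≡ 1ℤ → ∀ {k} → k ℕ.< 3 → SumOfProducts R k (X ⊟ Y) → X ≈q Y
  χ-separated {X} {Y} χX χY {k} k<3 (ps , X-Y≈ps)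
    with find ([]≡1⇒ (matches? C X) χX) | find ([]≡1⇒ (matches? C Y) χY)
  ... | X′ , X′∈C , X′≈X | Y′ , Y′∈C , Y′≈Y with X′ ≟Q Y′
  ...   | yes X′≈Y′ = λ i j le → ≈-trans (≈-sym (X′≈X i j le)) (≈-trans (X′≈Y′ i j le) (Y′≈Y i j le))
  ...   | no X′≉Y′ = contradiction
            (ps , λ i j le → ≈-trans (+ᶠ-cong (X′≈X i j le) (-‿cong (Y′≈Y i j le))) (X-Y≈ps i j le))
            (separated X′ Y′ X′∈C Y′∈C X′≉Y′ k k<3)

  -- Two hits in the coset differ by a(u - u′) + b(v - v′), of weight at most 2, so they are the
  -- same form and the difference of the pairs is a syzygy. If a_i ≠ 0, the pair is then determined
  -- by v_i. The bound is q and not 1 because each form of the coset arises from q pairs (u , v).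
  line-sum-≤ : ∀ {a b : LinForm R n} → ¬ (a ≋ 0ᴸ) → (∀ s → ¬ (b ≋ (λ j → s · a j))) → ∀ P →
    (∑[ u ∈ 𝕃 n ] ∑[ v ∈ 𝕃 n ] χ (P ⊞ a ⊙ u ⊞ b ⊙ v)) ≤ Q
  line-sum-≤ {a} {b} a≉0 b∉Fa P with nonzero-coordinate a≉0
  ... | i , ai≉0 = begin
      (∑[ u ∈ 𝕃 n ] ∑[ v ∈ 𝕃 n ] χ (P ⊞ a ⊙ u ⊞ b ⊙ v))
        ≡⟨ ∑-× (L-enumeration n) (L-enumeration n) p ⟨
      ∑ (Enumeration.elements (×-enumeration (L-enumeration n) (L-enumeration n))) p
        ≤⟨ ∑-injective (×-enumeration (L-enumeration n) (L-enumeration n)) F-enumeration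
             (λ (u , v) → v i) (λ (_ , v≈) → v≈ i) p-resp (λ (u , v) → χ-binary _) injective ⟩
      pos (Enumeration.size F-enumeration)
        ≡⟨ cong pos size-F ⟩
      Q ∎
    where
    open ℤₚ.≤-Reasoning
    p : LinForm R n × LinForm R n → ℤ
    p (u , v) = χ (P ⊞ a ⊙ u ⊞ b ⊙ v)
    p-resp : Respects (×-setoid (L-setoid n) (L-setoid n)) p
    p-resp (u≈ , v≈) = χ-resp λ j k _ → +ᶠ-cong (+ᶠ-congˡ (⊙-cong (λ _ → ≈-refl) u≈ j k)) (⊙-cong (λ _ → ≈-refl) v≈ j k)
    s = b i · proj₁ (inverse ai≉0)
    sai≈bi : s · a i ≈ b i
    sai≈bi = ≈-trans (solve 3 (λ b t a → (b :* t) :* a := b :* (a :* t)) ≈-refl (b i) (proj₁ (inverse ai≉0)) (a i))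
      (≈-trans (·-congˡ (proj₂ (inverse ai≉0))) (*-identityʳ (b i)))
    difference : ∀ u v u′ v′ j k → (P ⊞ a ⊙ u ⊞ b ⊙ v ⊟ (P ⊞ a ⊙ u′ ⊞ b ⊙ v′)) j k ≈
      (a ⊙ (λ l → u l -ᶠ u′ l) ⊞ b ⊙ (λ l → v l -ᶠ v′ l)) j k
    difference u v u′ v′ j k with j Fin.≟ k
    ... | yes _ = solve 7 (λ p a b u v u′ v′ →
          ((p :+ a :* u) :+ b :* v) :- ((p :+ a :* u′) :+ b :* v′) := a :* (u :- u′) :+ b :* (v :- v′))
          ≈-refl (P j k) (a j) (b j) (u j) (v j) (u′ j) (v′ j)
    ... | no _ = solve 13 (λ p a b u v u′ v′ a₁ b₁ u₁ v₁ u₁′ v₁′ →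
          ((p :+ (a :* u₁ :+ a₁ :* u)) :+ (b :* v₁ :+ b₁ :* v)) :- ((p :+ (a :* u₁′ :+ a₁ :* u′)) :+ (b :* v₁′ :+ b₁ :* v′))
          := (a :* (u₁ :- u₁′) :+ a₁ :* (u :- u′)) :+ (b :* (v₁ :- v₁′) :+ b₁ :* (v :- v′)))
          ≈-refl (P j k) (a j) (b j) (u j) (v j) (u′ j) (v′ j) (a k) (b k) (u k) (v k) (u′ k) (v′ k)
    injective : ∀ x y → p x ≡ 1ℤ → p y ≡ 1ℤ → proj₂ x i ≈ proj₂ y i → Setoid._≈_ (×-setoid (L-setoid n) (L-setoid n)) x y
    injective (u , v) (u′ , v′) px py vi≈v′i = (λ j → x-y≈0⇒x≈y _ _ (proj₁ zeros j)) , (λ j → x-y≈0⇒x≈y _ _ (proj₂ zeros j))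
      where
      X Y : QForm R n
      X = P ⊞ a ⊙ u ⊞ b ⊙ v
      Y = P ⊞ a ⊙ u′ ⊞ b ⊙ v′
      δu δv : LinForm R n
      δu l = u l -ᶠ u′ l
      δv l = v l -ᶠ v′ l
      X≈Y : X ≈q Y
      X≈Y = χ-separated {X} {Y} px py {2} (ℕ.s≤s (ℕ.s≤s (ℕ.s≤s ℕ.z≤n)))
        ((a , δu) ∷ (b , δv) ∷ [] , λ j k _ → ≈-trans (difference u v u′ v′ j k) (+ᶠ-congˡ (≈-sym (+-identityʳ _))))
      zeros : δu ≋ 0ᴸ × δv ≋ 0ᴸ
      zeros = syzygy {s = s} ai≉0 sai≈bi (b∉Fa s)
        (λ j k le → ≈-trans (≈-sym (difference u v u′ v′ j k)) (≈-trans (+ᶠ-congʳ (X≈Y j k le)) (-‿inverseʳ _)))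
        (≈-trans (+ᶠ-congʳ vi≈v′i) (-‿inverseʳ _))

  module _ {P₀ : QForm R n} (P₀∈C : P₀ ∈ C) where

    -- `N κ` is a sum of two products, so a second hit would force `N κ` to be zero; anisotropy then
    -- leaves only κ = 0.
    Θχ-member : Θ χ P₀ ≡ 1ℤ
    Θχ-member = trans (Sift.∑-single (KV-enumeration n) (λ κ≈λ → χ-resp λ i j _ → +ᶠ-congˡ (N-cong κ≈λ i j)) (λ _ → 0ᴷ) elsewhere)
      (trans (χ-resp (λ i j _ → ≈-trans (+ᶠ-congˡ (N-0 i j)) (+-identityʳ _))) (χ-member P₀∈C))
      where
      N-0 : ∀ i j → N {n} (λ _ → 0ᴷ) i j ≈ 0#
      N-0 i j = begin
        N (λ _ → 0ᴷ) i j                 ≈⟨ N-cong (λ _ → ∗-zeroʳ 0ᴷ) i j ⟩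
        N (0ᴷ ∗ᵛ (λ _ → 0ᴷ)) i j         ≈⟨ N-∗ 0ᴷ (λ _ → 0ᴷ) i j ⟩
        norm 0# 0# · N (λ _ → 0ᴷ) i j    ≈⟨ ≈-trans (·-congʳ norm-00) (zeroˡ _) ⟩
        0# ∎
        where open ≈-Reasoning
      elsewhere : ∀ κ → ¬ (∀ i → re κ i ≈ 0# × im κ i ≈ 0#) → χ (P₀ ⊞ N κ) ≡ 0ℤ
      elsewhere κ κ≉0 with χ-binary (P₀ ⊞ N κ)
      ... | inj₁ eq = eq
      ... | inj₂ eq = contradiction (N-anisotropic Nκ≈0) κ≉0
        where
        same : P₀ ⊞ N κ ≈q P₀
        same = χ-separated {P₀ ⊞ N κ} {P₀} eq (χ-member P₀∈C) {2} (ℕ.s≤s (ℕ.s≤s (ℕ.s≤s ℕ.z≤n)))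
          ((re κ , (λ i → re κ i +ᶠ im κ i)) ∷ ((λ i → -ᶠ (d · im κ i)) , im κ) ∷ [] ,
            λ i j _ → ≈-trans (solve 4 (λ p x y z → (p :+ (x :+ y)) :- p := x :+ (y :+ (z :- z))) ≈-refl (P₀ i j)
              ((re κ ⊙ (λ i → re κ i +ᶠ im κ i)) i j) (((λ i → -ᶠ (d · im κ i)) ⊙ im κ) i j) 0#)
              (+ᶠ-congˡ (+ᶠ-congˡ (-‿inverseʳ 0#))))
        Nκ≈0 : N κ ≈q 0Q R
        Nκ≈0 i j le = ≈-trans (solve 2 (λ p x → x := (p :+ x) :- p) ≈-refl (P₀ i j) (N κ i j))
          (≈-trans (+ᶠ-congʳ (same i j le)) (-‿inverseʳ _))

    -- The hits are the pairs with ab = 0: every b for a = 0, and only b = 0 for each of the other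
    -- q^n - 1 forms a.
    Tχ-member : T χ P₀ ≡ pos 2 * 𝕏 - 1ℤ
    Tχ-member = begin
      (∑[ a ∈ 𝕃 n ] ∑[ b ∈ 𝕃 n ] χ (P₀ ⊞ a ⊙ b))
        ≡⟨ ∑-cong (𝕃 n) (λ a → row a (a ≟ᴸ 0ᴸ)) ⟩
      (∑[ a ∈ 𝕃 n ] (1ℤ + [ a ≟ᴸ 0ᴸ ] * (𝕏 - 1ℤ)))
        ≡⟨ ∑-+ (𝕃 n) (λ _ → 1ℤ) (λ a → [ a ≟ᴸ 0ᴸ ] * (𝕏 - 1ℤ)) ⟩
      (∑[ a ∈ 𝕃 n ] 1ℤ) + (∑[ a ∈ 𝕃 n ] [ a ≟ᴸ 0ᴸ ] * (𝕏 - 1ℤ))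
        ≡⟨ cong₂ _+_ (∑-const-L 1ℤ) (trans (∑-*ʳ (𝕃 n) (𝕏 - 1ℤ) (λ a → [ a ≟ᴸ 0ᴸ ])) (cong (_* (𝕏 - 1ℤ)) (Enumeration.once (L-enumeration n) 0ᴸ))) ⟩
      𝕏 * 1ℤ + 1ℤ * (𝕏 - 1ℤ)
        ≡⟨ aux 𝕏 ⟩
      pos 2 * 𝕏 - 1ℤ ∎
      where
      open ≡.≡-Reasoning
      aux : ∀ x → x * 1ℤ + 1ℤ * (x - 1ℤ) ≡ pos 2 * x - 1ℤ
      aux = solve-∀
      row : ∀ a (a≟0 : Dec (a ≋ 0ᴸ)) → (∑[ b ∈ 𝕃 n ] χ (P₀ ⊞ a ⊙ b)) ≡ 1ℤ + [ a≟0 ] * (𝕏 - 1ℤ)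
      row a (yes a≈0) = trans
        (∑-cong (𝕃 n) λ b → trans
          (χ-resp λ i j _ → ≈-trans (+ᶠ-congˡ (≈-trans (⊙-cong a≈0 (λ _ → ≈-refl) i j) (⊙-zeroˡ b i j))) (+-identityʳ _))
          (χ-member P₀∈C))
        (trans (∑-const-L 1ℤ) (aux′ 𝕏))
        where
        aux′ : ∀ x → x * 1ℤ ≡ 1ℤ + 1ℤ * (x - 1ℤ)
        aux′ = solve-∀
      row a (no a≉0) = trans
        (Sift.∑-single (L-enumeration n) (λ b≈ → χ-resp λ i j _ → +ᶠ-congˡ (⊙-cong (λ _ → ≈-refl) b≈ i j)) 0ᴸ elsewhere)
        (trans (χ-resp λ i j _ → ≈-trans (+ᶠ-congˡ (⊙-zeroʳ a i j)) (+-identityʳ _))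
          (trans (χ-member P₀∈C) (aux′ (𝕏 - 1ℤ))))
        where
        aux′ : ∀ x → 1ℤ ≡ 1ℤ + 0ℤ * x
        aux′ = solve-∀
        elsewhere : ∀ b → ¬ (b ≋ 0ᴸ) → χ (P₀ ⊞ a ⊙ b) ≡ 0ℤ
        elsewhere b b≉0 with χ-binary (P₀ ⊞ a ⊙ b)
        ... | inj₁ eq = eq
        ... | inj₂ eq = contradiction (⊙-integral ab≈0 a≉0) b≉0
          where
          same : P₀ ⊞ a ⊙ b ≈q P₀
          same = χ-separated {P₀ ⊞ a ⊙ b} {P₀} eq (χ-member P₀∈C) {1} (ℕ.s≤s (ℕ.s≤s ℕ.z≤n))
            ((a , b) ∷ [] , λ i j _ → ≈-trans
              (solve 3 (λ p x z → (p :+ x) :- p := x :+ (z :- z)) ≈-refl (P₀ i j) ((a ⊙ b) i j) 0#)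
              (+ᶠ-congˡ (-‿inverseʳ 0#)))
          ab≈0 : a ⊙ b ≈q 0Q R
          ab≈0 i j le = ≈-trans (solve 2 (λ p x → x := (p :+ x) :- p) ≈-refl (P₀ i j) ((a ⊙ b) i j))
            (≈-trans (+ᶠ-congʳ (same i j le)) (-‿inverseʳ _))

-- Extremal codes

module LargeCodes {c ℓ : Level} (R : CommutativeRing c ℓ) (q : ℕ) (isField : IsField R) (card : HasCardinality R q)
  (n : ℕ) (C : List (QForm R n)) (distinct : DistinctForms R C) (separated : CodeWtAtLeast R 3 C)
  -- There are q^(n(n+1)/2) quadratic forms, so this is the bound q^((n-1)(n-2)/2) ≤ |C| multiplied
  -- by q^(2n), the number of pairs (u , v).
  (large : q ℕ.^ Products.triangle R q isField card n ℕ.* q ℕ.≤ q ℕ.^ n ℕ.* (q ℕ.^ n ℕ.* length C)) where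

  open Codes R q isField card n C distinct separated public

  -- Summed over all P, the left sides give q^(2n)|C|, which by `large` is at least the sum of the
  -- upper bounds `Q`. Hence no single bound is strict.
  line-sum : ∀ {a b : LinForm R n} → ¬ (a ≋ 0ᴸ) → (∀ s → ¬ (b ≋ (λ j → s · a j))) → ∀ P →
    (∑[ u ∈ 𝕃 n ] ∑[ v ∈ 𝕃 n ] χ (P ⊞ a ⊙ u ⊞ b ⊙ v)) ≡ Q
  line-sum {a} {b} a≉0 b∉Fa = Sift.∑-tight (QForm-enumeration n)
    (λ P≈P′ → ∑-cong (𝕃 n) λ u → ∑-cong (𝕃 n) λ v → χ-resp λ i j le → +ᶠ-congʳ (+ᶠ-congʳ (P≈P′ i j le)))
    (λ _ → refl) (line-sum-≤ a≉0 b∉Fa) (begin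
      (∑[ P ∈ Ps ] Q)
        ≡⟨ trans (∑-const Ps Q) (trans (cong (λ m → pos m * Q) (size-QForm n)) (sym (ℤₚ.pos-* (q ℕ.^ triangle n) q))) ⟩
      pos (q ℕ.^ triangle n ℕ.* q)
        ≤⟨ +≤+ large ⟩
      pos (q ℕ.^ n ℕ.* (q ℕ.^ n ℕ.* length C))
        ≡⟨ trans (ℤₚ.pos-* (q ℕ.^ n) _) (cong (𝕏 *_) (ℤₚ.pos-* (q ℕ.^ n) (length C))) ⟩
      𝕏 * (𝕏 * pos (length C))
        ≡⟨ trans (∑-cong (𝕃 n) λ u → ∑-const-L (pos (length C))) (∑-const-L (𝕏 * pos (length C))) ⟨
      (∑[ u ∈ 𝕃 n ] ∑[ v ∈ 𝕃 n ] pos (length C))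
        ≡⟨ ∑-cong (𝕃 n) (λ u → ∑-cong (𝕃 n) λ v → ∑-χ-translate (a ⊙ u ⊞ b ⊙ v)) ⟨
      (∑[ u ∈ 𝕃 n ] ∑[ v ∈ 𝕃 n ] ∑[ P ∈ Ps ] χ (P ⊞ (a ⊙ u ⊞ b ⊙ v)))
        ≡⟨ ∑-cong (𝕃 n) (λ u → ∑-cong (𝕃 n) λ v → ∑-cong Ps λ P → χ-resp λ i j _ →
             solve 3 (λ p x y → p :+ (x :+ y) := (p :+ x) :+ y) ≈-refl (P i j) ((a ⊙ u) i j) ((b ⊙ v) i j)) ⟩
      (∑[ u ∈ 𝕃 n ] ∑[ v ∈ 𝕃 n ] ∑[ P ∈ Ps ] χ (P ⊞ a ⊙ u ⊞ b ⊙ v))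
        ≡⟨ ∑-cong (𝕃 n) (λ u → ∑-swap Ps (𝕃 n) (λ P v → χ (P ⊞ a ⊙ u ⊞ b ⊙ v))) ⟨
      (∑[ u ∈ 𝕃 n ] ∑[ P ∈ Ps ] ∑[ v ∈ 𝕃 n ] χ (P ⊞ a ⊙ u ⊞ b ⊙ v))
        ≡⟨ ∑-swap Ps (𝕃 n) (λ P u → ∑[ v ∈ 𝕃 n ] χ (P ⊞ a ⊙ u ⊞ b ⊙ v)) ⟨
      (∑[ P ∈ Ps ] ∑[ u ∈ 𝕃 n ] ∑[ v ∈ 𝕃 n ] χ (P ⊞ a ⊙ u ⊞ b ⊙ v)) ∎)
    where
    open ℤₚ.≤-Reasoning
    Ps = Enumeration.elements (QForm-enumeration n)

  module _ (P : QForm R n) where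

    private
      G : LinForm R n → LinForm R n → ℤ
      G a b = ∑[ u ∈ 𝕃 n ] ∑[ v ∈ 𝕃 n ] χ (P ⊞ a ⊙ u ⊞ b ⊙ v)

      t : LinForm R n → ℤ
      t a = ∑[ u ∈ 𝕃 n ] χ (P ⊞ a ⊙ u)

      G-resp : ∀ a → Respects (L-setoid n) (G a)
      G-resp a b≈b′ = ∑-cong (𝕃 n) λ u → ∑-cong (𝕃 n) λ v → χ-resp λ i j _ → +ᶠ-congˡ (⊙-cong b≈b′ (λ _ → ≈-refl) i j)

      -- au + (sa)v = a(u + sv), and for each v the form u + sv runs through all linear forms.
      G-proportional : ∀ a s → G a (λ j → s · a j) ≡ 𝕏 * t a
      G-proportional a s = begin
        (∑[ u ∈ 𝕃 n ] ∑[ v ∈ 𝕃 n ] χ (P ⊞ a ⊙ u ⊞ (λ j → s · a j) ⊙ v))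
          ≡⟨ ∑-swap (𝕃 n) (𝕃 n) _ ⟩
        (∑[ v ∈ 𝕃 n ] ∑[ u ∈ 𝕃 n ] χ (P ⊞ a ⊙ u ⊞ (λ j → s · a j) ⊙ v))
          ≡⟨ ∑-cong (𝕃 n) (λ v → trans (∑-cong (𝕃 n) λ u → χ-resp λ i j _ → combine u v i j) (shifted v)) ⟩
        (∑[ v ∈ 𝕃 n ] t a)
          ≡⟨ ∑-const-L (t a) ⟩
        𝕏 * t a ∎
        where
        open ≡.≡-Reasoning
        combine : ∀ u v i j → (P ⊞ a ⊙ u ⊞ (λ j → s · a j) ⊙ v) i j ≈ (P ⊞ a ⊙ (λ k → u k +ᶠ s · v k)) i j
        combine u v i j with i Fin.≟ j
        ... | yes _ = solve 5 (λ p a s u v → (p :+ a :* u) :+ (s :* a) :* v := p :+ a :* (u :+ s :* v)) ≈-refl (P i j) (a i) s (u i) (v i)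
        ... | no _ = solve 8 (λ p a s u v a′ u′ v′ →
              (p :+ (a :* u′ :+ a′ :* u)) :+ ((s :* a) :* v′ :+ (s :* a′) :* v) :=
              p :+ (a :* (u′ :+ s :* v′) :+ a′ :* (u :+ s :* v))) ≈-refl (P i j) (a i) s (u i) (v i) (a j) (u j) (v j)
        shifted : ∀ v → (∑[ u ∈ 𝕃 n ] χ (P ⊞ a ⊙ (λ k → u k +ᶠ s · v k))) ≡ t a
        shifted v = ∑-reindex (L-enumeration n) (L-enumeration n) (λ u k → u k +ᶠ s · v k) (λ u k → u k -ᶠ s · v k)
          (λ u u′ eq k → ≈-sym (≈-trans (+ᶠ-congʳ (eq k)) (solve 2 (λ x y → (x :+ y) :- y := x) ≈-refl (u k) (s · v k))))
          (λ u u′ eq k → ≈-sym (≈-trans (+ᶠ-congʳ (eq k)) (solve 2 (λ x y → (x :- y) :+ y := x) ≈-refl (u′ k) (s · v k))))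
          (λ u≈ → χ-resp λ i j _ → +ᶠ-congˡ (⊙-cong (λ _ → ≈-refl) u≈ i j))

      S-zero : ∀ {a} → a ≋ 0ᴸ → ∑ (𝕃 n) (G a) ≡ 𝕏 * T χ P
      S-zero {a} a≈0 = begin
        (∑[ b ∈ 𝕃 n ] ∑[ u ∈ 𝕃 n ] ∑[ v ∈ 𝕃 n ] χ (P ⊞ a ⊙ u ⊞ b ⊙ v))
          ≡⟨ ∑-cong (𝕃 n) (λ b → ∑-cong (𝕃 n) λ u → ∑-cong (𝕃 n) λ v → χ-resp λ i j _ →
               +ᶠ-congʳ (≈-trans (+ᶠ-congˡ (≈-trans (⊙-cong a≈0 (λ _ → ≈-refl) i j) (⊙-zeroˡ u i j))) (+-identityʳ _))) ⟩
        (∑[ b ∈ 𝕃 n ] ∑[ u ∈ 𝕃 n ] t b)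
          ≡⟨ ∑-cong (𝕃 n) (λ b → ∑-const-L (t b)) ⟩
        (∑[ b ∈ 𝕃 n ] 𝕏 * t b)
          ≡⟨ ∑-*ˡ (𝕃 n) 𝕏 t ⟩
        𝕏 * T χ P ∎
        where open ≡.≡-Reasoning

      -- Among the q^n forms b, the q multiples of a contribute 𝕏 t(a) each and the others Q each.
      -- Therefore G - Q is supported on the multiples of a.
      S-nonzero : ∀ {a} → ¬ (a ≋ 0ᴸ) → ∑ (𝕃 n) (G a) ≡ Q * (𝕏 * t a - Q) + 𝕏 * Q
      S-nonzero {a} a≉0 with nonzero-coordinate a≉0
      ... | i , ai≉0 = begin
        ∑ (𝕃 n) (G a)
          ≡⟨ ∑-cong (𝕃 n) (λ b → trans (aux (G a b) Q) (cong (_+ Q) (multiples b))) ⟩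
        (∑[ b ∈ 𝕃 n ] ((∑[ s ∈ 𝔽 ] [ b ≟ᴸ (λ j → s · a j) ] * (𝕏 * t a - Q)) + Q))
          ≡⟨ ∑-+ (𝕃 n) (λ b → ∑[ s ∈ 𝔽 ] [ b ≟ᴸ (λ j → s · a j) ] * (𝕏 * t a - Q)) (λ _ → Q) ⟩
        (∑[ b ∈ 𝕃 n ] ∑[ s ∈ 𝔽 ] [ b ≟ᴸ (λ j → s · a j) ] * (𝕏 * t a - Q)) + (∑[ b ∈ 𝕃 n ] Q)
          ≡⟨ cong₂ _+_ (trans (∑-swap (𝕃 n) 𝔽 (λ b s → [ b ≟ᴸ (λ j → s · a j) ] * (𝕏 * t a - Q)))
               (trans (∑-cong 𝔽 λ s → trans (∑-*ʳ (𝕃 n) (𝕏 * t a - Q) (λ b → [ b ≟ᴸ (λ j → s · a j) ]))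
                 (trans (cong (_* (𝕏 * t a - Q)) (Enumeration.once (L-enumeration n) (λ j → s · a j))) (ℤₚ.*-identityˡ _)))
               (∑-const-F (𝕏 * t a - Q)))) (∑-const-L Q) ⟩
        Q * (𝕏 * t a - Q) + 𝕏 * Q ∎
        where
        open ≡.≡-Reasoning
        aux : ∀ g x → g ≡ (g - x) + x
        aux = solve-∀
        s₀ : LinForm R n → F
        s₀ b = b i · proj₁ (inverse ai≉0)
        ratio : ∀ {b s} → b ≋ (λ j → s · a j) → s ≈ s₀ b
        ratio {b} {s} b≈sa = ≈-sym (begin′
          b i · ai⁻¹            ≈⟨ ·-congʳ (b≈sa i) ⟩
          (s · a i) · ai⁻¹      ≈⟨ solve 3 (λ s a t → (s :* a) :* t := s :* (a :* t)) ≈-refl s (a i) ai⁻¹ ⟩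
          s · (a i · ai⁻¹)      ≈⟨ ·-congˡ (proj₂ (inverse ai≉0)) ⟩
          s · 1#                ≈⟨ *-identityʳ s ⟩
          s ∎′)
          where
          open ≈-Reasoning renaming (begin_ to begin′_; _∎ to _∎′)
          ai⁻¹ = proj₁ (inverse ai≉0)
        multiples : ∀ b → G a b - Q ≡ (∑[ s ∈ 𝔽 ] [ b ≟ᴸ (λ j → s · a j) ] * (𝕏 * t a - Q))
        multiples b = cases (b ≟ᴸ (λ j → s₀ b · a j))
          where
          cases : Dec (b ≋ (λ j → s₀ b · a j)) → G a b - Q ≡ (∑[ s ∈ 𝔽 ] [ b ≟ᴸ (λ j → s · a j) ] * (𝕏 * t a - Q))
          cases (yes b≈s₀a) = sym (trans (∑-*ʳ 𝔽 (𝕏 * t a - Q) (λ s → [ b ≟ᴸ (λ j → s · a j) ]))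
            (trans (cong (_* (𝕏 * t a - Q)) (trans
              (∑-cong 𝔽 λ s → []-cong (b ≟ᴸ (λ j → s · a j)) (s ≟ s₀ b) (ratio {b})
                λ s≈s₀ j → ≈-trans (b≈s₀a j) (·-congʳ (≈-sym s≈s₀)))
              (once (s₀ b))))
            (trans (ℤₚ.*-identityˡ (𝕏 * t a - Q)) (cong (_- Q) (trans (sym (G-proportional a (s₀ b)))
              (G-resp a (λ j → ≈-sym (b≈s₀a j))))))))
          cases (no b≉s₀a) = trans (ℤₚ.i≡j⇒i-j≡0 (line-sum a≉0 b∉Fa P)) (sym (trans
            (∑-cong 𝔽 λ s → trans (cong (_* (𝕏 * t a - Q)) ([]-no (b ≟ᴸ (λ j → s · a j)) (b∉Fa s))) (ℤₚ.*-zeroˡ (𝕏 * t a - Q)))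
            (∑-zero 𝔽)))
            where
            b∉Fa : ∀ s → ¬ (b ≋ (λ j → s · a j))
            b∉Fa s b≈sa = b≉s₀a λ j → ≈-trans (b≈sa j) (·-congʳ (ratio {b} b≈sa))

      t-zero : t 0ᴸ ≡ 𝕏 * χ P
      t-zero = trans (∑-cong (𝕃 n) λ u → χ-resp λ i j _ → ≈-trans (+ᶠ-congˡ (⊙-zeroˡ u i j)) (+-identityʳ _)) (∑-const-L (χ P))

    -- Rearranged, this is (T - q^n)(T - q^(n+1))χ = q(q^n - 1)(q^n - q).
    T²χ : T² χ P ≡ (Q * 𝕏 + 𝕏) * T χ P - Q * 𝕏 * 𝕏 * χ P + Q * (𝕏 - 1ℤ) * (𝕏 - Q)
    T²χ = begin
      (∑[ a ∈ 𝕃 n ] ∑ (𝕃 n) (G a))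
        ≡⟨ ∑-cong (𝕃 n) (λ a → row a (a ≟ᴸ 0ᴸ)) ⟩
      (∑[ a ∈ 𝕃 n ] ((Q * 𝕏 * t a + k₁) + [ a ≟ᴸ 0ᴸ ] * k₀))
        ≡⟨ ∑-+ (𝕃 n) (λ a → Q * 𝕏 * t a + k₁) (λ a → [ a ≟ᴸ 0ᴸ ] * k₀) ⟩
      (∑[ a ∈ 𝕃 n ] (Q * 𝕏 * t a + k₁)) + (∑[ a ∈ 𝕃 n ] [ a ≟ᴸ 0ᴸ ] * k₀)
        ≡⟨ cong₂ _+_ (trans (∑-+ (𝕃 n) (λ a → Q * 𝕏 * t a) (λ _ → k₁)) (cong₂ _+_ (∑-*ˡ (𝕃 n) (Q * 𝕏) t) (∑-const-L k₁)))
             (trans (∑-*ʳ (𝕃 n) k₀ (λ a → [ a ≟ᴸ 0ᴸ ])) (trans (cong (_* k₀) (Enumeration.once (L-enumeration n) 0ᴸ)) (ℤₚ.*-identityˡ k₀))) ⟩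
      (Q * 𝕏 * T χ P + 𝕏 * k₁) + k₀
        ≡⟨ total Q 𝕏 (T χ P) (χ P) ⟩
      (Q * 𝕏 + 𝕏) * T χ P - Q * 𝕏 * 𝕏 * χ P + Q * (𝕏 - 1ℤ) * (𝕏 - Q) ∎
      where
      open ≡.≡-Reasoning
      -- `k₁` is the constant of `S-nonzero`. `k₀` is the error of that formula at a = 0, where the
      -- sum is 𝕏 Tχ(P) and t(0) = 𝕏 χ(P).
      k₀ k₁ : ℤ
      k₁ = 𝕏 * Q - Q * Q
      k₀ = 𝕏 * T χ P - k₁ - Q * 𝕏 * (𝕏 * χ P)
      row : ∀ a (a≟0 : Dec (a ≋ 0ᴸ)) → ∑ (𝕃 n) (G a) ≡ (Q * 𝕏 * t a + k₁) + [ a≟0 ] * k₀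
      row a (yes a≈0) = trans (S-zero a≈0) (trans (aux (𝕏 * T χ P) k₁ (Q * 𝕏) (𝕏 * χ P))
        (cong (λ z → (Q * 𝕏 * z + k₁) + 1ℤ * k₀) (trans (sym t-zero)
          (∑-cong (𝕃 n) λ u → χ-resp λ i j _ → +ᶠ-congˡ (⊙-cong (λ k → ≈-sym (a≈0 k)) (λ _ → ≈-refl) i j)))))
        where
        aux : ∀ x b y z → x ≡ (y * z + b) + 1ℤ * (x - b - y * z)
        aux = solve-∀
      row a (no a≉0) = trans (S-nonzero a≉0) (aux Q 𝕏 (t a) k₀)
        where
        aux : ∀ y x z w → y * (x * z - y) + x * y ≡ (y * x * z + (x * y - y * y)) + 0ℤ * w
        aux = solve-∀
      total : ∀ y x z w → (y * x * z + x * (x * y - y * y)) + (x * z - (x * y - y * y) - y * x * (x * w)) ≡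
        (y * x + x) * z - y * x * x * w + y * (x - 1ℤ) * (x - y)
      total = solve-∀

-- Incompatibility of the eigenvalues

-- Applied with x = q^n, Q = q, y = (-q)^n and τ = ΘTχ at a point of C.
eigenvalue-comparison : ∀ x Q τ y → y ≡ x ⊎ y ≡ - x →
  x * τ + - (x * (Q * x)) * 1ℤ + x * x * - (Q * (x - Q)) ≡
    y * (x * (pos 2 * x - 1ℤ) + - (x * (Q * x)) * 1ℤ + - (Q * (x - Q))) →
  x * τ + - (x * x) * 1ℤ + x * x * - (Q * (x - 1ℤ)) ≡
    - Q * y * (x * (pos 2 * x - 1ℤ) + - (x * x) * 1ℤ + - (Q * (x - 1ℤ))) →
  pos 2 * x * ((x - 1ℤ) * (x - Q * Q)) ≡ 0ℤ ⊎ pos 2 * x * ((x - Q) * (x - Q)) ≡ 0ℤ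
eigenvalue-comparison x Q τ .x (inj₁ refl) eq₁ eq₂ = inj₁ (trans (identity x Q τ)
  (cong₂ _-_ (ℤₚ.i≡j⇒i-j≡0 eq₂) (ℤₚ.i≡j⇒i-j≡0 eq₁)))
  where
  identity : ∀ x Q τ → pos 2 * x * ((x - 1ℤ) * (x - Q * Q)) ≡
    ((x * τ + - (x * x) * 1ℤ + x * x * - (Q * (x - 1ℤ))) - - Q * x * (x * (pos 2 * x - 1ℤ) + - (x * x) * 1ℤ + - (Q * (x - 1ℤ)))) -
    ((x * τ + - (x * (Q * x)) * 1ℤ + x * x * - (Q * (x - Q))) - x * (x * (pos 2 * x - 1ℤ) + - (x * (Q * x)) * 1ℤ + - (Q * (x - Q))))
  identity = solve-∀
eigenvalue-comparison x Q τ .(- x) (inj₂ refl) eq₁ eq₂ = inj₂ (trans (identity x Q τ)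
  (cong₂ _-_ (ℤₚ.i≡j⇒i-j≡0 eq₁) (ℤₚ.i≡j⇒i-j≡0 eq₂)))
  where
  identity : ∀ x Q τ → pos 2 * x * ((x - Q) * (x - Q)) ≡
    ((x * τ + - (x * (Q * x)) * 1ℤ + x * x * - (Q * (x - Q))) - - x * (x * (pos 2 * x - 1ℤ) + - (x * (Q * x)) * 1ℤ + - (Q * (x - Q)))) -
    ((x * τ + - (x * x) * 1ℤ + x * x * - (Q * (x - 1ℤ))) - - Q * - x * (x * (pos 2 * x - 1ℤ) + - (x * x) * 1ℤ + - (Q * (x - 1ℤ))))
  identity = solve-∀

-- Here n ≥ 3 enters: q^n exceeds 1, q and q².
no-comparison : ∀ q n → 2 ℕ.≤ q → 3 ℕ.≤ n → let x = pos (q ℕ.^ n) ; Q = pos q in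
  ¬ (pos 2 * x * ((x - 1ℤ) * (x - Q * Q)) ≡ 0ℤ ⊎ pos 2 * x * ((x - Q) * (x - Q)) ≡ 0ℤ)
no-comparison q n q≥2 n≥3 = λ
  { (inj₁ eq) → product-nonzero 2x≢0 (product-nonzero (x≢ 0 refl (ℕₚ.≤-trans (ℕ.s≤s ℕ.z≤n) n≥3)) (x≢ 2 Q²≡ n≥3)) eq
  ; (inj₂ eq) → product-nonzero 2x≢0 (product-nonzero x≢Q x≢Q) eq }
  where
  x = pos (q ℕ.^ n)
  Q = pos q
  product-nonzero : ∀ {i j} → ¬ (i ≡ 0ℤ) → ¬ (j ≡ 0ℤ) → ¬ (i * j ≡ 0ℤ)
  product-nonzero {i} i≢0 j≢0 eq with ℤₚ.i*j≡0⇒i≡0∨j≡0 i eq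
  ... | inj₁ i≡0 = i≢0 i≡0
  ... | inj₂ j≡0 = j≢0 j≡0
  2x≢0 : ¬ (pos 2 * x ≡ 0ℤ)
  2x≢0 = product-nonzero {pos 2} (λ ()) λ x≡0 → ℕₚ.<-irrefl (sym (ℤₚ.+-injective x≡0))
    (ℕₚ.<-≤-trans (ℕ.s≤s ℕ.z≤n) (ℕₚ.^-monoʳ-< q q≥2 (ℕₚ.≤-trans (ℕ.s≤s ℕ.z≤n) n≥3)))
  x≢ : ∀ k {z} → z ≡ pos (q ℕ.^ k) → k ℕ.< n → ¬ (x - z ≡ 0ℤ)
  x≢ k z≡ k<n eq = ℕₚ.<-irrefl (sym (ℤₚ.+-injective (trans (ℤₚ.i-j≡0⇒i≡j x _ eq) z≡))) (ℕₚ.^-monoʳ-< q q≥2 k<n)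
  x≢Q : ¬ (x - Q ≡ 0ℤ)
  x≢Q = x≢ 1 (cong pos (sym (ℕₚ.*-identityʳ q))) (ℕₚ.≤-trans (ℕ.s≤s (ℕ.s≤s ℕ.z≤n)) n≥3)
  Q²≡ : Q * Q ≡ pos (q ℕ.^ 2)
  Q²≡ = trans (sym (ℤₚ.pos-* q q)) (cong (λ m → pos (q ℕ.* m)) (sym (ℕₚ.*-identityʳ q)))

-q^n≡±q^n : ∀ q n → (- pos q) ^ n ≡ pos (q ℕ.^ n) ⊎ (- pos q) ^ n ≡ - pos (q ℕ.^ n)
-q^n≡±q^n q zero = inj₁ refl
-q^n≡±q^n q (suc n) with -q^n≡±q^n q n
... | inj₁ eq = inj₂ (trans (cong (- pos q *_) eq) (trans (sym (ℤₚ.neg-distribˡ-* (pos q) (pos (q ℕ.^ n)))) (cong -_ (sym (ℤₚ.pos-* q (q ℕ.^ n))))))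
... | inj₂ eq = inj₁ (trans (cong (- pos q *_) eq) (trans (neg-neg (pos q) (pos (q ℕ.^ n))) (sym (ℤₚ.pos-* q (q ℕ.^ n)))))
  where
  neg-neg : ∀ a b → - a * - b ≡ a * b
  neg-neg = solve-∀

-- The two eigenfunctions and their values at a point of the code

module Contradiction {c ℓ : Level} (R : CommutativeRing c ℓ) (q : ℕ) (isField : IsField R) (card : HasCardinality R q)
  (n : ℕ) (C : List (QForm R n)) (distinct : DistinctForms R C) (separated : CodeWtAtLeast R 3 C)
  (large : q ℕ.^ Products.triangle R q isField card n ℕ.* q ℕ.≤ q ℕ.^ n ℕ.* (q ℕ.^ n ℕ.* length C)) where

  open LargeCodes R q isField card n C distinct separated large

  T∘T : ∀ f → Respects (QForm-setoid n) f → ∀ P → T (T f) P ≡ T² f P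
  T∘T f f-resp P = ∑-cong (𝕃 n) λ a → ∑-swap (𝕃 n) (𝕃 n) λ u b → ∑[ v ∈ 𝕃 n ] f (P ⊞ a ⊙ u ⊞ b ⊙ v)

  affine : ℤ → ℤ → QForm R n → ℤ
  affine β γ P = 𝕏 * T χ P + β * χ P + γ

  affine-resp : ∀ β γ → Respects (QForm-setoid n) (affine β γ)
  affine-resp β γ P≈P′ = cong (_+ γ) (cong₂ _+_
    (cong (𝕏 *_) (∑-cong (𝕃 n) λ a → ∑-cong (𝕃 n) λ b → χ-resp λ i j le → +ᶠ-congʳ (P≈P′ i j le)))
    (cong (β *_) (χ-resp P≈P′)))

  ∑-affine : ∀ {A : Set c} (xs : List A) β γ (f g : A → ℤ) → (∑[ x ∈ xs ] (𝕏 * f x + β * g x + γ)) ≡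
    𝕏 * ∑ xs f + β * ∑ xs g + (∑[ x ∈ xs ] γ)
  ∑-affine xs β γ f g = trans (∑-+ xs (λ x → 𝕏 * f x + β * g x) (λ _ → γ))
    (cong (_+ (∑[ x ∈ xs ] γ)) (trans (∑-+ xs (λ x → 𝕏 * f x) (λ x → β * g x)) (cong₂ _+_ (∑-*ˡ xs 𝕏 f) (∑-*ˡ xs β g))))

  T-affine : ∀ β γ P → T (affine β γ) P ≡ 𝕏 * T² χ P + β * T χ P + 𝕏 * (𝕏 * γ)
  T-affine β γ P = begin
    (∑[ a ∈ 𝕃 n ] ∑[ b ∈ 𝕃 n ] affine β γ (P ⊞ a ⊙ b))
      ≡⟨ ∑-cong (𝕃 n) (λ a → trans (∑-affine (𝕃 n) β γ (λ b → T χ (P ⊞ a ⊙ b)) (λ b → χ (P ⊞ a ⊙ b)))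
           (cong (𝕏 * (∑[ b ∈ 𝕃 n ] T χ (P ⊞ a ⊙ b)) + β * (∑[ b ∈ 𝕃 n ] χ (P ⊞ a ⊙ b)) +_) (∑-const-L γ))) ⟩
    (∑[ a ∈ 𝕃 n ] (𝕏 * (∑[ b ∈ 𝕃 n ] T χ (P ⊞ a ⊙ b)) + β * (∑[ b ∈ 𝕃 n ] χ (P ⊞ a ⊙ b)) + 𝕏 * γ))
      ≡⟨ ∑-affine (𝕃 n) β (𝕏 * γ) (λ a → ∑[ b ∈ 𝕃 n ] T χ (P ⊞ a ⊙ b)) (λ a → ∑[ b ∈ 𝕃 n ] χ (P ⊞ a ⊙ b)) ⟩
    𝕏 * T (T χ) P + β * T χ P + (∑[ a ∈ 𝕃 n ] 𝕏 * γ)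
      ≡⟨ cong₂ (λ z w → 𝕏 * z + β * T χ P + w) (T∘T χ (λ {P} {P′} → χ-resp {P} {P′}) P) (∑-const-L (𝕏 * γ)) ⟩
    𝕏 * T² χ P + β * T χ P + 𝕏 * (𝕏 * γ) ∎
    where open ≡.≡-Reasoning

  Θ-affine : ∀ β γ P → Θ (affine β γ) P ≡ 𝕏 * Θ (T χ) P + β * Θ χ P + 𝕏 * 𝕏 * γ
  Θ-affine β γ P = trans (∑-affine (𝕂𝕍 n) β γ (λ κ → T χ (P ⊞ N κ)) (λ κ → χ (P ⊞ N κ)))
    (cong (𝕏 * Θ (T χ) P + β * Θ χ P +_) (trans (∑-const (𝕂𝕍 n) γ)
      (cong (_* γ) (trans (cong pos (trans (size-KV n) (square-power n))) (ℤₚ.pos-* (q ℕ.^ n) (q ℕ.^ n))))))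
    where
    square-power : ∀ n → (q ℕ.* q) ℕ.^ n ≡ q ℕ.^ n ℕ.* q ℕ.^ n
    square-power n = trans (cong (λ m → (q ℕ.* m) ℕ.^ n) (sym (ℕₚ.*-identityʳ q)))
      (trans (ℕₚ.^-*-assoc q 2 n) (trans (cong (q ℕ.^_) (cong (n ℕ.+_) (ℕₚ.+-identityʳ n))) (ℕₚ.^-distribˡ-+-* q n n)))

  T²-eigen : ∀ f l → Respects (QForm-setoid n) f → (∀ P → T f P ≡ l * f P) → ∀ P → T² f P ≡ l * (l * f P)
  T²-eigen f l f-resp eigen P = begin
    T² f P                ≡⟨ T∘T f f-resp P ⟨
    T (T f) P             ≡⟨ ∑-cong (𝕃 n) (λ a → trans (∑-cong (𝕃 n) λ b → eigen (P ⊞ a ⊙ b)) (∑-*ˡ (𝕃 n) l (λ b → f (P ⊞ a ⊙ b)))) ⟩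
    (∑[ a ∈ 𝕃 n ] l * (∑[ b ∈ 𝕃 n ] f (P ⊞ a ⊙ b)))   ≡⟨ ∑-*ˡ (𝕃 n) l (λ a → ∑[ b ∈ 𝕃 n ] f (P ⊞ a ⊙ b)) ⟩
    l * T f P             ≡⟨ cong (l *_) (eigen P) ⟩
    l * (l * f P) ∎
    where open ≡.≡-Reasoning

  -- 𝕏(T - q^(n+1))χ and 𝕏(T - q^n)χ are eigenfunctions of T up to constants, for q^n and q^(n+1).
  -- As T multiplies constants by 𝕏², the corrections `γ₁` and `γ₂` are determined by `T²χ`; the
  -- overall factor 𝕏 clears their denominators.
  β₁ γ₁ β₂ γ₂ : ℤ
  β₁ = - (𝕏 * (Q * 𝕏))
  γ₁ = - (Q * (𝕏 - Q))
  β₂ = - (𝕏 * 𝕏)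
  γ₂ = - (Q * (𝕏 - 1ℤ))

  T-eigen₁ : ∀ P → T (affine β₁ γ₁) P ≡ 𝕏 * affine β₁ γ₁ P
  T-eigen₁ P = trans (T-affine β₁ γ₁ P) (trans (cong (λ z → 𝕏 * z + β₁ * T χ P + 𝕏 * (𝕏 * γ₁)) (T²χ P)) (identity 𝕏 Q (T χ P) (χ P)))
    where
    identity : ∀ x y s w → x * ((y * x + x) * s - y * x * x * w + y * (x - 1ℤ) * (x - y)) + - (x * (y * x)) * s + x * (x * - (y * (x - y))) ≡
      x * (x * s + - (x * (y * x)) * w + - (y * (x - y)))
    identity = solve-∀

  T-eigen₂ : ∀ P → T (affine β₂ γ₂) P ≡ Q * 𝕏 * affine β₂ γ₂ P
  T-eigen₂ P = trans (T-affine β₂ γ₂ P) (trans (cong (λ z → 𝕏 * z + β₂ * T χ P + 𝕏 * (𝕏 * γ₂)) (T²χ P)) (identity 𝕏 Q (T χ P) (χ P)))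
    where
    identity : ∀ x y s w → x * ((y * x + x) * s - y * x * x * w + y * (x - 1ℤ) * (x - y)) + - (x * x) * s + x * (x * - (y * (x - 1ℤ))) ≡
      y * x * (x * s + - (x * x) * w + - (y * (x - 1ℤ)))
    identity = solve-∀

  same-square : ∀ {y x} f → y ≡ x ⊎ y ≡ - x → x * (x * f) ≡ y * (y * f)
  same-square f (inj₁ refl) = refl
  same-square {x = x} f (inj₂ refl) = aux x f
    where
    aux : ∀ x f → x * (x * f) ≡ - x * (- x * f)
    aux = solve-∀

  Θ-eigen₁ : ∀ P → Θ (affine β₁ γ₁) P ≡ (- Q) ^ n * affine β₁ γ₁ P
  Θ-eigen₁ = Θ-eigenvalue n (affine β₁ γ₁) (affine-resp β₁ γ₁) λ P →
    trans (T²-eigen (affine β₁ γ₁) 𝕏 (affine-resp β₁ γ₁) T-eigen₁ P) (same-square (affine β₁ γ₁ P) (-q^n≡±q^n q n))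

  Θ-eigen₂ : ∀ P → Θ (affine β₂ γ₂) P ≡ (- Q) ^ suc n * affine β₂ γ₂ P
  Θ-eigen₂ = Θ-eigenvalue (suc n) (affine β₂ γ₂) (affine-resp β₂ γ₂) λ P →
    trans (T²-eigen (affine β₂ γ₂) (Q * 𝕏) (affine-resp β₂ γ₂) T-eigen₂ P)
      (trans (cong (λ z → z * (z * affine β₂ γ₂ P)) (sym (ℤₚ.pos-* q (q ℕ.^ n)))) (same-square (affine β₂ γ₂ P) (-q^n≡±q^n q (suc n))))

  -- At a point of C the values of χ, Tχ and Θχ are known, and only ΘTχ is not. It enters both
  -- eigenvalue equations as 𝕏 ΘTχ, so their difference eliminates it.
  no-member : 3 ℕ.≤ n → ∀ {P₀} → ¬ (P₀ ∈ C)
  no-member n≥3 {P₀} P₀∈C = no-comparison q n q≥2 n≥3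
    (eigenvalue-comparison 𝕏 Q (Θ (T χ) P₀) ((- Q) ^ n) (-q^n≡±q^n q n)
      (at-member β₁ γ₁ ((- Q) ^ n) (Θ-eigen₁ P₀)) (at-member β₂ γ₂ ((- Q) ^ suc n) (Θ-eigen₂ P₀)))
    where
    at-member : ∀ β γ y → Θ (affine β γ) P₀ ≡ y * affine β γ P₀ →
      𝕏 * Θ (T χ) P₀ + β * 1ℤ + 𝕏 * 𝕏 * γ ≡ y * (𝕏 * (pos 2 * 𝕏 - 1ℤ) + β * 1ℤ + γ)
    at-member β γ y eigen = trans (sym (trans (Θ-affine β γ P₀) (cong (λ z → 𝕏 * Θ (T χ) P₀ + β * z + 𝕏 * 𝕏 * γ) (Θχ-member P₀∈C))))
      (trans eigen (cong₂ (λ z w → y * (𝕏 * z + β * w + γ)) (Tχ-member P₀∈C) (χ-member P₀∈C)))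

theorem6p1 : ∀ {c ℓ : Level} (R : CommutativeRing c ℓ) (q : ℕ) → IsPrimePower q → IsField R → HasCardinality R q →
    (n : ℕ) → 3 ℕ.≤ n → (C : List (QForm R n)) → DistinctForms R C → CodeWtAtLeast R 3 C →
    length C ℕ.< q ℕ.^ (((n ℕ.∸ 1) ℕ.* (n ℕ.∸ 2)) ℕ./ 2)
theorem6p1 R q _ isField card n n≥3 C distinct separated =
  ℕₚ.≰⇒> λ size≥ → impossible C distinct separated size≥
  where
  open NormSums R q isField card using (q≥2)
  open Products R q isField card using (triangle)

  2*triangle : ∀ m → triangle m ℕ.* 2 ≡ suc m ℕ.* m
  2*triangle zero = refl
  2*triangle (suc m) = trans (ℕₚ.*-distribʳ-+ 2 (suc m) (triangle m)) (trans (cong (suc m ℕ.* 2 ℕ.+_) (2*triangle m)) (aux m))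
    where
    aux : ∀ m → suc m ℕ.* 2 ℕ.+ suc m ℕ.* m ≡ suc (suc m) ℕ.* suc m
    aux = ℕ-solver.solve-∀

  exponent : ∀ n → 3 ℕ.≤ n → ∃ λ m → ((n ℕ.∸ 1) ℕ.* (n ℕ.∸ 2)) ℕ./ 2 ≡ triangle m × n ≡ 2 ℕ.+ m
  exponent (suc zero) (ℕ.s≤s ())
  exponent (suc (suc m)) _ = m , trans (cong (ℕ._/ 2) (sym (2*triangle m))) (m*n/n≡m (triangle m) 2) , refl

  -- The exponents match because triangle(m + 2) + 1 = 2(m + 2) + triangle(m).
  large : ∀ D e m → e ≡ triangle m → n ≡ 2 ℕ.+ m → q ℕ.^ e ℕ.≤ D → q ℕ.^ triangle n ℕ.* q ℕ.≤ q ℕ.^ n ℕ.* (q ℕ.^ n ℕ.* D)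
  large D .(triangle m) m refl refl q^e≤D = begin
    q ℕ.^ triangle (2 ℕ.+ m) ℕ.* q                          ≡⟨ ℕₚ.*-comm _ q ⟩
    q ℕ.^ suc (triangle (2 ℕ.+ m))                          ≡⟨ cong (q ℕ.^_) (aux m (triangle m)) ⟩
    q ℕ.^ ((2 ℕ.+ m) ℕ.+ ((2 ℕ.+ m) ℕ.+ triangle m))        ≡⟨ ℕₚ.^-distribˡ-+-* q (2 ℕ.+ m) _ ⟩
    q ℕ.^ (2 ℕ.+ m) ℕ.* q ℕ.^ ((2 ℕ.+ m) ℕ.+ triangle m)    ≡⟨ cong (q ℕ.^ (2 ℕ.+ m) ℕ.*_) (ℕₚ.^-distribˡ-+-* q (2 ℕ.+ m) (triangle m)) ⟩
    q ℕ.^ (2 ℕ.+ m) ℕ.* (q ℕ.^ (2 ℕ.+ m) ℕ.* q ℕ.^ triangle m)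
      ≤⟨ ℕₚ.*-monoʳ-≤ (q ℕ.^ (2 ℕ.+ m)) (ℕₚ.*-monoʳ-≤ (q ℕ.^ (2 ℕ.+ m)) q^e≤D) ⟩
    q ℕ.^ (2 ℕ.+ m) ℕ.* (q ℕ.^ (2 ℕ.+ m) ℕ.* D) ∎
    where
    open ℕₚ.≤-Reasoning
    aux : ∀ m t → suc (suc (suc m) ℕ.+ (suc m ℕ.+ t)) ≡ (2 ℕ.+ m) ℕ.+ ((2 ℕ.+ m) ℕ.+ t)
    aux = ℕ-solver.solve-∀

  impossible : ∀ D → DistinctForms R D → CodeWtAtLeast R 3 D → q ℕ.^ (((n ℕ.∸ 1) ℕ.* (n ℕ.∸ 2)) ℕ./ 2) ℕ.≤ length D → ⊥
  -- The eigenvalue argument needs a point of C; for the empty code the bound fails already because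
  -- a power of q is positive.
  impossible [] _ _ size≤0 = ℕₚ.<-irrefl refl (ℕₚ.<-≤-trans (ℕₚ.m^n>0 q {{ℕ.>-nonZero (ℕₚ.<-trans ℕₚ.0<1+n q≥2)}} (((n ℕ.∸ 1) ℕ.* (n ℕ.∸ 2)) ℕ./ 2)) size≤0)
  impossible D@(_ ∷ _) distinct separated size≥ with exponent n n≥3
  ... | m , e≡ , n≡ = Contradiction.no-member R q isField card n D distinct separated
          (large (length D) _ m e≡ n≡ size≥) n≥3 (here refl)
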